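{- Let $\Gamma$ be a finite group that is nilpotent of class $\le n$ (in the sense defined in the context), where $n\ge 1$, and let $r\ge\max\{4^{n+1},20\}$ be an integer. Then the following are equivalent: (i) for some generating set $S$ of $\Gamma$, the $r$-local covering of the Cayley graph $\mathrm{Cay}(\Gamma,S)$ has two distinct ends that are separated by a set of at most $2$ vertices; (ii) for some generating set $S$ of $\Gamma$, the Cayley graph $\mathrm{Cay}(\Gamma,S)$ has an $r$-local separator of size $\le 2$, and $|\Gamma|>r$; (iii) $\Gamma$ is isomorphic to $C_i\times C_j$ for some integer $i>r$ and some $j\in\{1,2\}$, where $C_m$ denotes the cyclic group of order $m$.
   Context: Generating sets $S$ of a group $\Gamma$ do not contain the identity $\mathbb{I}$ and are closed under inverses. The Cayley graph $\mathrm{Cay}(\Gamma,S)$ is the simple graph with vertex set $\Gamma$ and edges $\{g,gs\}$ for $g\in\Gamma$, $s\in S$. Two elements $g,h$ are equivalent, $g\equiv h$, if $g=h$ or $g=h^{ -1}$. Nilpotency (as used in the paper): for $g,h\in\Gamma$ define the words $[g,h]_1:=gh^{ -1}g^{ -1}h$ and recursively $[g,h]_n:=[g,[g,h]_{n-1}]_1$ (i.e. $g\,[g,h]_{n-1}^{ -1}\,g^{ -1}\,[g,h]_{n-1}$, freely reduced). $\Gamma$ is nilpotent of class $\le n$ if $[g,h]_n$ evaluates to $\mathbb{I}$ in $\Gamma$ for all $g,h\in\Gamma$ with $g\not\equiv h$. Balls: for a graph $G$, a vertex $v$ and integer $r$, the ball $B_r(v)$ is the subgraph of $G$ consisting of all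 vertices and edges lying on closed walks of length at most $r$ through $v$. A vertex $v$ is an $r$-local cutvertex if $B_r(v)-v$ is disconnected. For two vertices $v_0,v_1$, with $N(\{v_0,v_1\})$ the set of vertices outside $\{v_0,v_1\}$ adjacent to $v_0$ or $v_1$, the connectivity graph $C_r(v_0,v_1)$ has vertex set $N(\{v_0,v_1\})$, and $a,b$ are adjacent if for some $i\in\{0,1\}$ they lie in the same component of $B_r(v_i)-v_0-v_1$. The set $\{v_0,v_1\}$ (with $v_0\ne v_1$) is an $r$-local $2$-separator if $C_r(v_0,v_1)$ is disconnected and the distance between $v_0$ and $v_1$ in $G$ is at most $r/2$. An $r$-local separator of size $\le 2$ is a set $\{v\}$ with $v$ an $r$-local cutvertex, or an $r$-local $2$-separator. $r$-local covering: for a connected graph $G$ with base vertex $v_0$, consider the fundamental group $\pi_1(G,v_0)$ of closed walks at $v_0$ up to homotopy (insertion/removal of backtracks), and its subgroup generated by all classes of closed walks $WCW^{ -1}$ where $C$ is a closed walk of length at most $r$ and $W$ is a walk from $v_0$ to the start of $C$. The $r$-local covering $G_r$ of $G$ is the covering graph of $G$ corresponding to this (normal) subgroup. Ends of a graph are equivalence classes of rays, two rays being equivalent if no finite vertex set separates them; two ends are separated by a finite vertex set $X$ if tails of their rays lie in distinct components of $G_r-X$. -}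

module Defs where

open import Data.Nat using (ℕ; zero; suc; _+_; _*_; _≤_; _<_)
open import Data.Nat.DivMod using (_mod_)
open import Data.Fin using (Fin; toℕ)
open import Data.Fin.Subset using (Subset; _∈_; _∉_)
open import Data.List using (List; []; _∷_; length; foldr)
open import Data.List.Relation.Unary.All using (All)
import Data.List.Membership.Propositional as LM
open import Data.Product using (Σ; ∃; _×_; _,_; proj₁; proj₂)
open import Data.Sum using (_⊎_)
open import Relation.Nullary using (¬_)
open import Relation.Binary.PropositionalEquality using (_≡_; _≢_)
open import Relation.Binary.Construct.Closure.ReflexiveTransitive using (Star)
open import Relation.Binary.Construct.Closure.Equivalence using (EqClosure)
open import Algebra.Structures using (IsGroup)
open import Function.Definitions using (Bijective)

record FinGroup : Set where
  field
    N       : ℕ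
    _∙_     : Fin N → Fin N → Fin N
    ε       : Fin N
    _⁻¹     : Fin N → Fin N
    isGroup : IsGroup _≡_ _∙_ ε _⁻¹

module _ (Γ : FinGroup) where
  open FinGroup Γ

  comm1 : Fin N → Fin N → Fin N
  comm1 g h = g ∙ ((h ⁻¹) ∙ ((g ⁻¹) ∙ h))

  comm : ℕ → Fin N → Fin N → Fin N
  comm zero    g h = h
  comm (suc k) g h = comm1 g (comm k g h)

  NilpotentClass≤ : ℕ → Set
  NilpotentClass≤ n = ∀ g h → g ≢ h → g ≢ (h ⁻¹) → comm n g h ≡ ε

  prod : List (Fin N) → Fin N
  prod = foldr _∙_ ε

  IsGeneratingSet : Subset N → Set
  IsGeneratingSet S =
    (ε ∉ S) × (∀ x → x ∈ S → (x ⁻¹) ∈ S) ×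
    (∀ g → Σ (List (Fin N)) λ xs → All (_∈ S) xs × prod xs ≡ g)

  CayAdj : Subset N → Fin N → Fin N → Set
  CayAdj S g h = Σ (Fin N) λ s → s ∈ S × h ≡ g ∙ s

addMod : ∀ {m} → Fin m → Fin m → Fin m
addMod {suc m} a b = (toℕ a + toℕ b) mod (suc m)

IsoToCyclicProduct : (Γ : FinGroup) → ℕ → ℕ → Set
IsoToCyclicProduct Γ i j =
  Σ (Fin N → Fin i × Fin j) λ φ →
    Bijective _≡_ _≡_ φ ×
    (∀ x y → φ (x ∙ y) ≡ (addMod (proj₁ (φ x)) (proj₁ (φ y)) , addMod (proj₂ (φ x)) (proj₂ (φ y))))
  where open FinGroup Γ

module Walks {V : Set} (E : V → V → Set) where

  data Walk : V → V → Set where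
    []  : ∀ {v} → Walk v v
    _∷_ : ∀ {u w v} → E u w → Walk w v → Walk u v

  len : ∀ {u v} → Walk u v → ℕ
  len []      = 0
  len (_ ∷ W) = suc (len W)

  verts : ∀ {u v} → Walk u v → List V
  verts {u} []      = u ∷ []
  verts {u} (_ ∷ W) = u ∷ verts W

  edges : ∀ {u v} → Walk u v → List (V × V)
  edges []                = []
  edges {u} (_∷_ {w = w} _ W) = (u , w) ∷ edges W

  _++ʷ_ : ∀ {u w v} → Walk u w → Walk w v → Walk u v
  []      ++ʷ W' = W'
  (e ∷ W) ++ʷ W' = e ∷ (W ++ʷ W')

module LocalSep {V : Set} (E : V → V → Set) (r : ℕ) where
  open Walks E
  open LM using () renaming (_∈_ to _∈ₗ_; _∉_ to _∉ₗ_)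

  InBall : V → V → Set
  InBall v x = Σ (Walk v v) λ C → len C ≤ r × x ∈ₗ verts C

  BallEdge : V → V → V → Set
  BallEdge v x y = Σ (Walk v v) λ C → len C ≤ r × ((x , y) ∈ₗ edges C ⊎ (y , x) ∈ₗ edges C)

  BallStep : V → List V → V → V → Set
  BallStep v D x y = BallEdge v x y × x ∉ₗ D × y ∉ₗ D

  SameComp : V → List V → V → V → Set
  SameComp v D a b = InBall v a × InBall v b × a ∉ₗ D × b ∉ₗ D × Star (BallStep v D) a b

  LocalCutvertex : V → Set
  LocalCutvertex v = Σ V λ a → Σ V λ b →
    InBall v a × InBall v b × a ≢ v × b ≢ v × ¬ Star (BallStep v (v ∷ [])) a b

  InNbhd : V → V → V → Set
  InNbhd v0 v1 a = a ≢ v0 × a ≢ v1 × (E v0 a ⊎ E v1 a)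

  ConnAdj : V → V → V → V → Set
  ConnAdj v0 v1 a b = InNbhd v0 v1 a × InNbhd v0 v1 b ×
    (SameComp v0 (v0 ∷ v1 ∷ []) a b ⊎ SameComp v1 (v0 ∷ v1 ∷ []) a b)

  Local2Separator : V → V → Set
  Local2Separator v0 v1 = v0 ≢ v1 ×
    (Σ V λ a → Σ V λ b → InNbhd v0 v1 a × InNbhd v0 v1 b × ¬ Star (ConnAdj v0 v1) a b) ×
    (Σ (Walk v0 v1) λ W → 2 * len W ≤ r)

  HasLocalSeparator≤2 : Set
  HasLocalSeparator≤2 = (Σ V LocalCutvertex) ⊎ (Σ V λ v0 → Σ V λ v1 → Local2Separator v0 v1)

-- The r-local covering G_r of (G, v0): vertices are walks from v0,
-- identified up to the equivalence generated by inserting/removing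
-- closed walks of length ≤ r (and backtracks) anywhere in the walk.

module LocalCover {V : Set} (E : V → V → Set) (v0 : V) (r : ℕ) where
  open Walks E

  CV : Set
  CV = Σ V (Walk v0)

  data Move : CV → CV → Set where
    cycle     : ∀ {a v} (W₁ : Walk v0 a) (C : Walk a a) (W₂ : Walk a v) → len C ≤ r →
                Move (v , W₁ ++ʷ (C ++ʷ W₂)) (v , W₁ ++ʷ W₂)
    backtrack : ∀ {a b v} (W₁ : Walk v0 a) (e : E a b) (e' : E b a) (W₂ : Walk a v) →
                Move (v , W₁ ++ʷ (e ∷ (e' ∷ W₂))) (v , W₁ ++ʷ W₂)

  _≈ᶜ_ : CV → CV → Set
  _≈ᶜ_ = EqClosure Move

  CAdj : CV → CV → Set
  CAdj (a , W) (b , W') = Σ (E a b) λ e → (b , W') ≈ᶜ (b , W ++ʷ (e ∷ []))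

module Ends {V : Set} (_≈_ : V → V → Set) (Adj : V → V → Set) where

  Avoids : List V → V → Set
  Avoids X x = All (λ y → ¬ (x ≈ y)) X

  StepAvoiding : List V → V → V → Set
  StepAvoiding X x y = Avoids X x × Avoids X y × (Adj x y ⊎ x ≈ y)

  IsRay : (ℕ → V) → Set
  IsRay f = (∀ k → Adj (f k) (f (suc k))) × (∀ i j → f i ≈ f j → i ≡ j)

  -- two (necessarily distinct) ends, represented by rays f and g, separated by X:
  -- tails of f and g lie in distinct components of G - X
  SeparatedBy : (ℕ → V) → (ℕ → V) → List V → Set
  SeparatedBy f g X = Σ ℕ λ n → ∀ m k → n ≤ m → n ≤ k →
    Avoids X (f m) × Avoids X (g k) × ¬ Star (StepAvoiding X) (f m) (g k)

  TwoEndsSeparatedBy≤2 : Set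
  TwoEndsSeparatedBy≤2 = Σ (ℕ → V) λ f → Σ (ℕ → V) λ g → IsRay f × IsRay g ×
    Σ (List V) λ X → length X ≤ 2 × SeparatedBy f g X

module _ (Γ : FinGroup) (r : ℕ) where
  open FinGroup Γ

  CondI : Set
  CondI = Σ (Subset N) λ S → IsGeneratingSet Γ S ×
    (let open LocalCover (CayAdj Γ S) ε r in Ends.TwoEndsSeparatedBy≤2 _≈ᶜ_ CAdj)

  CondII : Set
  CondII = Σ (Subset N) λ S → IsGeneratingSet Γ S ×
    LocalSep.HasLocalSeparator≤2 (CayAdj Γ S) r × r < N

  CondIII : Set
  CondIII = Σ ℕ λ i → Σ ℕ λ j → r < i × (j ≡ 1 ⊎ j ≡ 2) × IsoToCyclicProduct Γ i j

{-# OPTIONS --safe #-}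
module Submission where

-- The r-local cover of Cay(Γ,S) is the Cayley graph of Γ′ = ⟨S | relations of Γ of length ≤ r⟩.  A local separator of
-- Cay(Γ,S) lifts to a separator of the cover, because every closed walk of length ≤ r crosses it an even number of times.
-- Take a separator X = {1 , v} of the cover with v as short as possible (v = 1 for a cutvertex).  By minimality no
-- translate of X crosses X, so assigning to g the sides of X on which gX and g⁻¹X lie gives a type that multiplies as
-- in a free product.  Nilpotency says that iterating x ↦ x g x⁻¹ from any h ends at g; for words g, h with
-- |g| + |h| ≤ 10 this also holds in Γ′, and ping-pong refutes it if g lies on one side of X in both directions and h on
-- the other.  Applied to conjugates of generators this leaves only S ⊆ ⟨s⟩⟨u⟩ with u² = 1 and su = us, where the order
-- of s in Γ exceeds r as no power of s is trivial in Γ′.  Conversely, the generators s^±¹, t of C_i × C_j with i > r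
-- carry a height (the exponent of s) which short closed walks preserve, and the at most two vertices at height 0 separate.

open import Defs
open import Algebra.Bundles using (Group)
open import Data.Bool using (Bool; true; false; not; _xor_)
import Data.Bool as Bool
open import Data.Bool.Properties using (not-¬; ¬-not; xor-comm; xor-identityʳ; xor-same; xor-assoc)
open import Data.Empty using (⊥; ⊥-elim)
open import Data.Fin using (Fin; toℕ; fromℕ<; splitAt; _↑ˡ_; _↑ʳ_) renaming (zero to fzero; suc to fsuc)
import Data.Fin.Properties as Fin
open import Data.Fin.Subset using (Subset; _∈_)
open import Data.Fin.Subset.Properties using (_∈?_)
open import Data.List using (List; []; _∷_; _++_; length; foldr; replicate; take; drop)
import Data.List.Membership.Propositional as LM
import Data.List.Properties as List
open import Data.Nat using (ℕ; zero; suc; pred; _+_; _*_; _^_; _∸_; _≤_; _<_; z≤n; s≤s; NonZero; >-nonZero)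
open import Data.Nat.DivMod using (_%_; _/_; m≡m%n+[m/n]*n; m%n<n; m<n⇒m%n≡m; %-distribˡ-+)
open import Data.Nat.Induction using (<-wellFounded)
import Data.Nat.Properties as ℕ
open import Data.Nat.Solver using (module +-*-Solver)
open import Data.Product using (Σ; _×_; _,_; proj₁; proj₂)
open import Data.Sum using (_⊎_; inj₁; inj₂; [_,_]′)
open import Data.Vec using (Vec; lookup; tabulate) renaming ([] to []ᵥ; _∷_ to _∷ᵥ_)
open import Data.Vec.Properties using (lookup∘tabulate; []=⇒lookup; lookup⇒[]=)
open import Function using (_∘_; case_of_)
open import Induction.WellFounded using (Acc; acc)
open import Level using (0ℓ)
open import Relation.Binary.Construct.Closure.Equivalence as EqC using (EqClosure)
open import Relation.Binary.Construct.Closure.ReflexiveTransitive as Star using (Star; _◅_; _◅◅_)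
open import Relation.Binary.Construct.Closure.Symmetric using (fwd; bwd)
open import Relation.Binary.PropositionalEquality as ≡ using (_≡_; _≢_; cong; cong₂; subst)
open import Relation.Nullary using (¬_; Dec; yes; no)
open import Relation.Nullary.Decidable using (¬¬-excluded-middle; decidable-stable; does; dec-true; _×-dec_; _⊎-dec_; ¬?)

-- Nothing here decides equality in Γ′, so the cover is analysed under double negation throughout.
-- The result becomes constructive because the description of Γ that comes out is a bounded search
-- in a finite group, hence decidable. The constants: a relation of Γ holds in Γ′ once its length is
-- at most r, and comparing the n-fold iterated conjugation with g takes 2ⁿ(|g| + |h|) letters. If v
-- has more than 3 letters, the words in play are too short to meet it and it is ignored; otherwise
-- the longest pair needed is s v s⁻¹ and s⁻¹ v s, with 5 + 5 letters. Hence the requirement 10 · 2ⁿ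
-- ≤ r. Two degenerate situations are treated apart. If S has at most two elements, the corner
-- argument has no third letter to use; then Γ is cyclic, or generated by two involutions and too
-- small. If the generator s has to be v itself, its order is not controlled by short words; but
-- then Γ is cyclic, and |Γ| > r bounds the order from below. For the covering condition |Γ| > r is
-- itself derived: for |Γ| ≤ r the cover would be finite.

em : {P : Set} → ¬ ¬ Dec P
em = ¬¬-excluded-middle

ret : {P : Set} → P → ¬ ¬ P
ret p k = k p

-- Free reduction decides the equations that hold in all groups.
module GroupSolver (G : Group 0ℓ 0ℓ) where
  open Group G
  open import Algebra.Properties.Group G using (⁻¹-anti-homo-∙; ε⁻¹≈ε; ⁻¹-involutive)

  infixl 7 _⊙_
  infix 8 _⁻

  data Expr (k : ℕ) : Set where
    var  : Fin k → Expr k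
    𝟙    : Expr k
    _⊙_  : Expr k → Expr k → Expr k
    _⁻   : Expr k → Expr k

  ⟦_⟧ : ∀ {k} → Expr k → Vec Carrier k → Carrier
  ⟦ var i ⟧ ρ = lookup ρ i
  ⟦ 𝟙 ⟧     ρ = ε
  ⟦ x ⊙ y ⟧ ρ = ⟦ x ⟧ ρ ∙ ⟦ y ⟧ ρ
  ⟦ x ⁻ ⟧   ρ = ⟦ x ⟧ ρ ⁻¹

  private
    signed : Bool → Carrier → Carrier
    signed true  x = x
    signed false x = x ⁻¹

    eval : ∀ {k} → Vec Carrier k → List (Bool × Fin k) → Carrier
    eval ρ []            = ε
    eval ρ ((b , i) ∷ l) = signed b (lookup ρ i) ∙ eval ρ l

    push : ∀ {k} → Bool → Fin k → List (Bool × Fin k) → List (Bool × Fin k)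
    push b i []            = (b , i) ∷ []
    push b i ((c , j) ∷ l) with i Fin.≟ j | b | c
    ... | yes _ | true  | false = l
    ... | yes _ | false | true  = l
    ... | _     | _     | _     = (b , i) ∷ (c , j) ∷ l

    -- The Boolean is the sign of the exponent; `l` accumulates the reduced word standing to the
    -- right.
    nf : ∀ {k} → Bool → Expr k → List (Bool × Fin k) → List (Bool × Fin k)
    nf b     (var i) l = push b i l
    nf b     𝟙       l = l
    nf true  (x ⊙ y) l = nf true x (nf true y l)
    nf false (x ⊙ y) l = nf false y (nf false x l)
    nf b     (x ⁻)   l = nf (not b) x l

    push-sound : ∀ {k} (ρ : Vec Carrier k) b i l → eval ρ (push b i l) ≈ signed b (lookup ρ i) ∙ eval ρ l
    push-sound ρ b i [] = refl
    push-sound ρ b i ((c , j) ∷ l) with i Fin.≟ j | b | c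
    ... | yes ≡.refl | true  | false = sym (trans (sym (assoc _ _ _)) (trans (∙-congʳ (inverseʳ _)) (identityˡ _)))
    ... | yes ≡.refl | false | true  = sym (trans (sym (assoc _ _ _)) (trans (∙-congʳ (inverseˡ _)) (identityˡ _)))
    ... | yes _ | true  | true  = refl
    ... | yes _ | false | false = refl
    ... | no _  | true  | true  = refl
    ... | no _  | true  | false = refl
    ... | no _  | false | true  = refl
    ... | no _  | false | false = refl

    nf-sound : ∀ {k} (ρ : Vec Carrier k) b x l → eval ρ (nf b x l) ≈ signed b (⟦ x ⟧ ρ) ∙ eval ρ l
    nf-sound ρ b     (var i) l = push-sound ρ b i l
    nf-sound ρ true  𝟙 l = sym (identityˡ _)
    nf-sound ρ false 𝟙 l = sym (trans (∙-congʳ ε⁻¹≈ε) (identityˡ _))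
    nf-sound ρ true (x ⊙ y) l = trans (nf-sound ρ true x _)
      (trans (∙-congˡ (nf-sound ρ true y l)) (sym (assoc _ _ _)))
    nf-sound ρ false (x ⊙ y) l = trans (nf-sound ρ false y _)
      (trans (∙-congˡ (nf-sound ρ false x l))
      (trans (sym (assoc _ _ _)) (∙-congʳ (sym (⁻¹-anti-homo-∙ _ _)))))
    nf-sound ρ true  (x ⁻) l = nf-sound ρ false x l
    nf-sound ρ false (x ⁻) l = trans (nf-sound ρ true x l) (∙-congʳ (sym (⁻¹-involutive _)))

  solve : ∀ {k} (ρ : Vec Carrier k) (x y : Expr k) → nf true x [] ≡ nf true y [] → ⟦ x ⟧ ρ ≈ ⟦ y ⟧ ρ
  solve ρ x y eq = trans (sym (back x)) (trans (reflexive (cong (eval ρ) eq)) (back y))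
    where
    back : ∀ z → eval ρ (nf true z []) ≈ ⟦ z ⟧ ρ
    back z = trans (nf-sound ρ true z []) (identityʳ _)

  open import Algebra.Properties.Group G public
    using (⁻¹-anti-homo-∙; ⁻¹-involutive; ∙-cancelˡ; ∙-cancelʳ; \\-leftDividesˡ; \\-leftDividesʳ; //-rightDividesˡ; //-rightDividesʳ)

  x₀ : ∀ {k} → Expr (1 + k)
  x₀ = var fzero

  x₁ : ∀ {k} → Expr (2 + k)
  x₁ = var (fsuc fzero)

  x₂ : ∀ {k} → Expr (3 + k)
  x₂ = var (fsuc (fsuc fzero))

  x₃ : ∀ {k} → Expr (4 + k)
  x₃ = var (fsuc (fsuc (fsuc fzero)))

  inv-conj : ∀ x y → x ∙ y ⁻¹ ∙ x ⁻¹ ≈ (x ∙ y ∙ x ⁻¹) ⁻¹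
  inv-conj x y = solve (x ∷ᵥ y ∷ᵥ []ᵥ) (x₀ ⊙ x₁ ⁻ ⊙ x₀ ⁻) ((x₀ ⊙ x₁ ⊙ x₀ ⁻) ⁻) ≡.refl

  ε-comm : ∀ x → ε ∙ x ≈ x ∙ ε
  ε-comm x = trans (identityˡ x) (sym (identityʳ x))

-- Separators of a Cayley graph

-- Instantiated by the group of words of the cover, whose equality is a double negation. It is not
-- assumed decidable; `stable` still allows an equation to be proved by contradiction.
record LetterGroup : Set₁ where
  field
    group : Group 0ℓ 0ℓ
  open Group group public
  field
    stable : ∀ {x y} → ¬ ¬ (x ≈ y) → x ≈ y
    A      : Set
    ι      : A → Carrier
    bar    : A → A
    ι-bar  : ∀ a → ι (bar a) ≈ ι a ⁻¹
    ι≉ε    : ∀ a → ¬ ι a ≈ ε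
    spell  : ∀ g → Σ (List A) λ l → foldr (λ a → ι a ∙_) ε l ≈ g

  ∏ : List A → Carrier
  ∏ = foldr (λ a → ι a ∙_) ε

  ∏-++ : ∀ B B′ → ∏ (B ++ B′) ≈ ∏ B ∙ ∏ B′
  ∏-++ [] B′ = sym (identityˡ _)
  ∏-++ (a ∷ B) B′ = trans (∙-congˡ (∏-++ B B′)) (sym (assoc _ _ _))

  ∏-empty : ∀ l → length l ≡ 0 → ∏ l ≈ ε
  ∏-empty [] _ = refl

module Paths (L : LetterGroup) where
  open LetterGroup L
  open GroupSolver group

  -- The start p itself is not required to avoid F.
  data Path (F : Carrier → Set) : Carrier → Carrier → Set where
    here : ∀ {p q} → p ≈ q → Path F p q
    step : ∀ {p q} a p′ → p′ ≈ p ∙ ι a → ¬ F p′ → Path F p′ q → Path F p q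

  Pair : Carrier → Carrier → Carrier → Set
  Pair x y q = q ≈ x ⊎ q ≈ y

  Resp : (Carrier → Set) → Set
  Resp F = ∀ {p q} → p ≈ q → F p → F q

  pair-resp : ∀ {x y} → Resp (Pair x y)
  pair-resp eq (inj₁ h) = inj₁ (trans (sym eq) h)
  pair-resp eq (inj₂ h) = inj₂ (trans (sym eq) h)

  path-resp : ∀ {F p p′ q} → p ≈ p′ → Path F p q → Path F p′ q
  path-resp eq (here h) = here (trans (sym eq) h)
  path-resp eq (step a p′ h nf P) = step a p′ (trans h (∙-congʳ eq)) nf P

  infixl 5 _⊕_
  _⊕_ : ∀ {F p q t} → Path F p q → Path F q t → Path F p t
  here h ⊕ Q = path-resp (sym h) Q
  step a p′ h nf P ⊕ Q = step a p′ h nf (P ⊕ Q)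

  cancel-letter : ∀ {p p′} a → p′ ≈ p ∙ ι a → p ≈ p′ ∙ ι (bar a)
  cancel-letter {p} {p′} a h = sym (trans (∙-congˡ (ι-bar a)) (trans (∙-congʳ h)
    (solve (p ∷ᵥ ι a ∷ᵥ []ᵥ) ((x₀ ⊙ x₁) ⊙ x₁ ⁻) x₀ ≡.refl)))

  path-rev : ∀ {F p q} → ¬ F p → Path F p q → Path F q p
  path-rev nF (here h) = here (sym h)
  path-rev nF (step a p′ h nf P) = path-rev nf P ⊕ step (bar a) _ (cancel-letter a h) nF (here refl)

  path-end : ∀ {F p q} → Resp F → ¬ F p → Path F p q → ¬ F q
  path-end rs nF (here h) = nF ∘ rs (sym h)
  path-end rs nF (step a p′ h nf P) = path-end rs nf P

  path-mono : ∀ {F F′ p q} → (∀ {t} → F′ t → F t) → Path F p q → Path F′ p q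
  path-mono m (here h) = here h
  path-mono m (step a p′ h nf P) = step a p′ h (nf ∘ m) (path-mono m P)

  -- Every vertex of the path is itself reachable from `c` outside `F`, so it is not in `F′`. This
  -- turns a path around one separator into a path around another.
  path-avoid : ∀ {F F′ c q} → (∀ {t} → F′ t → ¬ Path F c t) → Path F c q → Path F′ c q
  path-avoid {F} {F′} {c} un = go (here refl)
    where
    go : ∀ {p q} → Path F c p → Path F p q → Path F′ p q
    go C (here h) = here h
    go C (step a p′ h nf P) = let C′ = C ⊕ step a p′ h nf (here refl) in
      step a p′ h (λ f → un f C′) (go C′ P)

  pair-translate : ∀ {x y p q} g → Path (Pair x y) p q → Path (Pair (g ∙ x) (g ∙ y)) (g ∙ p) (g ∙ q)
  pair-translate g (here h) = here (∙-congˡ h)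
  pair-translate {x} {y} g (step {p} a p′ h nf P) =
    step a (g ∙ p′) (trans (∙-congˡ h) (sym (assoc _ _ _))) (nf ∘ back) (pair-translate g P)
    where
    back : Pair (g ∙ x) (g ∙ y) (g ∙ p′) → Pair x y p′
    back (inj₁ h) = inj₁ (∙-cancelˡ g _ _ h)
    back (inj₂ h) = inj₂ (∙-cancelˡ g _ _ h)

  -- The path is cut just before its first visit to `x`. If the letter `a` makes that visit, the
  -- vertex before it is `x ∙ ι (bar a)`, whence the inverse letter in the result.
  path-truncate : ∀ {F p} x → Resp F → ¬ F p → ¬ p ≈ x → Path F p x →
    ¬ ¬ Σ A λ a → ¬ F (x ∙ ι a) × ¬ x ∙ ι a ≈ x × Path (λ q → F q ⊎ q ≈ x) p (x ∙ ι a)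
  path-truncate x rs nF n≈ (here h) k = n≈ h
  path-truncate x rs nF n≈ (step {p} a p′ h nf P) k = em λ
    { (yes eq) → let p≈ = trans (cancel-letter a h) (∙-congʳ eq) in
        k (bar a , nF ∘ rs (sym p≈) , (n≈ ∘ trans p≈) , here p≈)
    ; (no neq) → path-truncate x rs nf neq P λ (b , nFb , nb , Q) →
        k (b , nFb , nb , step a p′ h (λ { (inj₁ f) → nf f ; (inj₂ f) → neq f }) Q) }

  path-spell : ∀ p l → Path (λ _ → ⊥) p (p ∙ ∏ l)
  path-spell p [] = here (sym (identityʳ p))
  path-spell p (a ∷ l) = step a (p ∙ ι a) refl (λ ()) (path-spell (p ∙ ι a) l ⊕ here (assoc _ _ _))

  connected : ∀ p q → Path (λ _ → ⊥) p q
  connected p q with spell (p ⁻¹ ∙ q)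
  ... | l , eq = path-spell p l ⊕ here (trans (∙-congˡ eq) (\\-leftDividesˡ p q))

  -- The first visit to `F` cuts the word in two. Applied to `V`, this produces the shorter words to
  -- which minimality is applied.
  path-hits : ∀ {F} p l → Resp F → ¬ F p → ¬ Path F p (p ∙ ∏ l) →
    ¬ ¬ Σ (List A) λ B → Σ (List A) λ B′ → l ≡ B ++ B′ × F (p ∙ ∏ B)
  path-hits p [] rs nF nP k = nP (here (sym (identityʳ p)))
  path-hits {F} p (a ∷ l) rs nF nP k = em λ
    { (yes f) → k (a ∷ [] , l , ≡.refl , rs (∙-congˡ (sym (identityʳ _))) f)
    ; (no nf) → path-hits (p ∙ ι a) l rs nf
        (λ P → nP (step a (p ∙ ι a) refl nf (P ⊕ here (assoc _ _ _))))
        λ (B , B′ , eq , f) → k (a ∷ B , B′ , cong (a ∷_) eq , rs (assoc _ _ _) f) }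

-- The empty word encodes a cutvertex, both points of the pair being `ε` then. `branching` says that
-- the degree is at least three: a vertex adjacent to both points of the separator still has a
-- neighbour outside it.
record MinimalSeparator (L : LetterGroup) : Set where
  open LetterGroup L
  open Paths L
  field
    V         : List A
    p₀ q₀     : Carrier
    p₀∉       : ¬ Pair ε (∏ V) p₀
    q₀∉       : ¬ Pair ε (∏ V) q₀
    separated : ¬ Path (Pair ε (∏ V)) p₀ q₀
    minimal   : ∀ B → length B < length V → ∀ {p q} →
                ¬ Pair ε (∏ B) p → ¬ Pair ε (∏ B) q → ¬ ¬ Path (Pair ε (∏ B)) p q
    branching : 0 < length V → ∀ x y → ¬ ¬ Σ A λ a → ¬ ι a ≈ x × ¬ ι a ≈ y

module Nested (L : LetterGroup) (M : MinimalSeparator L) where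
  open LetterGroup L
  open GroupSolver group
  open Paths L
  open MinimalSeparator M

  v : Carrier
  v = ∏ V

  X : Carrier → Set
  X = Pair ε v

  -- Left translation moves `x` to `ε`, and {ε} is the pair of the empty word, which is shorter than
  -- `V`.
  no-cutvertex : 0 < length V → ∀ x {p q} → ¬ p ≈ x → ¬ q ≈ x → ¬ ¬ Path (Pair x x) p q
  no-cutvertex 0<V x {p} {q} np nq k = minimal [] 0<V (shift np) (shift nq) λ P →
    k (path-resp (back p) (path-mono to (pair-translate x P) ⊕ here (back q)))
    where
    back : ∀ p → x ∙ (x ⁻¹ ∙ p) ≈ p
    back p = \\-leftDividesˡ x p
    shift : ∀ {p} → ¬ p ≈ x → ¬ Pair ε ε (x ⁻¹ ∙ p)
    shift {p} n (inj₁ h) = n (trans (sym (back p)) (trans (∙-congˡ h) (identityʳ x)))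
    shift {p} n (inj₂ h) = n (trans (sym (back p)) (trans (∙-congˡ h) (identityʳ x)))
    to : ∀ {t} → Pair x x t → Pair (x ∙ ε) (x ∙ ε) t
    to (inj₁ h) = inj₁ (trans h (sym (identityʳ x)))
    to (inj₂ h) = inj₁ (trans h (sym (identityʳ x)))

  v≉ε : 0 < length V → ¬ v ≈ ε
  v≉ε 0<V eq = no-cutvertex 0<V ε (p₀∉ ∘ inj₁) (q₀∉ ∘ inj₁) λ P → separated (path-mono to P)
    where
    to : ∀ {t} → X t → Pair ε ε t
    to (inj₁ h) = inj₁ h
    to (inj₂ h) = inj₁ (trans h eq)

  Neighbour : Carrier → Carrier → Set
  Neighbour x p = Σ A λ a → ¬ X (x ∙ ι a) × Path X p (x ∙ ι a)

  -- Otherwise the other vertex of X would be a cutvertex.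
  reaches : ∀ {x p} → X x → ¬ X p → ¬ ¬ Neighbour x p
  reaches {x} {p} Xx nX k with length V in eq
  ... | zero = path-truncate x (λ _ f → f) (λ ()) (λ h → nX (pair-resp (sym h) Xx)) (connected p x)
      λ (a , _ , na , P) → k (a , na ∘ X⇒x , path-mono (inj₂ ∘ X⇒x) P)
    where
    X⇒ε : ∀ {t} → X t → t ≈ ε
    X⇒ε (inj₁ h) = h
    X⇒ε (inj₂ h) = trans h (∏-empty V eq)
    X⇒x : ∀ {t} → X t → t ≈ x
    X⇒x h = trans (X⇒ε h) (sym (X⇒ε Xx))
  ... | suc _ = around Xx
    where
    0<V : 0 < length V
    0<V = subst (0 <_) (≡.sym eq) (s≤s z≤n)
    via : ∀ y → ¬ p ≈ y → ¬ x ≈ y → ¬ p ≈ x → (∀ {t} → X t → Pair y y t ⊎ t ≈ x) → ⊥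
    via y p≉ x≉ p≉x cover = no-cutvertex 0<V y p≉ x≉ λ P →
      path-truncate x pair-resp (λ { (inj₁ h) → p≉ h ; (inj₂ h) → p≉ h }) p≉x P
      λ (a , nF , na , Q) → k (a , (λ Xa → case cover Xa of λ { (inj₁ f) → nF f ; (inj₂ f) → na f }) , path-mono cover Q)
    around : X x → ⊥
    around (inj₁ h) = via v (nX ∘ inj₂) (λ e → v≉ε 0<V (trans (sym e) h)) (λ e → nX (inj₁ (trans e h)))
      λ { (inj₁ f) → inj₂ (trans f (sym h)) ; (inj₂ f) → inj₁ (inj₁ f) }
    around (inj₂ h) = via ε (nX ∘ inj₁) (λ e → v≉ε 0<V (trans (sym h) e)) (λ e → nX (inj₂ (trans e h)))
      λ { (inj₁ f) → inj₁ (inj₁ f) ; (inj₂ f) → inj₂ (trans f (sym h)) }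

  into : ∀ {F p x} → ¬ F x → (a : A) → Path F p (x ∙ ι a) → Path F p x
  into nF a P = P ⊕ step (bar a) _ (cancel-letter a refl) nF (here refl)

  module _ (g : Carrier) where
    X∙ : Carrier → Set
    X∙ = Pair g (g ∙ v)

    to-X∙ : ∀ {p q} → Path X p q → Path X∙ (g ∙ p) (g ∙ q)
    to-X∙ P = path-mono (λ { (inj₁ h) → inj₁ (trans h (sym (identityʳ g))) ; (inj₂ h) → inj₂ h }) (pair-translate g P)

    from-X∙ : ∀ {p q} → Path X∙ (g ∙ p) (g ∙ q) → Path X p q
    from-X∙ {p} {q} P = path-resp (canc p) (path-mono to (pair-translate (g ⁻¹) P) ⊕ here (canc q))
      where
      canc : ∀ p → g ⁻¹ ∙ (g ∙ p) ≈ p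
      canc p = \\-leftDividesʳ g p
      to : ∀ {t} → X t → Pair (g ⁻¹ ∙ g) (g ⁻¹ ∙ (g ∙ v)) t
      to (inj₁ h) = inj₁ (trans h (sym (inverseˡ g)))
      to (inj₂ h) = inj₂ (trans h (sym (canc v)))

    X∙⇒X : ∀ {p} → X∙ (g ∙ p) → X p
    X∙⇒X (inj₁ h) = inj₁ (∙-cancelˡ g _ _ (trans h (sym (identityʳ g))))
    X∙⇒X (inj₂ h) = inj₂ (∙-cancelˡ g _ _ h)

    reaches∙ : ∀ {x p} → X∙ x → ¬ X∙ p → ¬ ¬ Σ A λ a → ¬ X∙ (x ∙ ι a) × Path X∙ p (x ∙ ι a)
    reaches∙ {x} {p} Xx nX k = reaches (move Xx) (λ h → nX (move′ h)) λ (a , na , P) →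
      k (a , (λ h → na (pair-resp (ass a) (X∙⇒X (pair-resp (re a) h)))) ,
         path-resp (back p) (to-X∙ P) ⊕ here (sym (trans (re a) (∙-congˡ (ass a)))))
      where
      back : ∀ p → g ∙ (g ⁻¹ ∙ p) ≈ p
      back p = \\-leftDividesˡ g p
      move : ∀ {p} → X∙ p → X (g ⁻¹ ∙ p)
      move {p} h = X∙⇒X (pair-resp (sym (back p)) h)
      move′ : ∀ {p} → X (g ⁻¹ ∙ p) → X∙ p
      move′ {p} (inj₁ h) = inj₁ (trans (sym (back p)) (trans (∙-congˡ h) (identityʳ g)))
      move′ {p} (inj₂ h) = inj₂ (trans (sym (back p)) (∙-congˡ h))
      re : ∀ a → x ∙ ι a ≈ g ∙ (g ⁻¹ ∙ (x ∙ ι a))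
      re a = sym (back _)
      ass : ∀ a → g ⁻¹ ∙ (x ∙ ι a) ≈ (g ⁻¹ ∙ x) ∙ ι a
      ass a = sym (assoc _ _ _)

  -- X and its translate gX do not cross: otherwise a corner of the two separations would be
  -- separated by a pair {x , c} closer together than X.
  nested : ∀ g → ¬ X g → ¬ X (g ∙ v) → ¬ ¬ Path X g (g ∙ v)
  nested g ng ngv crossing with length V in eq
  ... | zero = crossing (here (sym (trans (∙-congˡ (∏-empty V eq)) (identityʳ g))))
  ... | suc _ = path-hits ε V pair-resp nYε (λ P → separates (λ k → k (P ⊕ here (identityˡ v))))
      λ (B , B′ , V≡ , Yc) → corner B B′ V≡ (pair-resp (identityˡ _) Yc)
    where
    0<V : 0 < length V
    0<V = subst (0 <_) (≡.sym eq) (s≤s z≤n)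

    Y : Carrier → Set
    Y = X∙ g

    disjoint : ∀ {t} → X t → Y t → ⊥
    disjoint Xt (inj₁ h) = ng (pair-resp h Xt)
    disjoint Xt (inj₂ h) = ngv (pair-resp h Xt)

    nYε : ¬ Y ε
    nYε = disjoint (inj₁ refl)
    nYv : ¬ Y v
    nYv = disjoint (inj₂ refl)

    separates : ¬ ¬ ¬ Path Y ε v
    separates cn = cn λ εv → em λ
      { (no nP) → apart εv (g ∙ p₀) (p₀∉ ∘ X∙⇒X g) nP
      ; (yes P) → em λ
        { (no nQ) → apart εv (g ∙ q₀) (q₀∉ ∘ X∙⇒X g) nQ
        ; (yes Q) → separated (from-X∙ g (P ⊕ path-rev (q₀∉ ∘ X∙⇒X g) Q)) } }
      where
      -- The component of `c` outside `Y` misses both points of `X`, since these lie together in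
      -- another one. Being adjacent to both points of `Y`, it joins them outside `X`.
      apart : Path Y ε v → ∀ c → ¬ Y c → ¬ Path Y c ε → ⊥
      apart εv c nY nP =
        reaches∙ g {g} (inj₁ refl) nY λ (a , _ , P) →
        reaches∙ g {g ∙ v} (inj₂ refl) nY λ (a′ , _ , P′) →
        crossing (path-rev nXc (into ng a (avoid P)) ⊕ into ngv a′ (avoid P′))
        where
        unreachable : ∀ {t} → X t → ¬ Path Y c t
        unreachable (inj₁ h) P = nP (P ⊕ here h)
        unreachable (inj₂ h) P = nP (P ⊕ here h ⊕ path-rev nYε εv)
        avoid : ∀ {q} → Path Y c q → Path X c q
        avoid = path-avoid unreachable
        nXc : ¬ X c
        nXc h = unreachable h (here refl)

    nεv : ¬ Path Y ε v
    nεv P = separates (λ n → n P)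

    crossing′ : ∀ {c c′} → Y c → Y c′ → ¬ c ≈ c′ → ¬ Path X c c′
    crossing′ (inj₁ h) (inj₁ h′) n P = n (trans h (sym h′))
    crossing′ (inj₂ h) (inj₂ h′) n P = n (trans h (sym h′))
    crossing′ (inj₁ h) (inj₂ h′) n P = crossing (path-resp h (P ⊕ here h′))
    crossing′ (inj₂ h) (inj₁ h′) n P = crossing (path-rev ngv (path-resp h (P ⊕ here h′)))

    other : ∀ {c} → Y c → Σ Carrier λ c′ → Y c′ × ¬ c ≈ c′ × (∀ {t} → Y t → t ≈ c ⊎ t ≈ c′)
    other (inj₁ h) = g ∙ v , inj₂ refl , (λ e → v≉ε 0<V (∙-cancelˡ g _ _ (sym (trans (identityʳ g) (trans (sym h) e))))) ,
      λ { (inj₁ f) → inj₁ (trans f (sym h)) ; (inj₂ f) → inj₂ f }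
    other (inj₂ h) = g , inj₁ refl , (λ e → v≉ε 0<V (∙-cancelˡ g _ _ (trans (sym h) (trans e (sym (identityʳ g)))))) ,
      λ { (inj₁ f) → inj₂ f ; (inj₂ f) → inj₁ (trans f (sym h)) }

    corner : ∀ B B′ → V ≡ B ++ B′ → Y (∏ B) → ⊥
    corner B B′ V≡ Yc with other Yc
    -- The two elements that the letter must differ from are those leading from `c` into `X`.
    ... | c′ , Yc′ , c≉c′ , only = branching 0<V (c ⁻¹) (c ⁻¹ ∙ v) λ (a , na , na′) →
      at a (λ { (inj₁ h) → na (∙-cancelˡ c _ _ (trans h (sym (inverseʳ c))))
              ; (inj₂ h) → na′ (∙-cancelˡ c _ _ (trans h (sym (back v)))) })
      where
      c : Carrier
      c = ∏ B
      back : ∀ p → c ∙ (c ⁻¹ ∙ p) ≈ p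
      back p = \\-leftDividesˡ c p
      cB′ : c ∙ ∏ B′ ≈ v
      cB′ = trans (sym (∏-++ B B′)) (reflexive (cong ∏ (≡.sym V≡)))
      nXc : ¬ X c
      nXc h = disjoint h Yc
      nXc′ : ¬ X c′
      nXc′ h = disjoint h Yc′
      0<B : ∀ B → ¬ ∏ B ≈ ε → 0 < length B
      0<B [] n = ⊥-elim (n refl)
      0<B (_ ∷ _) n = s≤s z≤n
      |V| : length V ≡ length B + length B′
      |V| = ≡.trans (cong length V≡) (List.length-++ B)
      B<V : length B < length V
      B<V = subst (length B <_) (≡.sym |V|) (ℕ.m<m+n _ (0<B B′ λ h → nXc (inj₂ (trans (sym (identityʳ c)) (trans (∙-congˡ (sym h)) cB′)))))
      B′<V : length B′ < length V
      B′<V = subst (length B′ <_) (≡.sym |V|) (ℕ.m<n+m _ (0<B B λ h → nXc (inj₁ h)))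

      -- The pairs `X` and `Y` cut the graph into corners. The corner of `p` is bounded by `c` and
      -- by the only point of `X` that can lie on its side of `Y`: `ε` in the first case, `v` in the
      -- second. Both bounding pairs are spelled by proper pieces of `V`, so minimality leads `p`
      -- out to `c′`, which `trapped` forbids.
      at : ∀ a → ¬ X (c ∙ ι a) → ⊥
      at a nXp = em λ
        { (yes P) → minimal B B<V
            (λ { (inj₁ h) → nXp (inj₁ h) ; (inj₂ h) → nYp (pair-resp (sym h) Yc) })
            (λ { (inj₁ h) → nXc′ (inj₁ h) ; (inj₂ h) → c≉c′ (sym h) })
            (trapped ε v (λ { (inj₁ h) → inj₁ h ; (inj₂ h) → inj₂ h }) nYv (λ Q → nεv (path-rev nYp P ⊕ Q))
              (λ { (inj₁ h) → inj₁ h ; (inj₂ h) → inj₂ h }) (here refl) (here refl))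
        ; (no nP) → minimal B′ B′<V
            (shift (λ { (inj₁ h) → nYp (pair-resp (sym h) Yc) ; (inj₂ h) → nXp (inj₂ h) }))
            (shift (λ { (inj₁ h) → c≉c′ (sym h) ; (inj₂ h) → nXc′ (inj₂ h) }))
            λ P → trapped v ε (λ { (inj₁ h) → inj₂ h ; (inj₂ h) → inj₁ h }) nYε nP
              (λ { (inj₁ h) → inj₂ (trans h (sym cB′)) ; (inj₂ h) → inj₁ (trans h (sym (identityʳ c))) })
              (here refl) (here refl) (path-resp (back p) (pair-translate c P ⊕ here (back c′))) }
        where
        p : Carrier
        p = c ∙ ι a
        cp : Path X c p
        cp = step a p refl nXp (here refl)
        nYp : ¬ Y p
        nYp h with only h
        ... | inj₁ e = ι≉ε a (∙-cancelˡ c _ _ (trans e (sym (identityʳ c))))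
        ... | inj₂ e = crossing′ Yc Yc′ c≉c′ (cp ⊕ here e)
        shift : ∀ {t} → ¬ Pair c v t → ¬ Pair ε (∏ B′) (c ⁻¹ ∙ t)
        shift {t} n (inj₁ h) = n (inj₁ (trans (sym (back t)) (trans (∙-congˡ h) (identityʳ c))))
        shift {t} n (inj₂ h) = n (inj₂ (trans (sym (back t)) (trans (∙-congˡ h) cB′)))
        -- A path that avoids `x` and `c` leaves neither its side of `X` nor its side of `Y`: the
        -- other point `x′` of `X` lies across `Y`, and the other point `c′` of `Y` lies across `X`.
        trapped : ∀ x x′ → (∀ {t} → X t → t ≈ x ⊎ t ≈ x′) → ¬ Y x′ → ¬ Path Y p x′ →
          ∀ {F} → (∀ {t} → Pair x c t → F t) → ∀ {p′} → Path X p p′ → Path Y p p′ → ¬ Path F p′ c′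
        trapped x x′ cov nYx′ np cF PX PY (here h) = crossing′ Yc Yc′ c≉c′ (cp ⊕ PX ⊕ here h)
        trapped x x′ cov nYx′ np cF PX PY (step b q h nF Q) =
          trapped x x′ cov nYx′ np cF (PX ⊕ step b q h nX (here refl)) (PY ⊕ step b q h nY (here refl)) Q
          where
          nY : ¬ Y q
          nY f with only f
          ... | inj₁ e = nF (cF (inj₂ e))
          ... | inj₂ e = crossing′ Yc Yc′ c≉c′ (cp ⊕ PX ⊕ step b q h (λ Xq → nXc′ (pair-resp e Xq)) (here e))
          nX : ¬ X q
          nX f with cov f
          ... | inj₁ e = nF (cF (inj₁ e))
          ... | inj₂ e = np (PY ⊕ step b q h nY (here e))

-- Types of group elements relative to a separator

module IteratedConjugation (G : Group 0ℓ 0ℓ) where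
  open Group G

  -- For k ≥ 1 the paper's [g , h⁻¹]ₖ equals g (iterConj k g h)⁻¹.
  iterConj : ℕ → Carrier → Carrier → Carrier
  iterConj zero    g h = h
  iterConj (suc k) g h = iterConj k g h ∙ g ∙ iterConj k g h ⁻¹

module Engel (L : LetterGroup) where
  open LetterGroup L
  open IteratedConjugation group public
  open GroupSolver group

  Len : ℕ → Carrier → Set
  Len i g = Σ (List A) λ l → length l ≤ i × ∏ l ≈ g

  EngelUpTo : ℕ → ℕ → Set
  EngelUpTo m n = ∀ {i j g h} → Len i g → Len j h → i + j ≤ m → iterConj n g h ≈ g

  len-weaken : ∀ {i j g} → i ≤ j → Len i g → Len j g
  len-weaken i≤j (l , le , eq) = l , ℕ.≤-trans le i≤j , eq

  len-resp : ∀ {i g h} → g ≈ h → Len i g → Len i h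
  len-resp g≈h (l , le , eq) = l , le , trans eq g≈h

  len-ι : ∀ a → Len 1 (ι a)
  len-ι a = a ∷ [] , s≤s z≤n , identityʳ _

  len-ε : Len 0 ε
  len-ε = [] , z≤n , refl

  private
    inv : List A → List A
    inv [] = []
    inv (a ∷ l) = inv l ++ bar a ∷ []

    ∏-inv : ∀ l → ∏ (inv l) ≈ ∏ l ⁻¹
    ∏-inv [] = solve []ᵥ 𝟙 (𝟙 ⁻) ≡.refl
    ∏-inv (a ∷ l) = trans (∏-++ (inv l) _) (trans (∙-cong (∏-inv l) (∙-congʳ (ι-bar a)))
      (solve (ι a ∷ᵥ ∏ l ∷ᵥ []ᵥ) (x₁ ⁻ ⊙ (x₀ ⁻ ⊙ 𝟙)) ((x₀ ⊙ x₁) ⁻) ≡.refl))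

    length-inv : ∀ l → length (inv l) ≡ length l
    length-inv [] = ≡.refl
    length-inv (a ∷ l) = ≡.trans (List.length-++ (inv l)) (≡.trans (ℕ.+-comm _ 1) (cong suc (length-inv l)))

  len-∙ : ∀ {i j g h} → Len i g → Len j h → Len (i + j) (g ∙ h)
  len-∙ (l , le , eq) (l′ , le′ , eq′) = l ++ l′ ,
    subst (_≤ _) (≡.sym (List.length-++ l)) (ℕ.+-mono-≤ le le′) , trans (∏-++ l l′) (∙-cong eq eq′)

  len-⁻¹ : ∀ {i g} → Len i g → Len i (g ⁻¹)
  len-⁻¹ (l , le , eq) = inv l , subst (_≤ _) (≡.sym (length-inv l)) le , trans (∏-inv l) (⁻¹-cong eq)

-- A side may be a union of several components. This freedom is used when `v` is an involution: the
-- side is then an orbit of components under `v`.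
record IsSide (L : LetterGroup) (M : MinimalSeparator L) (Q : LetterGroup.Carrier L → Set) : Set where
  open LetterGroup L
  open Paths L
  open Nested L M
  field
    Q-stable : ∀ {p} → ¬ ¬ Q p → Q p
    Q∉X      : ∀ {p} → Q p → ¬ X p
    Q-path   : ∀ {p q} → Q p → Path X p q → Q q
    inside   : Σ Carrier Q
    outside  : Σ Carrier λ p → ¬ X p × ¬ Q p

module Sides (L : LetterGroup) (M : MinimalSeparator L)
             (Q : LetterGroup.Carrier L → Set) (isSide : IsSide L M Q) where
  open LetterGroup L
  open GroupSolver group
  open Paths L
  open Nested L M
  open Engel L
  open IsSide isSide

  Side : Bool → Carrier → Set
  Side true  p = Q p
  Side false p = ¬ X p × ¬ Q p

  side∉ : ∀ b {p} → Side b p → ¬ X p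
  side∉ true  = Q∉X
  side∉ false = proj₁

  side-stable : ∀ b {p} → ¬ ¬ Side b p → Side b p
  side-stable true  s = Q-stable s
  side-stable false s = (λ x → s λ (n , _) → n x) , (λ q → s λ (_ , n) → n q)

  side-unique : ∀ {b b′ p} → b ≢ b′ → Side b p → Side b′ p → ⊥
  side-unique {true}  {true}  n s t = n ≡.refl
  side-unique {true}  {false} n s t = proj₂ t s
  side-unique {false} {true}  n s t = proj₂ s t
  side-unique {false} {false} n s t = n ≡.refl

  side-path : ∀ b {p q} → Side b p → Path X p q → Side b q
  side-path true  s P = Q-path s P
  side-path false (n , s) P = path-end pair-resp n P , λ q → s (Q-path q (path-rev n P))

  side-resp : ∀ b {p q} → p ≈ q → Side b p → Side b q
  side-resp b eq s = side-path b s (here eq)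

  side-total : ∀ {p} → ¬ X p → ¬ ¬ Σ Bool λ b → Side b p
  side-total n k = em λ { (yes q) → k (true , q) ; (no q) → k (false , n , q) }

  side-step : ∀ b {p} a → Side b p → ¬ X (p ∙ ι a) → Side b (p ∙ ι a)
  side-step b a s n = side-path b s (step a _ refl n (here refl))

  -- The points `p` and `p ∙ v` form a translate of `X`, which does not cross `X`.
  side-v : ∀ b {p} → Side b p → ¬ X (p ∙ v) → Side b (p ∙ v)
  side-v b s n = side-stable b λ k → nested _ (side∉ b s) n λ P → k (side-path b s P)

  side-v⁻¹ : ∀ b {p} → Side b p → ¬ X (p ∙ v ⁻¹) → Side b (p ∙ v ⁻¹)
  side-v⁻¹ b {p} s n = side-stable b λ k → nested _ n (side∉ b s ∘ pair-resp eq) λ P →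
      k (side-path b s (path-resp eq (path-rev n P)))
    where
    eq : (p ∙ v ⁻¹) ∙ v ≈ p
    eq = //-rightDividesˡ v p

  side-letter : ∀ b → ¬ ¬ Σ A λ a → Side b (ι a)
  side-letter b k = reaches {ε} (inj₁ refl) (side∉ b (proj₂ (some b))) λ (a , n , P) →
      k (a , side-path b (proj₂ (some b)) (P ⊕ here (identityˡ _)))
    where
    some : ∀ b → Σ Carrier (Side b)
    some true  = inside
    some false = outside

  -- `T g b`: gX ≠ X, and the part of gX outside X lies on side b of X.
  record T (g : Carrier) (b : Bool) : Set where
    constructor mkT
    field
      moved : ¬ (X g × X (g ∙ v))
      at-g  : ¬ X g → Side b g
      at-gv : ¬ X (g ∙ v) → Side b (g ∙ v)

  T-side : ∀ {b g} → Side b g → T g b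
  T-side {b} s = mkT (λ (x , _) → side∉ b s x) (λ _ → s) (side-v b s)

  T-sideᵛ : ∀ {b g} → Side b (g ∙ v) → T g b
  T-sideᵛ {b} {g} s = mkT (λ (_ , x) → side∉ b s x)
    (λ n → side-resp b eq (side-v⁻¹ b s (n ∘ pair-resp eq))) (λ _ → s)
    where
    eq : (g ∙ v) ∙ v ⁻¹ ≈ g
    eq = //-rightDividesʳ v g

  side-T : ∀ {b g} → ¬ X g → T g b → Side b g
  side-T n t = T.at-g t n

  T-resp : ∀ {b g h} → g ≈ h → T g b → T h b
  T-resp {b} eq (mkT n s t) = mkT
    (λ (x , y) → n (pair-resp (sym eq) x , pair-resp (sym (∙-congʳ eq)) y))
    (λ n → side-resp b eq (s (n ∘ pair-resp eq)))
    (λ n → side-resp b (∙-congʳ eq) (t (n ∘ pair-resp (∙-congʳ eq))))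

  T-unique : ∀ {b b′ g} → b ≢ b′ → T g b → T g b′ → ⊥
  T-unique ne (mkT n s t) (mkT _ s′ t′) = em λ
    { (no k)  → side-unique ne (s k) (s′ k)
    ; (yes x) → em λ { (no k) → side-unique ne (t k) (t′ k) ; (yes y) → n (x , y) } }

  -- As `g ⁻¹` takes `X` to side `b′`, no path from `g ∙ p` around gX meets `X`. Such a path leads
  -- to a neighbour of gX, and gX lies on side `c`.
  translate-side : ∀ {b b′ c g p} → b ≢ b′ → T g c → T (g ⁻¹) b′ → Side b p → Side c (g ∙ p)
  translate-side {b} {b′} {c} {g} {p} ne (mkT n s t) (mkT _ s′ t′) sp = side-stable c λ k → em λ
    { (no nX) → go k {ε} (inj₁ refl) (nX ∘ pair-resp (identityʳ g)) (side-resp c (sym (identityʳ g)) (s nX))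
    ; (yes x) → em λ { (no nX) → go k {v} (inj₂ refl) nX (t nX) ; (yes y) → n (x , y) } }
    where
    back : ∀ t → g ∙ (g ⁻¹ ∙ t) ≈ t
    back t = \\-leftDividesˡ g t
    unreachable : ∀ {t} → X t → ¬ Path (X∙ g) (g ∙ p) t
    unreachable {t₁} x P = clash x (side-path b sp (from-X∙ g (P ⊕ here (sym (back t₁)))))
      where
      clash : X t₁ → Side b (g ⁻¹ ∙ t₁) → ⊥
      clash (inj₁ h) σ = let σ′ = side-resp b (trans (∙-congˡ h) (identityʳ _)) σ in
        side-unique ne σ′ (s′ (side∉ b σ′))
      clash (inj₂ h) σ = let σ′ = side-resp b (∙-congˡ h) σ in side-unique ne σ′ (t′ (side∉ b σ′))
    go : ¬ Side c (g ∙ p) → ∀ {x} → X x → ¬ X (g ∙ x) → Side c (g ∙ x) → ⊥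
    go k {x} Xx nX σ = reaches Xx (side∉ b sp) λ (a , _ , P) →
      k (side-path c σ (path-rev (λ x → unreachable x (here refl))
        (into nX a (path-avoid unreachable (to-X∙ g P) ⊕ here (sym (assoc _ _ _))))))

  -- As for reduced words in a free product: if the end of `g` and the beginning of `h` do not
  -- cancel, the product begins like `g`.
  T-∙ : ∀ {b b′ c g h} → b ≢ b′ → T g c → T (g ⁻¹) b′ → T h b → T (g ∙ h) c
  T-∙ {b} {b′} {c} {g} {h} ne Tg Tg′ (mkT n s t) = mkT
    (λ (x , y) → em λ
      { (no k) → side∉ c (translate-side ne Tg Tg′ (s k)) x
      ; (yes k) → em λ { (no l) → side∉ c (translate-side ne Tg Tg′ (t l)) (pair-resp (assoc _ _ _) y)
                       ; (yes l) → n (k , l) } })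
    (point s) (λ n → side-resp c (sym (assoc _ _ _)) (point t (n ∘ pair-resp (sym (assoc _ _ _)))))
    where
    point : ∀ {x} → (¬ X x → Side b x) → ¬ X (g ∙ x) → Side c (g ∙ x)
    point {x} s n = side-stable c λ k → em λ
      { (no nX) → k (translate-side ne Tg Tg′ (s nX))
      ; (yes (inj₁ h)) → let e = trans (∙-congˡ h) (identityʳ g) in
          k (side-resp c (sym e) (T.at-g Tg (n ∘ pair-resp (sym e))))
      ; (yes (inj₂ h)) → let e = ∙-congˡ h in
          k (side-resp c (sym e) (T.at-gv Tg (n ∘ pair-resp (sym e)))) }

  -- The analogue of a reduced word that begins and ends in the same free factor.
  Hom : Carrier → Bool → Set
  Hom g b = T g b × T (g ⁻¹) b

  Hom-conj : ∀ {b b′ g h} → b ≢ b′ → Hom g b → Hom h b′ → Hom (h ∙ g ∙ h ⁻¹) b′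
  Hom-conj {b} {b′} {g} {h} ne (g₁ , g₂) (h₁ , h₂) =
    conj g₁ g₂ , T-resp (inv-conj h g)
      (conj g₂ (T-resp (sym (⁻¹-involutive g)) g₁))
    where
    conj : ∀ {g} → T g b → T (g ⁻¹) b → T (h ∙ g ∙ h ⁻¹) b′
    conj {g} g₁ g₂ = T-∙ (ne ∘ ≡.sym) (T-∙ ne h₁ h₂ g₁)
      (T-resp (sym (⁻¹-anti-homo-∙ h g))
        (T-∙ (ne ∘ ≡.sym) g₂ (T-resp (sym (⁻¹-involutive g)) g₁) h₂)) h₂

  module _ {n : ℕ} (engel : EngelUpTo 10 n) where
    no-clash : ∀ {b b′ i j g h} → b ≢ b′ → Hom g b → Hom h b′ → Len i g → Len j h → i + j ≤ 10 → ⊥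
    no-clash {b} {b′} {g = g} {h} ne Hg Hh lg lh le =
      T-unique ne (proj₁ Hg) (T-resp (engel lg lh le) (proj₁ (iter n)))
      where
      iter : ∀ k → Hom (iterConj k g h) b′
      iter zero = Hh
      iter (suc k) = Hom-conj ne Hg (iter k)

-- Generators permitted by the position of the separator

module Generated (G : Group 0ℓ 0ℓ) where
  open Group G

  power : Carrier → ℕ → Carrier
  power s zero    = ε
  power s (suc k) = s ∙ power s k

  data Gen (s u : Carrier) : Carrier → Set where
    nil : ∀ {g} → g ≈ ε → Gen s u g
    _·s_ : ∀ {g h} → Gen s u g → h ≈ g ∙ s → Gen s u h
    _·s⁻¹_ : ∀ {g h} → Gen s u g → h ≈ g ∙ s ⁻¹ → Gen s u h
    _·u_ : ∀ {g h} → Gen s u g → h ≈ g ∙ u → Gen s u h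

-- In the first alternative of `kind` a vanishing power of `s` in Γ is a closed word of letters, so
-- the cover controls the order of `s`. In the second, `s` may be the word `v` of several letters;
-- since `u` is trivial the group is then cyclic, and its size controls the order.
record Generators (L : LetterGroup) : Set where
  open LetterGroup L
  open Generated group
  field
    s u       : Carrier
    commute   : s ∙ u ≈ u ∙ s
    u²        : u ∙ u ≈ ε
    generates : ∀ a → ¬ ¬ Gen s u (ι a)
    kind      : (Σ A λ a → s ≈ ι a × ∀ k → ¬ power s (suc k) ≈ ε) ⊎ u ≈ ε

module Cases (L : LetterGroup) (M : MinimalSeparator L)
             (Q : LetterGroup.Carrier L → Set) (isSide : IsSide L M Q)
             (n : ℕ) (engel : Engel.EngelUpTo L 10 n) where
  open LetterGroup L
  open GroupSolver group
  open Paths L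
  open Nested L M
  open Engel L
  open Sides L M Q isSide
  open Generated group

  clash : ∀ {b b′ i j g h} → b ≢ b′ → Hom g b → Hom h b′ → Len i g → Len j h → i + j ≤ 10 → ⊥
  clash = no-clash {n} engel

  ¬Tε : ∀ {b g} → g ≈ ε → ¬ T g b
  ¬Tε eq t = T.moved t (inj₁ eq , inj₂ (trans (∙-congʳ eq) (identityˡ v)))

  xy≈z⇒x : ∀ {x y z} → x ∙ y ≈ z → x ≈ z ∙ y ⁻¹
  xy≈z⇒x {x} {y} h = trans (solve (x ∷ᵥ y ∷ᵥ []ᵥ) x₀ (x₀ ⊙ x₁ ⊙ x₁ ⁻) ≡.refl) (∙-congʳ h)

  xy≈z⇒y : ∀ {x y z} → x ∙ y ≈ z → y ≈ x ⁻¹ ∙ z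
  xy≈z⇒y {x} {y} h = trans (solve (x ∷ᵥ y ∷ᵥ []ᵥ) x₁ (x₀ ⁻ ⊙ (x₀ ⊙ x₁)) ≡.refl) (∙-congˡ h)

  xy⁻¹≈z⇒x : ∀ {x y z} → x ∙ y ⁻¹ ≈ z → x ≈ z ∙ y
  xy⁻¹≈z⇒x {x} {y} h = trans (solve (x ∷ᵥ y ∷ᵥ []ᵥ) x₀ (x₀ ⊙ x₁ ⁻ ⊙ x₁) ≡.refl) (∙-congʳ h)

  x⁻¹y≈z⇒y : ∀ {x y z} → x ⁻¹ ∙ y ≈ z → y ≈ x ∙ z
  x⁻¹y≈z⇒y {x} {y} h = trans (solve (x ∷ᵥ y ∷ᵥ []ᵥ) x₁ (x₀ ⊙ (x₀ ⁻ ⊙ x₁)) ≡.refl) (∙-congˡ h)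

  inv-inv : ∀ x → x ≈ x ⁻¹ ⁻¹
  inv-inv x = sym (⁻¹-involutive x)

  x⁻¹≈y⇒x : ∀ {x y} → x ⁻¹ ≈ y → x ≈ y ⁻¹
  x⁻¹≈y⇒x {x} h = trans (inv-inv x) (⁻¹-cong h)

  ε⁻¹ : ε ⁻¹ ≈ ε
  ε⁻¹ = solve []ᵥ (𝟙 ⁻) 𝟙 ≡.refl

  involution : ∀ {u} → u ∙ u ≈ ε → u ⁻¹ ≈ u
  involution {u} h = sym (trans (xy≈z⇒x h) (identityˡ _))

  len-conj : ∀ {i j g h} → Len i g → Len j h → Len (i + j + i) (g ∙ h ∙ g ⁻¹)
  len-conj lg lh = len-∙ (len-∙ lg lh) (len-⁻¹ lg)

  not-≢ : ∀ b → b ≢ not b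
  not-≢ b = not-¬ ≡.refl

  -- Here C = {ε , u} plays the part of X: either u = ε, and X = {ε} or X is too wide to be
  -- noticed by short words, or u = v is an involution preserving both sides of X.
  module Preserving (u : Carrier) (lu : ℕ) (len-u : Len lu u) (lu≤3 : lu ≤ 3) (u² : u ∙ u ≈ ε)
    (C⊆X : ∀ {g} → Pair ε u g → X g) (safe : ∀ {g} → Len (3 + lu) g → ¬ Pair ε u g → ¬ X g)
    (T-uʳ : ∀ {b g} → T g b → T (g ∙ u) b) (T-uˡ : ∀ {b g} → T g b → T (u ∙ g) b) where

    C : Carrier → Set
    C = Pair ε u

    u⁻¹ : u ⁻¹ ≈ u
    u⁻¹ = involution u²

    C-inv : ∀ {g} → ¬ C g → ¬ C (g ⁻¹)
    C-inv n (inj₁ h) = n (inj₁ (trans (x⁻¹≈y⇒x h) ε⁻¹))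
    C-inv n (inj₂ h) = n (inj₂ (trans (x⁻¹≈y⇒x h) u⁻¹))

    C-∙u : ∀ {g} → ¬ C g → ¬ C (g ∙ u)
    C-∙u n (inj₁ h) = n (inj₂ (trans (xy≈z⇒x h) (trans (identityˡ _) u⁻¹)))
    C-∙u n (inj₂ h) = n (inj₁ (trans (xy≈z⇒x h) (inverseʳ u)))

    -- Words of length at most `3 + lu` meet `X` only in `C`, so a step between such vertices
    -- outside `C` does not change sides.
    extend : ∀ {b g i} a → Len i g → suc i ≤ 3 + lu → ¬ C g → T g b → ¬ C (g ∙ ι a) → T (g ∙ ι a) b
    extend {b} {g} {i} a lg le nC t nC′ = T-side (side-step b a (side-T (safe (len-weaken (ℕ.<⇒≤ le) lg) nC) t)
      (safe (len-weaken (subst (_≤ 3 + lu) (ℕ.+-comm 1 i) le) (len-∙ lg (len-ι a))) nC′))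

    extend⁻¹ : ∀ {b g i} a → Len i g → suc i ≤ 3 + lu → ¬ C g → T g b → ¬ C (g ∙ ι a ⁻¹) → T (g ∙ ι a ⁻¹) b
    extend⁻¹ a lg le nC t nC′ = T-resp (∙-congˡ (ι-bar a))
      (extend (bar a) lg le nC t (nC′ ∘ pair-resp (∙-congˡ (ι-bar a))))

    le₁ : 1 ≤ 3 + lu
    le₁ = s≤s z≤n
    le₂ : 2 ≤ 3 + lu
    le₂ = s≤s (s≤s z≤n)
    le₃ : 3 ≤ 3 + lu
    le₃ = s≤s (s≤s (s≤s z≤n))
    le-u : suc (1 + lu) ≤ 3 + lu
    le-u = ℕ.m≤n+m (2 + lu) 1

    letter∉ : ∀ {b a} → Side b (ι a) → ¬ C (ι a)
    letter∉ {b} σ = side∉ b σ ∘ C⊆X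

    -- With a letter `t` of the opposite side, the walk through t, t s, t s t⁻¹ stays on that side,
    -- and likewise for s⁻¹, so the conjugate clashes with `s`. The one exception is t s t⁻¹ = u;
    -- then t u t⁻¹, which is its own inverse, takes the place of the conjugate.
    no-Hom-letter : ∀ a b → ¬ C (ι a) → ¬ Hom (ι a) b
    no-Hom-letter a b nCs Hs@(s₁ , s₂) = side-letter (not b) λ (a′ , σ) → with-t a′ (T-side σ) (letter∉ {not b} σ)
      where
      s : Carrier
      s = ι a
      with-t : ∀ a′ → T (ι a′) (not b) → ¬ C (ι a′) → ⊥
      with-t a′ t₁ nCt = em λ
        { (no nC) → clash (not-≢ b) Hs
            (extend⁻¹ a′ (len-∙ lt (len-ι a)) le₃ nC-ts T-ts nC ,
             T-resp inv-tst (extend⁻¹ a′ (len-∙ lt (len-⁻¹ (len-ι a))) le₃ nC-ts⁻¹ T-ts⁻¹ (C-inv nC ∘ pair-resp inv-tst)))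
            (len-ι a) (len-conj lt (len-ι a)) (ℕ.m≤m+n 4 6)
        ; (yes (inj₁ h)) → s≉ε h
        ; (yes (inj₂ h)) → twisted h }
        where
        t : Carrier
        t = ι a′
        lt : Len 1 t
        lt = len-ι a′
        ru : ∀ {g} → g ≈ u ⁻¹ ∙ t → T g (not b)
        ru h = T-resp (sym (trans h (∙-congʳ u⁻¹))) (T-uˡ t₁)
        nC-ts : ¬ C (t ∙ s)
        nC-ts (inj₁ h) = T-unique (not-≢ b) s₂ (T-resp (trans (xy≈z⇒x h) (identityˡ _)) t₁)
        nC-ts (inj₂ h) = T-unique (not-≢ b) s₂
          (ru (trans (xy≈z⇒x {s ⁻¹} {t ⁻¹} {u ⁻¹} (trans (sym (⁻¹-anti-homo-∙ t s)) (⁻¹-cong h)))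
            (∙-congˡ (sym (inv-inv t)))))
        nC-ts⁻¹ : ¬ C (t ∙ s ⁻¹)
        nC-ts⁻¹ (inj₁ h) = T-unique (not-≢ b) s₁ (T-resp (trans (xy⁻¹≈z⇒x h) (identityˡ _)) t₁)
        nC-ts⁻¹ (inj₂ h) = T-unique (not-≢ b) s₁ (ru (xy≈z⇒y (sym (xy⁻¹≈z⇒x h))))
        T-ts : T (t ∙ s) (not b)
        T-ts = extend a lt le₂ nCt t₁ nC-ts
        T-ts⁻¹ : T (t ∙ s ⁻¹) (not b)
        T-ts⁻¹ = extend⁻¹ a lt le₂ nCt t₁ nC-ts⁻¹
        inv-tst : t ∙ s ⁻¹ ∙ t ⁻¹ ≈ (t ∙ s ∙ t ⁻¹) ⁻¹
        inv-tst = inv-conj t s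
        s≉ε : ¬ t ∙ s ∙ t ⁻¹ ≈ ε
        s≉ε h = ι≉ε a (∙-cancelˡ t _ _ (trans (xy⁻¹≈z⇒x h) (ε-comm t)))
        twisted : t ∙ s ∙ t ⁻¹ ≈ u → ⊥
        twisted h = clash (not-≢ b) Hs (Tw , T-resp inv-w Tw) (len-ι a) (len-conj lt len-u)
          (ℕ.+-monoʳ-≤ 1 (ℕ.≤-trans (ℕ.+-monoˡ-≤ 1 (ℕ.+-monoʳ-≤ 1 lu≤3)) (ℕ.m≤m+n 5 4)))
          where
          nC : ¬ C (t ∙ u ∙ t ⁻¹)
          nC (inj₁ e) = s≉ε (trans h (∙-cancelˡ t _ _ (trans (xy⁻¹≈z⇒x e) (ε-comm t))))
          nC (inj₂ e) = nCs (inj₂ (∙-cancelˡ t _ _ (trans (xy⁻¹≈z⇒x h) (sym (xy⁻¹≈z⇒x e)))))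
          Tw : T (t ∙ u ∙ t ⁻¹) (not b)
          Tw = extend⁻¹ a′ (len-∙ lt len-u) le-u (C-∙u nCt) (T-uʳ t₁) nC
          inv-w : t ∙ u ∙ t ⁻¹ ≈ (t ∙ u ∙ t ⁻¹) ⁻¹
          inv-w = trans (∙-congʳ (∙-congˡ (sym u⁻¹))) (inv-conj t u)

    -- `s` is only equal to a letter in the group, so that the inverse of a letter qualifies too.
    record Forward (s : Carrier) : Set where
      field
        a   : A
        s≈  : s ≈ ι a
        out : T s true
        inn : T (s ⁻¹) false

    type-of-inverse : ∀ a b → ¬ C (ι a) → T (ι a) b → ¬ ¬ T (ι a ⁻¹) (not b)
    type-of-inverse a b nC t k = side-total (safe (len-weaken le₁ (len-⁻¹ (len-ι a))) (C-inv nC)) λ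
      { (c , σ) → decide b c t σ k }
      where
      decide : ∀ b c → T (ι a) b → Side c (ι a ⁻¹) → ¬ ¬ T (ι a ⁻¹) (not b)
      decide true  true  t σ k = no-Hom-letter a true nC (t , T-side σ)
      decide true  false t σ k = k (T-side σ)
      decide false true  t σ k = k (T-side σ)
      decide false false t σ k = no-Hom-letter a false nC (t , T-side σ)

    module _ {s : Carrier} (fs : Forward s) where
      open Forward fs

      ls : Len 1 s
      ls = len-resp (sym s≈) (len-ι a)

      nCs : ¬ C s
      nCs (inj₁ h) = ¬Tε h out
      nCs (inj₂ h) = ¬Tε u² (T-resp (∙-congʳ h) (T-uʳ out))

      extend-s : ∀ {b g i} → Len i g → suc i ≤ 3 + lu → ¬ C g → T g b → ¬ C (g ∙ s) → T (g ∙ s) b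
      extend-s lg le nC t nC′ = T-resp (∙-congˡ (sym s≈)) (extend a lg le nC t (nC′ ∘ pair-resp (∙-congˡ (sym s≈))))

      extend-s⁻¹ : ∀ {b g i} → Len i g → suc i ≤ 3 + lu → ¬ C g → T g b → ¬ C (g ∙ s ⁻¹) → T (g ∙ s ⁻¹) b
      extend-s⁻¹ lg le nC t nC′ = let eq = ∙-congˡ (⁻¹-cong (sym s≈)) in
        T-resp eq (extend⁻¹ a lg le nC t (nC′ ∘ pair-resp eq))

      -- Otherwise s u s⁻¹ and s⁻¹ u s lie on opposite sides, and as involutions they keep their
      -- type under inversion. For `u` of length 3 they have five letters each; this is where the
      -- bound 10 is attained.
      commutes : s ∙ u ≈ u ∙ s
      commutes = stable λ nc →
        let nC₁ : ¬ C (s ∙ u ∙ s ⁻¹)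
            nC₁ = λ { (inj₁ h) → let su = trans (xy⁻¹≈z⇒x h) (identityˡ s)
                                     u≈ε = ∙-cancelˡ s _ _ (trans su (sym (identityʳ s)))
                                 in nc (trans su (sym (trans (∙-congʳ u≈ε) (identityˡ s))))
                    ; (inj₂ h) → nc (xy⁻¹≈z⇒x h) }
            nC₂ : ¬ C (s ⁻¹ ∙ u ∙ s)
            nC₂ = λ { (inj₁ h) → let us = trans (x⁻¹y≈z⇒y (trans (sym (assoc _ _ _)) h)) (identityʳ s)
                                     u≈ε = ∙-cancelʳ s _ _ (trans us (sym (identityˡ s)))
                                 in nc (trans (trans (∙-congˡ u≈ε) (identityʳ s)) (sym us))
                    ; (inj₂ h) → nc (sym (x⁻¹y≈z⇒y (trans (sym (assoc _ _ _)) h))) }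
            T₁ : T (s ∙ u ∙ s ⁻¹) true
            T₁ = extend-s⁻¹ (len-∙ ls len-u) le-u (C-∙u nCs) (T-uʳ out) nC₁
            T₂ : T (s ⁻¹ ∙ u ∙ s) false
            T₂ = extend-s (len-∙ (len-⁻¹ ls) len-u) le-u (C-∙u (C-inv nCs)) (T-uʳ inn) nC₂
            i₁ : s ∙ u ∙ s ⁻¹ ≈ (s ∙ u ∙ s ⁻¹) ⁻¹
            i₁ = trans (∙-congʳ (∙-congˡ (sym u⁻¹))) (inv-conj s u)
            i₂ : s ⁻¹ ∙ u ∙ s ≈ (s ⁻¹ ∙ u ∙ s) ⁻¹
            i₂ = trans (∙-congʳ (∙-congˡ (sym u⁻¹))) (solve (s ∷ᵥ u ∷ᵥ []ᵥ) (x₀ ⁻ ⊙ x₁ ⁻ ⊙ x₀) ((x₀ ⁻ ⊙ x₁ ⊙ x₀) ⁻) ≡.refl)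
            lu+2 : 1 + lu + 1 ≤ 5
            lu+2 = ℕ.+-monoˡ-≤ 1 (ℕ.+-monoʳ-≤ 1 lu≤3)
        in clash (λ ()) (T₁ , T-resp i₁ T₁) (T₂ , T-resp i₂ T₂)
             (len-conj ls len-u) (len-∙ (len-∙ (len-⁻¹ ls) len-u) ls) (ℕ.+-mono-≤ lu+2 lu+2)

      powers : ∀ k → T (power s (suc k)) true
      powers zero = T-resp (sym (identityʳ s)) out
      powers (suc k) = T-∙ (λ ()) out inn (powers k)

    -- Otherwise s t⁻¹ and its inverse both begin with a forward letter, while s⁻¹ t and its inverse
    -- both begin with a backward one: a clash.
    forward-unique : ∀ {s t} → Forward s → Forward t → ¬ ¬ (t ≈ s ⊎ t ≈ s ∙ u)
    forward-unique {s} {t} fs ft k = clash (λ ())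
        (extend-s⁻¹ ft (ls fs) le₂ (nCs fs) (Forward.out fs) nC₁ ,
         T-resp (i₁ s t) (extend-s⁻¹ fs (ls ft) le₂ (nCs ft) (Forward.out ft) (C-inv nC₁ ∘ pair-resp (i₁ s t))))
        (extend-s ft (len-⁻¹ (ls fs)) le₂ (C-inv (nCs fs)) (Forward.inn fs) nC₂ ,
         T-resp (i₂ s t) (extend-s fs (len-⁻¹ (ls ft)) le₂ (C-inv (nCs ft)) (Forward.inn ft) (C-inv nC₂ ∘ pair-resp (i₂ s t))))
        (len-∙ (ls fs) (len-⁻¹ (ls ft))) (len-∙ (len-⁻¹ (ls fs)) (ls ft)) (ℕ.m≤m+n 4 6)
      where
      nC₁ : ¬ C (s ∙ t ⁻¹)
      nC₁ (inj₁ h) = k (inj₁ (sym (trans (xy⁻¹≈z⇒x h) (identityˡ t))))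
      nC₁ (inj₂ h) = k (inj₂ (trans (trans (xy≈z⇒y (sym (xy⁻¹≈z⇒x h))) (∙-congʳ u⁻¹)) (sym (commutes fs))))
      nC₂ : ¬ C (s ⁻¹ ∙ t)
      nC₂ (inj₁ h) = k (inj₁ (trans (x⁻¹y≈z⇒y h) (identityʳ s)))
      nC₂ (inj₂ h) = k (inj₂ (x⁻¹y≈z⇒y h))
      i₁ : ∀ s t → t ∙ s ⁻¹ ≈ (s ∙ t ⁻¹) ⁻¹
      i₁ s t = solve (t ∷ᵥ s ∷ᵥ []ᵥ) (x₀ ⊙ x₁ ⁻) ((x₁ ⊙ x₀ ⁻) ⁻) ≡.refl
      i₂ : ∀ s t → t ⁻¹ ∙ s ≈ (s ⁻¹ ∙ t) ⁻¹
      i₂ s t = solve (t ∷ᵥ s ∷ᵥ []ᵥ) (x₀ ⁻ ⊙ x₁) ((x₁ ⁻ ⊙ x₀) ⁻) ≡.refl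

    generators : ¬ ¬ Generators L
    generators k = side-letter true λ (a , σ) → type-of-inverse a true (letter∉ {true} σ) (T-side σ) λ τ →
      let fs : Forward (ι a)
          fs = record { a = a ; s≈ = refl ; out = T-side σ ; inn = τ }
          s  = ι a
          gen-letter : ∀ b → ¬ ¬ Gen s u (ι b)
          gen-letter b k = em {C (ι b)} λ
            { (yes (inj₁ h)) → k (nil h)
            ; (yes (inj₂ h)) → k (nil refl ·u trans h (sym (identityˡ u)))
            ; (no nC) → side-total (safe (len-weaken le₁ (len-ι b)) nC) λ
              { (true , σ′) → type-of-inverse b true nC (T-side σ′) λ τ′ →
                  forward-unique fs (record { a = b ; s≈ = refl ; out = T-side σ′ ; inn = τ′ }) λ
                  { (inj₁ h) → k (nil refl ·s trans h (sym (identityˡ _)))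
                  ; (inj₂ h) → k ((nil refl ·s sym (identityˡ _)) ·u h) }
              ; (false , σ′) → type-of-inverse b false nC (T-side σ′) λ τ′ →
                  forward-unique fs (record { a = bar b ; s≈ = sym (ι-bar b) ; out = τ′ ; inn = T-resp (inv-inv _) (T-side σ′) }) λ
                  { (inj₁ h) → k (nil refl ·s⁻¹ trans (x⁻¹≈y⇒x h) (sym (identityˡ _)))
                  ; (inj₂ h) → k ((nil refl ·s⁻¹ sym (identityˡ _)) ·u
                      trans (x⁻¹≈y⇒x (trans h (commutes fs)))
                        (trans (⁻¹-anti-homo-∙ u s) (∙-congˡ u⁻¹))) } } }
      in k (record { s = s ; u = u ; commute = commutes fs ; u² = u² ; generates = gen-letter
                   ; kind = inj₁ (a , refl , λ k h → ¬Tε h (powers fs k)) })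

  module Swapping (len-v : Len 3 v) (v² : v ∙ v ≈ ε)
    (swap : ∀ {b p} → Side b p → Side (not b) (v ∙ p)) where

    -- As `v` is an involution, `g` and `g ∙ v` carry `X` to the same pair.
    T-∙v : ∀ {b g} → Side b g → T (g ∙ v) b
    T-∙v {b} {g} σ = T-sideᵛ (side-resp b (sym (trans (assoc _ _ _) (trans (∙-congˡ v²) (identityʳ g)))) σ)

    -- If s and s⁻¹ lie on the same side, s clashes with v s v; otherwise s v clashes with v s.
    impossible : ⊥
    impossible = side-letter true λ (a , σ) → with-s a σ
      where
      with-s : ∀ a → Side true (ι a) → ⊥
      with-s a σ = side-total ∉X⁻¹ λ
        { (true , σ′) → clash {true} {false} (λ ()) (T-side σ , T-side σ′)
            (T-∙v (swap σ) , T-resp (inv-vsv (ι a)) (T-∙v (swap σ′))) (len-ι a) (len-∙ (len-∙ len-v (len-ι a)) len-v) (ℕ.m≤m+n 8 2)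
        ; (false , σ′) → clash {true} {false} (λ ())
            (T-∙v σ , T-resp inv-sv (T-side (swap σ′)))
            (T-side (swap σ) , T-resp inv-vs (T-∙v σ′))
            (len-∙ (len-ι a) len-v) (len-∙ len-v (len-ι a)) (ℕ.m≤m+n 8 2) }
        where
        s : Carrier
        s = ι a
        v⁻¹ : v ⁻¹ ≈ v
        v⁻¹ = involution v²
        ∉X⁻¹ : ¬ X (s ⁻¹)
        ∉X⁻¹ (inj₁ h) = side∉ true σ (inj₁ (trans (x⁻¹≈y⇒x h) ε⁻¹))
        ∉X⁻¹ (inj₂ h) = side∉ true σ (inj₂ (trans (x⁻¹≈y⇒x h) v⁻¹))
        inv-vsv : ∀ s → v ∙ s ⁻¹ ∙ v ≈ (v ∙ s ∙ v) ⁻¹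
        inv-vsv s = trans (∙-cong (∙-congʳ (sym v⁻¹)) (sym v⁻¹))
          (solve (v ∷ᵥ s ∷ᵥ []ᵥ) (x₀ ⁻ ⊙ x₁ ⁻ ⊙ x₀ ⁻) ((x₀ ⊙ x₁ ⊙ x₀) ⁻) ≡.refl)
        inv-sv : v ∙ s ⁻¹ ≈ (s ∙ v) ⁻¹
        inv-sv = trans (∙-congʳ (sym v⁻¹)) (sym (⁻¹-anti-homo-∙ s v))
        inv-vs : s ⁻¹ ∙ v ≈ (v ∙ s) ⁻¹
        inv-vs = trans (∙-congˡ (sym v⁻¹)) (sym (⁻¹-anti-homo-∙ v s))

  module Moving (len-v : Len 3 v) (v≉ε : ¬ v ≈ ε) (v²≉ε : ¬ v ∙ v ≈ ε) where

    ∉v⁻¹ : ¬ X (v ⁻¹)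
    ∉v⁻¹ (inj₁ h) = v≉ε (trans (x⁻¹≈y⇒x h) ε⁻¹)
    ∉v⁻¹ (inj₂ h) = v²≉ε (trans (∙-congʳ (sym h)) (inverseˡ v))

    ∉v² : ¬ X (v ∙ v)
    ∉v² (inj₁ h) = v²≉ε h
    ∉v² (inj₂ h) = v≉ε (∙-cancelˡ v _ _ (trans h (sym (identityʳ v))))

    module Elliptic {b : Bool} (Hv : Hom v b) where
      -- For a letter s on the side not containing the translates of `X` by `v` and its inverse, s v
      -- s⁻¹ clashes with `v`. The exception s v s⁻¹ = v is impossible: s v lies on the side of s,
      -- and v s on side `b`.
      impossible : ⊥
      impossible = side-letter (not b) λ (a , σ) → with-s a σ
        where
        with-s : ∀ a → Side (not b) (ι a) → ⊥
        with-s a σ = em {X (ι a ∙ v ∙ ι a ⁻¹)} λ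
          { (yes (inj₁ h)) → v≉ε (∙-cancelˡ s _ _ (trans (xy⁻¹≈z⇒x h) (ε-comm s)))
          ; (yes (inj₂ h)) → side-unique ne (side-resp c (xy⁻¹≈z⇒x h) Σsv) (translate-side ne (proj₁ Hv) (proj₂ Hv) σ)
          ; (no n) → em {X (ι a ∙ v ⁻¹ ∙ ι a ⁻¹)} λ
            { (yes (inj₁ h)) → n (inj₁ (trans inv₂ (trans (⁻¹-cong h) ε⁻¹)))
            ; (yes (inj₂ h)) → side-unique ne (side-resp c (xy⁻¹≈z⇒x (trans inv₂ (⁻¹-cong h))) Σsv)
                (translate-side ne (proj₂ Hv) (T-resp (inv-inv v) (proj₁ Hv)) σ)
            ; (no n′) → clash ne
                (T-side (by-bar n Σsv) , T-resp inv₁ (T-side (by-bar n′ Σsv⁻¹))) Hv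
                (len-conj (len-ι a) len-v) len-v (ℕ.m≤m+n 8 2) } }
          where
          c : Bool
          c = not b
          ne : c ≢ b
          ne = not-≢ b ∘ ≡.sym
          s : Carrier
          s = ι a
          by-bar : ∀ {p} → ¬ X (p ∙ s ⁻¹) → Side c p → Side c (p ∙ s ⁻¹)
          by-bar n σ = side-resp c (∙-congˡ (ι-bar a)) (side-step c (bar a) σ (n ∘ pair-resp (∙-congˡ (ι-bar a))))
          inv₁ : s ∙ v ⁻¹ ∙ s ⁻¹ ≈ (s ∙ v ∙ s ⁻¹) ⁻¹
          inv₁ = inv-conj s v
          inv₂ : s ∙ v ∙ s ⁻¹ ≈ (s ∙ v ⁻¹ ∙ s ⁻¹) ⁻¹
          inv₂ = solve (s ∷ᵥ v ∷ᵥ []ᵥ) (x₀ ⊙ x₁ ⊙ x₀ ⁻) ((x₀ ⊙ x₁ ⁻ ⊙ x₀ ⁻) ⁻) ≡.refl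
          Σsv : Side c (s ∙ v)
          Σsv = side-v c σ λ
            { (inj₁ h) → side-unique ne σ (side-resp b (sym (trans (xy≈z⇒x h) (identityˡ _))) (side-T ∉v⁻¹ (proj₂ Hv)))
            ; (inj₂ h) → ι≉ε a (trans (xy≈z⇒x h) (inverseʳ v)) }
          Σsv⁻¹ : Side c (s ∙ v ⁻¹)
          Σsv⁻¹ = side-v⁻¹ c σ λ
            { (inj₁ h) → side∉ c σ (inj₂ (trans (xy⁻¹≈z⇒x h) (identityˡ v)))
            ; (inj₂ h) → side-unique ne σ (side-resp b (sym (xy⁻¹≈z⇒x h)) (T.at-gv (proj₁ Hv) ∉v²)) }

    module Hyperbolic {α β : Bool} (ne : β ≢ α) (Tv : T v β) (Tv⁻¹ : T (v ⁻¹) α) (0<n : 0 < n) where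
      en : α ≢ β
      en = ne ∘ ≡.sym

      shift : ∀ {p} → Side β p → Side β (v ∙ p)
      shift = translate-side ne Tv Tv⁻¹

      shift⁻¹ : ∀ {p} → Side α p → Side α (v ⁻¹ ∙ p)
      shift⁻¹ = translate-side en Tv⁻¹ (T-resp (inv-inv v) Tv)

      αv⁻¹ : Side α (v ⁻¹)
      αv⁻¹ = side-T ∉v⁻¹ Tv⁻¹

      βv² : Side β (v ∙ v)
      βv² = T.at-gv Tv ∉v²

      canc : ∀ q → v ∙ (v ⁻¹ ∙ q) ≈ q
      canc q = \\-leftDividesˡ v q

      -- The slab between the separators v⁻¹X and X.
      U : Carrier → Set
      U q = Side α q × Side β (v ∙ q)

      -- The two pairs bounding the slab share the point `ε`, so there are three boundary points.
      Z : Carrier → Set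
      Z q = q ≈ v ⁻¹ ⊎ X q

      Z⇒ : ∀ {q} → ¬ Z q → ¬ X (v ∙ q)
      Z⇒ n (inj₁ h) = n (inj₁ (trans (xy≈z⇒y h) (identityʳ _)))
      Z⇒ n (inj₂ h) = n (inj₂ (inj₁ (trans (xy≈z⇒y h) (inverseˡ v))))

      U-resp : ∀ {p q} → p ≈ q → U p → U q
      U-resp eq (a , b) = side-resp α eq a , side-resp β (∙-congˡ eq) b

      U∉Z : ∀ {q} → U q → ¬ Z q
      U∉Z (a , b) (inj₁ h) = side∉ β b (inj₁ (trans (∙-congˡ h) (inverseʳ v)))
      U∉Z (a , b) (inj₂ h) = side∉ α a h

      U-letter : ∀ {q} a → U q → ¬ Z (q ∙ ι a ⁻¹) → U (q ∙ ι a ⁻¹)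
      U-letter {q} a (σ , τ) n = U-resp eq
        (side-step α (bar a) σ (n′ ∘ inj₂) ,
         side-resp β (assoc _ _ _) (side-step β (bar a) τ (Z⇒ n′ ∘ pair-resp (assoc _ _ _))))
        where
        eq : q ∙ ι (bar a) ≈ q ∙ ι a ⁻¹
        eq = ∙-congˡ (ι-bar a)
        n′ : ¬ Z (q ∙ ι (bar a))
        n′ (inj₁ h) = n (inj₁ (trans (sym eq) h))
        n′ (inj₂ h) = n (inj₂ (pair-resp eq h))

      U-v : ∀ {q} → U q → U (q ∙ v)
      U-v {q} u@(σ , τ) = side-v α σ (n∉ ∘ inj₂) ,
          side-resp β (assoc _ _ _) (side-v β τ (Z⇒ n∉ ∘ pair-resp (assoc _ _ _)))
        where
        n∉ : ¬ Z (q ∙ v)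
        n∉ (inj₁ h) = side-unique ne τ (side-resp α (sym (trans (∙-congˡ (xy≈z⇒x h)) (canc _))) αv⁻¹)
        n∉ (inj₂ (inj₁ h)) = U∉Z u (inj₁ (trans (xy≈z⇒x h) (identityˡ _)))
        n∉ (inj₂ (inj₂ h)) = U∉Z u (inj₂ (inj₁ (trans (xy≈z⇒x h) (inverseʳ v))))

      U-v⁻¹ : ∀ {q} → U q → U (q ∙ v ⁻¹)
      U-v⁻¹ {q} u@(σ , τ) = side-v⁻¹ α σ (n∉ ∘ inj₂) ,
          side-resp β (assoc _ _ _) (side-v⁻¹ β τ (Z⇒ n∉ ∘ pair-resp (assoc _ _ _)))
        where
        n∉ : ¬ Z (q ∙ v ⁻¹)
        n∉ (inj₁ h) = U∉Z u (inj₂ (inj₁ (trans (xy⁻¹≈z⇒x h) (inverseˡ v))))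
        n∉ (inj₂ (inj₁ h)) = U∉Z u (inj₂ (inj₂ (trans (xy⁻¹≈z⇒x h) (identityˡ _))))
        n∉ (inj₂ (inj₂ h)) = side-unique ne (side-resp β (sym (xy⁻¹≈z⇒x h)) βv²) σ

      data Pow : Carrier → Set where
        zer : ∀ {c} → c ≈ ε → Pow c
        pos : ∀ {c} k → c ≈ power v (suc k) → Pow c
        neg : ∀ {c} k → c ≈ power (v ⁻¹) (suc k) → Pow c

      power-comm : ∀ x k → power x k ∙ x ≈ x ∙ power x k
      power-comm x zero = ε-comm x
      power-comm x (suc k) = trans (assoc _ _ _) (∙-congˡ (power-comm x k))

      power-canc : ∀ x k → power x (suc k) ∙ x ⁻¹ ≈ power x k
      power-canc x k = trans (∙-congʳ (sym (power-comm x k))) (solve (power x k ∷ᵥ x ∷ᵥ []ᵥ) (x₀ ⊙ x₁ ⊙ x₁ ⁻) x₀ ≡.refl)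

      Pow-v : ∀ {c} → Pow c → Pow (c ∙ v)
      Pow-v (zer h) = pos 0 (trans (∙-congʳ h) (ε-comm v))
      Pow-v (pos k h) = pos (suc k) (trans (∙-congʳ h) (power-comm v (suc k)))
      Pow-v (neg zero h) = zer (trans (∙-congʳ h) (solve (v ∷ᵥ []ᵥ) (x₀ ⁻ ⊙ 𝟙 ⊙ x₀) 𝟙 ≡.refl))
      Pow-v (neg (suc k) h) = neg k (trans (∙-cong h (inv-inv v)) (power-canc (v ⁻¹) (suc k)))

      Pow-v⁻¹ : ∀ {c} → Pow c → Pow (c ∙ v ⁻¹)
      Pow-v⁻¹ (zer h) = neg 0 (trans (∙-congʳ h) (solve (v ∷ᵥ []ᵥ) (𝟙 ⊙ x₀ ⁻) (x₀ ⁻ ⊙ 𝟙) ≡.refl))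
      Pow-v⁻¹ (pos zero h) = zer (trans (∙-congʳ h) (solve (v ∷ᵥ []ᵥ) (x₀ ⊙ 𝟙 ⊙ x₀ ⁻) 𝟙 ≡.refl))
      Pow-v⁻¹ (pos (suc k) h) = pos k (trans (∙-congʳ h) (power-canc v (suc k)))
      Pow-v⁻¹ (neg k h) = neg (suc k) (trans (∙-congʳ h) (power-comm (v ⁻¹) (suc k)))

      Z⇒Pow : ∀ {q} → Z q → Pow q
      Z⇒Pow (inj₁ h) = neg 0 (trans h (sym (identityʳ _)))
      Z⇒Pow (inj₂ (inj₁ h)) = zer h
      Z⇒Pow (inj₂ (inj₂ h)) = pos 0 (trans h (sym (identityʳ _)))

      -- Positive powers of `v` push the slab beyond `X`, negative ones beyond v⁻¹X; so two distinct
      -- points of the slab never differ by a power of `v` on the left.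
      slab-disjoint : ∀ {p q c} → U p → U q → ¬ q ≈ p → Pow c → ¬ q ≈ c ∙ p
      slab-disjoint p∈ q∈ n (zer h) e = n (trans e (trans (∙-congʳ h) (identityˡ _)))
      slab-disjoint {p} (σ , τ) (σ′ , τ′) n (pos k h) e =
          side-unique ne (side-resp β (sym (trans e (∙-congʳ h))) (up k)) σ′
        where
        up : ∀ k → Side β (power v (suc k) ∙ p)
        up zero = side-resp β (∙-congʳ (sym (identityʳ v))) τ
        up (suc k) = side-resp β (sym (assoc _ _ _)) (shift (up k))
      slab-disjoint {p} (σ , τ) (σ′ , τ′) n (neg k h) e =
          side-unique ne τ′ (side-resp α (sym eq) (down k))
        where
        down : ∀ k → Side α (power (v ⁻¹) k ∙ p)
        down zero = side-resp α (sym (identityˡ p)) σ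
        down (suc k) = side-resp α (sym (assoc _ _ _)) (shift⁻¹ (down k))
        eq = trans (∙-congˡ (trans e (∙-congʳ h))) (trans (∙-congˡ (assoc _ _ _)) (canc _))

      -- `w` is one of v⁻¹, ε, v: the power of `v` that brings the letter into the slab.
      record InSlab (s : Carrier) : Set where
        field
          w      : Carrier
          len-w  : Len 3 w
          ws∈U   : U (w ∙ s)
          Pow-w  : ∀ {c} → Pow c → Pow (c ∙ w ⁻¹)
          U-w    : ∀ {q} → U q → U (q ∙ w ⁻¹)

      -- A letter is a neighbour of `ε`, which borders three slabs: those between consecutive pairs
      -- among v⁻²X, v⁻¹X, X and vX. The excluded values are the points of these four pairs other
      -- than `ε`.
      in-slab : ∀ a → ¬ ι a ≈ v → ¬ ι a ≈ v ∙ v → ¬ ι a ≈ v ⁻¹ → ¬ ι a ≈ v ⁻¹ ∙ v ⁻¹ → ¬ ¬ InSlab (ι a)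
      in-slab a n₁ n₂ n₃ n₄ k = em λ
        { (yes σ) → k record { w = v ⁻¹ ; len-w = len-⁻¹ len-v
            ; ws∈U = side-step α a αv⁻¹ (λ { (inj₁ h) → n₁ (trans (x⁻¹y≈z⇒y h) (identityʳ v)) ; (inj₂ h) → n₂ (x⁻¹y≈z⇒y h) }) ,
                     side-resp β (sym (canc s)) σ
            ; Pow-w = λ c → Pow-resp (Pow-v c) ; U-w = λ u → U-resp (∙-congˡ (inv-inv v)) (U-v u) }
        ; (no nσ) → let σ : Side α s ; σ = opposite nβ nσ in em λ
          { (yes τ) → k record { w = ε ; len-w = len-weaken z≤n len-ε
              ; ws∈U = U-resp (sym (identityˡ s)) (σ , τ)
              ; Pow-w = λ c → Pow-ε c ; U-w = U-resp (sym (trans (∙-congˡ ε⁻¹) (identityʳ _))) }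
          ; (no nτ) → k record { w = v ; len-w = len-v
              ; ws∈U = opposite nvs nτ , side-resp β (assoc _ _ _) (side-step β a βv²
                  λ { (inj₁ h) → n₄ (trans (xy≈z⇒y h) (solve (v ∷ᵥ []ᵥ) ((x₀ ⊙ x₀) ⁻ ⊙ 𝟙) (x₀ ⁻ ⊙ x₀ ⁻) ≡.refl))
                    ; (inj₂ h) → n₃ (trans (xy≈z⇒y h) (solve (v ∷ᵥ []ᵥ) ((x₀ ⊙ x₀) ⁻ ⊙ x₀) (x₀ ⁻) ≡.refl)) })
              ; Pow-w = Pow-v⁻¹ ; U-w = U-v⁻¹ } } }
        where
        s : Carrier
        s = ι a
        nβ : ¬ X s
        nβ (inj₁ h) = ι≉ε a h
        nβ (inj₂ h) = n₁ h
        nvs : ¬ X (v ∙ s)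
        nvs (inj₁ h) = n₃ (trans (xy≈z⇒y h) (identityʳ _))
        nvs (inj₂ h) = ι≉ε a (trans (xy≈z⇒y h) (inverseˡ v))
        opposite : ∀ {p} → ¬ X p → ¬ Side β p → Side α p
        opposite {p} n nσ = side-stable α λ k → side-total n λ (b , σ) → case b Bool.≟ α of λ
          { (yes ≡.refl) → k σ
          ; (no b≢α) → nσ (subst (λ b → Side b p) (≡.trans (¬-not b≢α) (≡.sym (¬-not ne))) σ) }
        Pow-cong : ∀ {c d} → c ≈ d → Pow c → Pow d
        Pow-cong e (zer h) = zer (trans (sym e) h)
        Pow-cong e (pos k h) = pos k (trans (sym e) h)
        Pow-cong e (neg k h) = neg k (trans (sym e) h)
        Pow-resp : ∀ {c} → Pow (c ∙ v) → Pow (c ∙ v ⁻¹ ⁻¹)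
        Pow-resp = Pow-cong (∙-congˡ (inv-inv v))
        Pow-ε : ∀ {c} → Pow c → Pow (c ∙ ε ⁻¹)
        Pow-ε = Pow-cong (sym (trans (∙-congˡ ε⁻¹) (identityʳ _)))

      W : Carrier → Set
      W q = Side β q ⊎ Side α (v ∙ q)

      -- The ping-pong condition: everything beyond either boundary of the slab is sent into the
      -- slab.
      Throws : Carrier → Set
      Throws y = ∀ {q} → W q → U (y ∙ q)

      throws : ∀ {y} → U y → U (y ⁻¹) → Throws y
      throws {y} (σ , τ) (σ′ , τ′) {q} (inj₁ h) =
        translate-side {c = α} ne (T-side σ) (T-side σ′) h ,
        side-resp β (assoc _ _ _) (translate-side {c = β} ne (T-side τ) (T-sideᵛ (side-resp α eq σ′)) h)
        where
        eq : y ⁻¹ ≈ (v ∙ y) ⁻¹ ∙ v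
        eq = solve (y ∷ᵥ v ∷ᵥ []ᵥ) (x₀ ⁻) ((x₁ ⊙ x₀) ⁻ ⊙ x₁) ≡.refl
      -- A point beyond v⁻¹X is v⁻¹ times a point of side α, so y is replaced by y v⁻¹ and the pair
      -- to be moved is `X` again.
      throws {y} (σ , τ) (σ′ , τ′) {q} (inj₂ h) =
        side-resp α (solve (y ∷ᵥ v ∷ᵥ q ∷ᵥ []ᵥ) (x₀ ⊙ x₁ ⁻ ⊙ (x₁ ⊙ x₂)) (x₀ ⊙ x₂) ≡.refl)
          (translate-side {c = α} en (T-sideᵛ (side-resp α (solve (y ∷ᵥ v ∷ᵥ []ᵥ) x₀ (x₀ ⊙ x₁ ⁻ ⊙ x₁) ≡.refl) σ))
            (T-resp (solve (y ∷ᵥ v ∷ᵥ []ᵥ) (x₁ ⊙ x₀ ⁻) ((x₀ ⊙ x₁ ⁻) ⁻) ≡.refl) (T-side τ′)) h) ,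
        side-resp β (solve (y ∷ᵥ v ∷ᵥ q ∷ᵥ []ᵥ) (x₁ ⊙ x₀ ⊙ x₁ ⁻ ⊙ (x₁ ⊙ x₂)) (x₁ ⊙ (x₀ ⊙ x₂)) ≡.refl)
          (translate-side en (conj τ) (T-resp (inv-conj v y) (conj τ′)) h)
        where
        conj : ∀ {y} → Side β (v ∙ y) → T (v ∙ y ∙ v ⁻¹) β
        conj {y} τ = T-sideᵛ (side-resp β (solve (y ∷ᵥ v ∷ᵥ []ᵥ) (x₁ ⊙ x₀) (x₁ ⊙ x₀ ⊙ x₁ ⁻ ⊙ x₁) ≡.refl) τ)

      -- The inverse of y throws into the slab, `v` or its inverse moves the slab off itself beyond
      -- one of its boundaries, and y throws the result back.
      throws-conj : ∀ {y} → Throws y → Throws (y ⁻¹) → Throws (y ∙ v ∙ y ⁻¹) × Throws ((y ∙ v ∙ y ⁻¹) ⁻¹)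
      throws-conj {y} f g =
        (λ {q} w → U-resp (solve (y ∷ᵥ v ∷ᵥ q ∷ᵥ []ᵥ) (x₀ ⊙ (x₁ ⊙ (x₀ ⁻ ⊙ x₂))) (x₀ ⊙ x₁ ⊙ x₀ ⁻ ⊙ x₂) ≡.refl)
          (f (inj₁ (proj₂ (g w))))) ,
        (λ {q} w → U-resp (solve (y ∷ᵥ v ∷ᵥ q ∷ᵥ []ᵥ) (x₀ ⊙ (x₁ ⁻ ⊙ (x₀ ⁻ ⊙ x₂))) ((x₀ ⊙ x₁ ⊙ x₀ ⁻) ⁻ ⊙ x₂) ≡.refl)
          (f (inj₂ (side-resp α (sym (canc _)) (proj₁ (g w))))))

      no-slab-letter : ∀ a → ¬ InSlab (ι a)
      no-slab-letter a i = finish n 0<n (engel len-v (len-∙ len-w (len-ι a)) (ℕ.m≤m+n 7 3))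
        where
        open InSlab i
        s p : Carrier
        s = ι a
        p = w ∙ s
        solveˢ : ∀ {q} → q ∙ s ⁻¹ ∙ w ⁻¹ ≈ q ∙ p ⁻¹
        solveˢ {q} = solve (q ∷ᵥ s ∷ᵥ w ∷ᵥ []ᵥ) (x₀ ⊙ x₁ ⁻ ⊙ x₂ ⁻) (x₀ ⊙ (x₂ ⊙ x₁) ⁻) ≡.refl
        -- If the step by s⁻¹ from q ended at a boundary point, q would be a power of `v` times p,
        -- which is impossible for distinct points of the slab. The remaining factor w⁻¹ preserves
        -- the slab.
        into-slab : ∀ {q} → U q → ¬ q ≈ p → U (q ∙ p ⁻¹)
        into-slab {q} q∈ n = U-resp solveˢ (U-w (U-letter a q∈ λ z → slab-disjoint ws∈U q∈ n (Pow-w (Z⇒Pow z))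
          (solve (q ∷ᵥ s ∷ᵥ w ∷ᵥ []ᵥ) x₀ (x₀ ⊙ x₁ ⁻ ⊙ x₂ ⁻ ⊙ (x₂ ⊙ x₁)) ≡.refl)))
        y∈ : U (p ∙ v ∙ p ⁻¹)
        y∈ = into-slab (U-v ws∈U) λ h → v≉ε (∙-cancelˡ p _ _ (trans h (sym (identityʳ p))))
        y⁻¹∈ : U ((p ∙ v ∙ p ⁻¹) ⁻¹)
        y⁻¹∈ = U-resp (inv-conj p v)
          (into-slab (U-v⁻¹ ws∈U) λ h → v≉ε (trans (x⁻¹≈y⇒x (∙-cancelˡ p _ _ (trans h (sym (identityʳ p))))) ε⁻¹))
        iter : ∀ k → Throws (iterConj (suc k) v p) × Throws (iterConj (suc k) v p ⁻¹)
        iter zero = throws y∈ y⁻¹∈ , throws y⁻¹∈ (U-resp (inv-inv _) y∈)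
        iter (suc k) = throws-conj (proj₁ (iter k)) (proj₂ (iter k))
        finish : ∀ n → 0 < n → ¬ iterConj n v p ≈ v
        -- The iterated conjugate throws v² into the slab, thus onto side α, whereas `v` takes it to
        -- v³ on side β. Iteration 0 is p itself, which is why n must be positive.
        finish (suc k) _ h = side-unique ne (shift βv²) (side-resp α (∙-congʳ h) (proj₁ (proj₁ (iter k) (inj₁ βv²))))

      generators : Generators L
      generators = record
        { s = v ; u = ε ; commute = solve (v ∷ᵥ []ᵥ) (x₀ ⊙ 𝟙) (𝟙 ⊙ x₀) ≡.refl ; u² = identityˡ ε
        ; generates = λ a k → in-slab a
            (λ h → k (nil refl ·s trans h (sym (identityˡ _))))
            (λ h → k ((nil refl ·s sym (identityˡ _)) ·s h))
            (λ h → k (nil refl ·s⁻¹ trans h (sym (identityˡ _))))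
            (λ h → k ((nil refl ·s⁻¹ sym (identityˡ _)) ·s⁻¹ h))
            (no-slab-letter a)
        ; kind = inj₂ refl }

-- Case distinction on the second point of the separator

module Classification (L : LetterGroup) (M : MinimalSeparator L)
                      (n : ℕ) (0<n : 0 < n) (engel : Engel.EngelUpTo L 10 n) where
  open LetterGroup L
  open GroupSolver group
  open Paths L
  open Nested L M
  open Engel L
  open MinimalSeparator M

  Component : Carrier → Set
  Component p = ¬ ¬ Path X p₀ p

  component-isSide : IsSide L M Component
  component-isSide = record
    { Q-stable = λ nn k → nn λ q → q k
    ; Q∉X = λ q x → q λ P → path-end pair-resp p₀∉ P x
    ; Q-path = λ q P k → q λ P′ → k (P′ ⊕ P)
    ; inside = p₀ , ret (here refl)
    ; outside = q₀ , q₀∉ , λ q → q separated }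

  no-shorter : ∀ l → length l < length V → ¬ ∏ l ≈ v
  no-shorter l l<V eq = minimal l l<V (p₀∉ ∘ to) (q₀∉ ∘ to) (separated ∘ path-mono from)
    where
    to : ∀ {t} → Pair ε (∏ l) t → X t
    to (inj₁ h) = inj₁ h
    to (inj₂ h) = inj₂ (trans h eq)
    from : ∀ {t} → X t → Pair ε (∏ l) t
    from (inj₁ h) = inj₁ h
    from (inj₂ h) = inj₂ (trans h (sym eq))

  -- Words of at most three letters do not notice the second point of `X`, so the argument for
  -- preserved sides runs with `u = ε`. Three letters are what the conjugate t s t⁻¹ takes.
  wide : (∀ {g} → Len 3 g → ¬ g ≈ ε → ¬ g ≈ v) → ¬ ¬ Generators L
  wide w = Preserving.generators ε 0 len-ε z≤n (identityˡ ε)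
    (λ { (inj₁ h) → inj₁ h ; (inj₂ h) → inj₁ h })
    (λ l nC → λ { (inj₁ h) → nC (inj₁ h) ; (inj₂ h) → w l (nC ∘ inj₁) h })
    (T-resp (sym (identityʳ _))) (T-resp (sym (identityˡ _)))
    where
    open Cases L M Component component-isSide n engel
    open Sides L M Component component-isSide using (T-resp)

  module Involution (len-v : Len 3 v) (v² : v ∙ v ≈ ε) where
    vv : ∀ p → v ∙ (v ∙ p) ≈ p
    vv p = trans (sym (assoc _ _ _)) (trans (∙-congʳ v²) (identityˡ p))

    v-path : ∀ {p q} → Path X p q → Path X (v ∙ p) (v ∙ q)
    v-path P = path-mono (λ { (inj₁ h) → inj₂ (trans h (sym v²)) ; (inj₂ h) → inj₁ h }) (to-X∙ v P)

    X-v : ∀ {p} → X (v ∙ p) → X p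
    X-v {p} (inj₁ h) = inj₂ (trans (sym (vv p)) (trans (∙-congˡ h) (identityʳ v)))
    X-v {p} (inj₂ h) = inj₁ (trans (sym (vv p)) (trans (∙-congˡ h) v²))

    -- A component other than those of p₀ and v p₀, which may coincide. If there is one, these two
    -- together form a proper side invariant under `v`.
    Third : Set
    Third = Σ Carrier λ q → ¬ X q × ¬ Path X p₀ q × ¬ Path X (v ∙ p₀) q

    module _ (third : Third) where
      Orbit : Carrier → Set
      Orbit p = ¬ ¬ (Path X p₀ p ⊎ Path X (v ∙ p₀) p)

      orbit-isSide : IsSide L M Orbit
      orbit-isSide = record
        { Q-stable = λ nn k → nn λ q → q k
        ; Q∉X = λ q x → q λ { (inj₁ P) → path-end pair-resp p₀∉ P x
                            ; (inj₂ P) → path-end pair-resp (p₀∉ ∘ X-v) P x }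
        ; Q-path = λ q P k → q λ { (inj₁ P′) → k (inj₁ (P′ ⊕ P)) ; (inj₂ P′) → k (inj₂ (P′ ⊕ P)) }
        ; inside = p₀ , ret (inj₁ (here refl))
        ; outside = let (q , nX , n₁ , n₂) = third in
            q , nX , λ o → o λ { (inj₁ P) → n₁ P ; (inj₂ P) → n₂ P } }

      open Cases L M Orbit orbit-isSide n engel
      open Sides L M Orbit orbit-isSide

      orbit-v : ∀ {p} → Orbit p → Orbit (v ∙ p)
      orbit-v o k = o λ { (inj₁ P) → k (inj₂ (v-path P)) ; (inj₂ P) → k (inj₁ (path-resp (vv p₀) (v-path P))) }

      preserve : ∀ b {p} → Side b p → Side b (v ∙ p)
      preserve true  o = orbit-v o
      preserve false {p} (∉ , out) = ∉ ∘ X-v , λ o → out (side-resp true (vv p) (orbit-v o))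

      preserving : ¬ ¬ Generators L
      preserving = Preserving.generators v 3 len-v ℕ.≤-refl v² (λ x → x) (λ _ n → n) T-∙v T-v∙
        where
        gvv : ∀ g → (g ∙ v) ∙ v ≈ g
        gvv g = trans (assoc _ _ _) (trans (∙-congˡ v²) (identityʳ g))
        T-∙v : ∀ {b g} → T g b → T (g ∙ v) b
        T-∙v {b} {g} (mkT m s t) = mkT (λ (x , y) → m (pair-resp (gvv g) y , x)) t
          (λ n → side-resp b (sym (gvv g)) (s (n ∘ pair-resp (sym (gvv g)))))
        T-v∙ : ∀ {b g} → T g b → T (v ∙ g) b
        T-v∙ {b} {g} (mkT m s t) = mkT (λ (x , y) → m (X-v x , X-v (pair-resp (assoc _ _ _) y)))
          (λ n → preserve b (s λ x → n (v-X x)))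
          (λ n → side-resp b (sym (assoc _ _ _)) (preserve b (t λ x → n (pair-resp (sym (assoc _ _ _)) (v-X x)))))
          where
          v-X : ∀ {p} → X p → X (v ∙ p)
          v-X {p} x = X-v (pair-resp (sym (vv p)) x)

    -- With no further component, v p₀ cannot lie with p₀, as q₀ would then be in a further one. So
    -- `v` exchanges the component of p₀ with the rest.
    not-swapping : ¬ Third → ⊥
    not-swapping none = Swapping.impossible len-v v² λ {b} {p} → swap {b} {p}
      where
      open Cases L M Component component-isSide n engel
      open Sides L M Component component-isSide
      swap : ∀ {b p} → Side b p → Side (not b) (v ∙ p)
      swap {true} {p} q = side∉ true q ∘ X-v , λ q′ → q λ P → q′ λ P′ →
        let P₀ = P′ ⊕ path-rev (p₀∉ ∘ X-v) (v-path P) in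
        none (q₀ , q₀∉ , separated , λ P″ → separated (P₀ ⊕ P″))
      swap {false} {p} (nX , nq) k = none (p , nX , (λ P → nq (ret P)) ,
        λ P → k (path-resp (vv p₀) (v-path P)))

  moving : Len 3 v → ¬ v ≈ ε → ¬ v ∙ v ≈ ε → ¬ ¬ Generators L
  moving len-v v≉ v²≉ k = side-total ∉v² λ (β , τ) → side-total ∉v⁻¹ λ (α , σ) → case β Bool.≟ α of λ
    { (yes ≡.refl) → Elliptic.impossible {β} (T-sideᵛ τ , T-side σ)
    ; (no ne) → k (Hyperbolic.generators ne (T-sideᵛ τ) (T-side σ) 0<n) }
    where
    open Cases L M Component component-isSide n engel
    open Sides L M Component component-isSide
    open Moving len-v v≉ v²≉

  classification : ¬ ¬ Generators L
  classification k with length V ℕ.≟ 0 | length V ℕ.≤? 3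
  ... | yes V≡0 | _ = wide (λ _ g≉ε g≈v → g≉ε (trans g≈v (∏-empty V V≡0))) k
  ... | no _ | no V≰3 = wide (λ (l , le , eq) _ g≈v → no-shorter l (ℕ.≤-<-trans le (ℕ.≰⇒> V≰3)) (trans eq g≈v)) k
  ... | no V≢0 | yes V≤3 = em λ
    { (yes v²) → em λ
      { (yes third) → Involution.preserving len-v v² third k
      ; (no none) → Involution.not-swapping len-v v² none }
    ; (no v²≉) → moving len-v (v≉ε (ℕ.n≢0⇒n>0 V≢0)) v²≉ k }
    where
    len-v : Len 3 v
    len-v = V , V≤3 , refl

-- The group of the r-local cover

open ≡ using (refl; sym; trans)
open import Data.List.Relation.Unary.All using (All; []; _∷_)
open import Data.List.Relation.Unary.Any using (here; there)

finGroup : FinGroup → Group 0ℓ 0ℓ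
finGroup Γ = record { isGroup = FinGroup.isGroup Γ }

module GroupOf (Γ : FinGroup) where
  open FinGroup Γ public using (N)
  open Group (finGroup Γ) public using (_∙_; ε; _⁻¹; assoc; identityˡ; identityʳ; inverseˡ; inverseʳ)
  open import Algebra.Properties.Group (finGroup Γ) public using (ε⁻¹≈ε; inverseʳ-unique; inverseˡ-unique; identityʳ-unique)
  open GroupSolver (finGroup Γ) public

record CayleyGraph : Set where
  field
    Γ   : FinGroup
    S   : Subset (FinGroup.N Γ)
    gen : IsGeneratingSet Γ S
    r   : ℕ
    2≤r : 2 ≤ r

module Words (C : CayleyGraph) where
  open CayleyGraph C
  open GroupOf Γ

  Letter : Set
  Letter = Σ (Fin N) (_∈ S)

  Word : Set
  Word = List Letter

  ev : Word → Fin N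
  ev = foldr (λ a → proj₁ a ∙_) ε

  ev-++ : ∀ u w → ev (u ++ w) ≡ ev u ∙ ev w
  ev-++ [] w = sym (identityˡ _)
  ev-++ (a ∷ u) w = trans (cong (proj₁ a ∙_) (ev-++ u w)) (sym (assoc _ _ _))

  barˡ : Letter → Letter
  barˡ (x , x∈) = x ⁻¹ , proj₁ (proj₂ gen) x x∈

  inv : Word → Word
  inv [] = []
  inv (a ∷ w) = inv w ++ barˡ a ∷ []

  ev-inv : ∀ w → ev (inv w) ≡ ev w ⁻¹
  ev-inv [] = sym ε⁻¹≈ε
  ev-inv (a ∷ w) = trans (ev-++ (inv w) _) (trans (≡.cong₂ _∙_ (ev-inv w) (identityʳ _)) (sym (⁻¹-anti-homo-∙ _ _)))

  length-inv : ∀ w → length (inv w) ≡ length w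
  length-inv [] = refl
  length-inv (a ∷ w) = trans (List.length-++ (inv w)) (trans (ℕ.+-comm _ 1) (cong suc (length-inv w)))

  -- Backtracks are included: they are closed words of length 2, and 2 ≤ r.
  data Delete : Word → Word → Set where
    delete : ∀ u c t → length c ≤ r → ev c ≡ ε → Delete (u ++ c ++ t) (u ++ t)

  _~_ : Word → Word → Set
  _~_ = EqClosure Delete

  ~-refl : ∀ {u} → u ~ u
  ~-refl = EqC.reflexive Delete
  ~-sym : ∀ {u w} → u ~ w → w ~ u
  ~-sym = EqC.symmetric Delete
  ~-trans : ∀ {u w t} → u ~ w → w ~ t → u ~ t
  ~-trans = EqC.transitive Delete
  ~-≡ : ∀ {u w} → u ≡ w → u ~ w
  ~-≡ refl = ~-refl

  del : ∀ u c t → length c ≤ r → ev c ≡ ε → (u ++ c ++ t) ~ (u ++ t)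
  del u c t le eq = EqC.return (delete u c t le eq)

  ev-~ : ∀ {u w} → u ~ w → ev u ≡ ev w
  ev-~ = EqC.gfold ≡.isEquivalence ev λ { (delete u c t _ eq) → trans (ev-++ u (c ++ t))
    (trans (cong (ev u ∙_) (trans (ev-++ c t) (trans (cong (_∙ ev t) eq) (identityˡ _)))) (sym (ev-++ u t))) }

  ~-++ˡ : ∀ x {u w} → u ~ w → (x ++ u) ~ (x ++ w)
  ~-++ˡ x = EqC.gmap (x ++_) λ { (delete u c t le eq) →
    ≡.subst₂ Delete (List.++-assoc x u _) (List.++-assoc x u t) (delete (x ++ u) c t le eq) }

  ~-++ʳ : ∀ x {u w} → u ~ w → (u ++ x) ~ (w ++ x)
  ~-++ʳ x = EqC.gmap (_++ x) λ { (delete u c t le eq) →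
    ≡.subst₂ Delete (sym (trans (List.++-assoc u _ x) (cong (u ++_) (List.++-assoc c t x))))
      (sym (List.++-assoc u t x)) (delete u c (t ++ x) le eq) }

  ~-++ : ∀ {u u′ w w′} → u ~ u′ → w ~ w′ → (u ++ w) ~ (u′ ++ w′)
  ~-++ {u} {u′} {w} {w′} p q = ~-trans (~-++ʳ w p) (~-++ˡ u′ q)

  closed-~ : ∀ c → length c ≤ r → ev c ≡ ε → c ~ []
  closed-~ c le eq = ~-trans (~-≡ (sym (List.++-identityʳ c))) (del [] c [] le eq)

  inv-cancelʳ : ∀ w → (w ++ inv w) ~ []
  inv-cancelʳ [] = ~-refl
  inv-cancelʳ (a ∷ w) = ~-trans (~-≡ (cong (a ∷_) (sym (List.++-assoc w (inv w) _))))
    (~-trans (~-++ˡ (a ∷ []) (~-++ʳ (barˡ a ∷ []) (inv-cancelʳ w)))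
      (closed-~ (a ∷ barˡ a ∷ []) 2≤r (trans (cong (proj₁ a ∙_) (identityʳ _)) (inverseʳ _))))

  inv-cancelˡ : ∀ w → (inv w ++ w) ~ []
  inv-cancelˡ [] = ~-refl
  inv-cancelˡ (a ∷ w) = ~-trans (~-≡ (List.++-assoc (inv w) _ _))
    (~-trans (del (inv w) (barˡ a ∷ a ∷ []) w 2≤r (trans (cong (_ ∙_) (identityʳ _)) (inverseˡ _))) (inv-cancelˡ w))

  -- `u` followed by the inverse of `w` is a closed word of length at most r. Through this every
  -- short relation of Γ passes to the cover.
  short-~ : ∀ u w → ev u ≡ ev w → length u + length w ≤ r → u ~ w
  short-~ u w eq le = ~-trans (~-trans (~-≡ (sym (List.++-identityʳ u))) (~-++ˡ u (~-sym (inv-cancelˡ w))))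
    (~-trans (~-≡ (sym (List.++-assoc u (inv w) w))) (del [] (u ++ inv w) w
      (subst (_≤ r) (sym (trans (List.length-++ u) (cong (length u +_) (length-inv w)))) le)
      (trans (ev-++ u (inv w)) (trans (≡.cong₂ _∙_ eq (ev-inv w)) (inverseʳ _)))))

  -- Equality in the cover is an undecidable word problem; the double negation makes classical reasoning available.
  _≋_ : Word → Word → Set
  u ≋ w = ¬ ¬ (u ~ w)

  ev-≋ : ∀ {u w} → u ≋ w → ev u ≡ ev w
  ev-≋ {u} {w} nn = decidable-stable (ev u Fin.≟ ev w) λ n → nn (n ∘ ev-~)

  ~-inv : ∀ {u w} → u ~ w → inv u ~ inv w
  ~-inv {u} {w} p =
    ~-trans (~-trans (~-≡ (sym (List.++-identityʳ _))) (~-++ˡ (inv u) (~-sym (inv-cancelʳ w))))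
    (~-trans (~-≡ (sym (List.++-assoc (inv u) w _)))
    (~-trans (~-++ʳ (inv w) (~-++ˡ (inv u) (~-sym p)))
    (~-++ʳ (inv w) (inv-cancelˡ u))))

  wordGroup : Group 0ℓ 0ℓ
  wordGroup = record
    { Carrier = Word ; _≈_ = _≋_ ; _∙_ = _++_ ; ε = [] ; _⁻¹ = inv
    ; isGroup = record
      { isMonoid = record
        { isSemigroup = record
          { isMagma = record
            { isEquivalence = record
              { refl = ret ~-refl
              ; sym = λ p k → p (k ∘ ~-sym)
              ; trans = λ p q k → p λ p → q λ q → k (~-trans p q) }
            ; ∙-cong = λ p q k → p λ p → q λ q → k (~-++ p q) }
          ; assoc = λ u w t → ret (~-≡ (List.++-assoc u w t)) }
        ; identity = (λ _ → ret ~-refl) , λ u → ret (~-≡ (List.++-identityʳ u)) }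
      ; inverse = (λ u → ret (inv-cancelˡ u)) , (λ u → ret (inv-cancelʳ u))
      ; ⁻¹-cong = λ p k → p (k ∘ ~-inv) } }

  spell-word : ∀ (w : Word) → foldr (λ (a : Letter) → (a ∷ []) ++_) [] w ≡ w
  spell-word [] = refl
  spell-word (a ∷ w) = cong (a ∷_) (spell-word w)

  letterGroup : LetterGroup
  letterGroup = record
    { group = wordGroup ; stable = λ nn k → nn λ p → p k
    ; A = Letter ; ι = _∷ [] ; bar = barˡ ; ι-bar = λ _ → ret ~-refl
    ; ι≉ε = λ (x , x∈) p → proj₁ gen (subst (_∈ S) (trans (sym (identityʳ x)) (ev-≋ p)) x∈)
    ; spell = λ w → w , ret (~-≡ (spell-word w)) }

  open LetterGroup letterGroup using (∏)
  open Paths letterGroup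
  open Engel letterGroup

  ΓConj : ℕ → Fin N → Fin N → Fin N
  ΓConj = IteratedConjugation.iterConj (finGroup Γ)

  ev-iterConj : ∀ k g h → ev (iterConj k g h) ≡ ΓConj k (ev g) (ev h)
  ev-iterConj zero g h = refl
  ev-iterConj (suc k) g h = trans (ev-++ (c ++ g) (inv c)) (≡.cong₂ _∙_ (trans (ev-++ c g) (cong (_∙ ev g) ih)) (trans (ev-inv c) (cong _⁻¹ ih)))
    where
    c  = iterConj k g h
    ih = ev-iterConj k g h

  -- With |g| added, each iteration exactly doubles the length. The sum is also the length of the
  -- relation that compares the iterate with g.
  length-iterConj : ∀ k g h → length (iterConj k g h) + length g ≡ 2 ^ k * (length g + length h)
  length-iterConj zero g h = trans (ℕ.+-comm (length h) _) (sym (ℕ.+-identityʳ _))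
  length-iterConj (suc k) g h = begin
    length ((c ++ g) ++ inv c) + length g        ≡⟨ cong (_+ length g) (List.length-++ (c ++ g)) ⟩
    length (c ++ g) + length (inv c) + length g  ≡⟨ ≡.cong₂ (λ x y → x + y + length g) (List.length-++ c) (length-inv c) ⟩
    (length c + length g) + length c + length g  ≡⟨ ℕ.+-assoc (length c + length g) _ _ ⟩
    (length c + length g) + (length c + length g) ≡⟨ ≡.cong₂ _+_ ih ih ⟩
    m + m                                         ≡⟨ cong (m +_) (sym (ℕ.+-identityʳ m)) ⟩
    2 * m                                         ≡⟨ sym (ℕ.*-assoc 2 (2 ^ k) _) ⟩
    2 ^ suc k * (length g + length h) ∎
    where
    open ≡.≡-Reasoning
    c = iterConj k g h
    m = 2 ^ k * (length g + length h)
    ih = length-iterConj k g h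

  engel-words : ∀ n → 2 ^ n * 10 ≤ r → (∀ a b → ΓConj n a b ≡ a) → EngelUpTo 10 n
  engel-words n le Γ-engel {i} {j} {g} {h} (l , l≤ , l≋) (l′ , l′≤ , l′≋) i+j≤ =
    W.trans (iterConj-cong n (W.trans (W.sym l≋) (ret (~-≡ (spell-word l)))) (W.trans (W.sym l′≋) (ret (~-≡ (spell-word l′)))))
      (W.trans (ret (short-~ (iterConj n l l′) l (trans (ev-iterConj n l l′) (Γ-engel _ _))
        (subst (_≤ r) (sym (length-iterConj n l l′))
          (ℕ.≤-trans (ℕ.*-monoʳ-≤ (2 ^ n) (ℕ.≤-trans (ℕ.+-mono-≤ l≤ l′≤) i+j≤)) le))))
      (W.trans (ret (~-≡ (sym (spell-word l)))) l≋))
    where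
    module W = Group wordGroup
    iterConj-cong : ∀ k {g g′ h h′} → g ≋ g′ → h ≋ h′ → iterConj k g h ≋ iterConj k g′ h′
    iterConj-cong zero p q = q
    iterConj-cong (suc k) {g} {g′} {h} {h′} p q = W.∙-cong (W.∙-cong ih p) (W.⁻¹-cong ih)
      where
      ih : iterConj k g h ≋ iterConj k g′ h′
      ih = iterConj-cong k p q

  record Separation : Set where
    field
      V         : Word
      p q       : Word
      p∉        : ¬ Pair [] (∏ V) p
      q∉        : ¬ Pair [] (∏ V) q
      separated : ¬ Path (Pair [] (∏ V)) p q

  -- Well-founded descent on the length of `V`, with excluded middle at each step. For `branching`
  -- letters are told apart by their values in Γ, which suffices since words equal in the cover have
  -- equal values.
  minimise : (∀ x y → Σ Letter λ a → proj₁ a ≢ x × proj₁ a ≢ y) → Separation → ¬ ¬ MinimalSeparator letterGroup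
  minimise branch σ = go σ (<-wellFounded _)
    where
    open Separation
    go : ∀ σ → Acc _<_ (length (V σ)) → ¬ ¬ MinimalSeparator letterGroup
    go σ (acc rec) k = em {Σ Separation λ τ → length (V τ) < length (V σ)} λ
      { (yes (τ , τ<)) → go τ (rec τ<) k
      ; (no least) → k record
          { V = V σ ; p₀ = p σ ; q₀ = q σ ; p₀∉ = p∉ σ ; q₀∉ = q∉ σ ; separated = separated σ
          ; minimal = λ B B< p∉ q∉ nP → least (record { V = B ; p∉ = p∉ ; q∉ = q∉ ; separated = nP } , B<)
          ; branching = λ _ x y k → let (a , a≢x , a≢y) = branch (ev x) (ev y) in
              k (a , (λ e → a≢x (trans (sym (identityʳ _)) (ev-≋ e))) , (λ e → a≢y (trans (sym (identityʳ _)) (ev-≋ e)))) } }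

-- Finite groups

least : ∀ {P : ℕ → Set} → (∀ k → Dec (P k)) → ∀ k → P k → Σ ℕ λ m → P m × (∀ j → j < m → ¬ P j)
least P? k = go k (<-wellFounded k)
  where
  go : ∀ k → Acc _<_ k → _ → _
  go k (acc rec) pk with ℕ.anyUpTo? P? k
  ... | yes (j , j<k , pj) = go j (rec j<k) pj
  ... | no none = k , pk , λ j j<k pj → none (j , j<k , pj)

surjection⇒≤ : ∀ {k m} (f : Fin k → Fin m) → (∀ y → Σ (Fin k) λ x → f x ≡ y) → m ≤ k
surjection⇒≤ f surj = Fin.injective⇒≤ {f = proj₁ ∘ surj}
  λ {x} {y} eq → trans (sym (proj₂ (surj x))) (trans (cong f eq) (proj₂ (surj y)))

module Finite (Γ : FinGroup) where
  open GroupOf Γ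
  open Generated (finGroup Γ)
  open IteratedConjugation (finGroup Γ)

  power-+ : ∀ s j k → power s (j + k) ≡ power s j ∙ power s k
  power-+ s zero k = sym (identityˡ _)
  power-+ s (suc j) k = trans (cong (s ∙_) (power-+ s j k)) (sym (assoc _ _ _))

  power-suc : ∀ s k → power s (suc k) ≡ power s k ∙ s
  power-suc s k = trans (cong (power s) (ℕ.+-comm 1 k)) (trans (power-+ s k 1) (cong (power s k ∙_) (identityʳ s)))

  power-periodic : ∀ s m q → power s m ≡ ε → power s (q * m) ≡ ε
  power-periodic s m zero eq = refl
  power-periodic s m (suc q) eq = trans (power-+ s m (q * m)) (trans (cong₂ _∙_ eq (power-periodic s m q eq)) (identityˡ ε))

  power-% : ∀ s m .{{_ : NonZero m}} k → power s m ≡ ε → power s (k % m) ≡ power s k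
  power-% s m k eq = sym (trans (cong (power s) (m≡m%n+[m/n]*n k m))
    (trans (power-+ s (k % m) _) (trans (cong (power s (k % m) ∙_) (power-periodic s m (k / m) eq)) (identityʳ _))))

  power-diff : ∀ s j k → j ≤ k → power s j ≡ power s k → power s (k ∸ j) ≡ ε
  power-diff s j k j≤k eq = ∙-cancelˡ (power s j) _ _
    (trans (sym (power-+ s j (k ∸ j))) (trans (cong (power s) (ℕ.m+[n∸m]≡n j≤k)) (trans (sym eq) (sym (identityʳ _)))))

  record Order (s : Fin N) : Set where
    field
      m       : ℕ
      0<m     : 0 < m
      m≤N     : m ≤ N
      s^m     : power s m ≡ ε
      minimal : ∀ k → 0 < k → k < m → power s k ≢ ε

  order : ∀ s → Order s
  order s with Fin.pigeonhole (ℕ.n<1+n N) (λ i → power s (toℕ i))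
  ... | i , j , i<j , eq with least (λ k → power s (suc k) Fin.≟ ε) (pred d) (subst (λ k → power s k ≡ ε) (sym suc-pred) s^d)
    where
    d = toℕ j ∸ toℕ i
    s^d : power s d ≡ ε
    s^d = power-diff s (toℕ i) (toℕ j) (ℕ.<⇒≤ i<j) eq
    suc-pred : suc (pred d) ≡ d
    suc-pred = ℕ.suc-pred d {{>-nonZero (ℕ.m<n⇒0<n∸m i<j)}}
  ... | m , s^m , min = record
    { m = suc m ; 0<m = s≤s z≤n ; s^m = s^m
    ; m≤N = ℕ.≮⇒≥ λ N<m → case Fin.pigeonhole N<m (λ i → power s (toℕ i)) of λ
        { (i , j , i<j , eq) → min′ (toℕ j ∸ toℕ i) (ℕ.m<n⇒0<n∸m i<j)
            (ℕ.≤-<-trans (ℕ.m∸n≤m (toℕ j) (toℕ i)) (Fin.toℕ<n j)) (power-diff s (toℕ i) (toℕ j) (ℕ.<⇒≤ i<j) eq) }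
    ; minimal = min′ }
    where
    min′ : ∀ k → 0 < k → k < suc m → power s k ≢ ε
    min′ (suc k) _ (s≤s k<m) = min k k<m

  -- `u` may be a power of `s`; whether it is decides later between second factors of order 1 and 2.
  record Structure (r : ℕ) : Set where
    field
      s u      : Fin N
      commute  : s ∙ u ≡ u ∙ s
      u²       : u ∙ u ≡ ε
      far      : ∀ k → k < r → power s (suc k) ≢ ε
      reps     : ∀ g → Σ ℕ λ k → g ≡ power s k ⊎ g ≡ power s k ∙ u

  module Representatives (s u : Fin N) (commute : s ∙ u ≡ u ∙ s) (u² : u ∙ u ≡ ε) where
    Rep : Fin N → Set
    Rep g = Σ ℕ λ k → g ≡ power s k ⊎ g ≡ power s k ∙ u

    open Order (order s)

    rep-ε : Rep ε
    rep-ε = 0 , inj₁ refl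

    rep-s : ∀ {g} → Rep g → Rep (g ∙ s)
    rep-s (k , inj₁ eq) = suc k , inj₁ (trans (cong (_∙ s) eq) (sym (power-suc s k)))
    rep-s (k , inj₂ eq) = suc k , inj₂ (trans (cong (_∙ s) eq) (trans (assoc _ _ _) (trans (cong (power s k ∙_) (sym commute))
      (trans (sym (assoc _ _ _)) (cong (_∙ u) (sym (power-suc s k)))))))

    rep-u : ∀ {g} → Rep g → Rep (g ∙ u)
    rep-u (k , inj₁ eq) = k , inj₂ (cong (_∙ u) eq)
    rep-u (k , inj₂ eq) = k , inj₁ (trans (cong (_∙ u) eq) (trans (assoc _ _ _) (trans (cong (power s k ∙_) u²) (identityʳ _))))

    rep-power : ∀ j {g} → Rep g → Rep (g ∙ power s j)
    rep-power zero ρ = subst Rep (sym (identityʳ _)) ρ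
    rep-power (suc j) ρ = subst Rep (assoc _ _ _) (rep-power j (rep-s ρ))

    s⁻¹-power : s ⁻¹ ≡ power s (pred m)
    s⁻¹-power = sym (inverseʳ-unique s _ (trans (cong (power s) (ℕ.suc-pred m {{>-nonZero 0<m}})) s^m))

    rep-gen : ∀ {g h} → Rep g → Gen s u h → Rep (g ∙ h)
    rep-gen ρ (nil eq) = subst Rep (sym (trans (cong (_ ∙_) eq) (identityʳ _))) ρ
    rep-gen ρ (γ ·s eq) = subst Rep (trans (assoc _ _ _) (cong (_ ∙_) (sym eq))) (rep-s (rep-gen ρ γ))
    rep-gen ρ (γ ·s⁻¹ eq) = subst Rep (trans (assoc _ _ _) (cong (_ ∙_) (trans (cong (_ ∙_) (sym s⁻¹-power)) (sym eq)))) (rep-power (pred m) (rep-gen ρ γ))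
    rep-gen ρ (γ ·u eq) = subst Rep (trans (assoc _ _ _) (cong (_ ∙_) (sym eq))) (rep-u (rep-gen ρ γ))

    -- Reducing the exponent modulo the order of `s` confines it to `Fin N`, which makes
    -- representability a finite search.
    rep-bounded : ∀ {g} → Rep g → Σ (Fin N) λ k → g ≡ power s (toℕ k) ⊎ g ≡ power s (toℕ k) ∙ u
    rep-bounded {g} (k , eq) = fromℕ< k%m<N , subst (λ p → g ≡ p ⊎ g ≡ p ∙ u) (sym pw) eq
      where
      instance _ = >-nonZero 0<m
      k%m<N : k % m < N
      k%m<N = ℕ.<-≤-trans (m%n<n k m) m≤N
      pw : power s (toℕ (fromℕ< k%m<N)) ≡ power s k
      pw = trans (cong (power s) (Fin.toℕ-fromℕ< k%m<N)) (power-% s m k s^m)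

    rep-stable : ∀ {g} → ¬ ¬ Rep g → Rep g
    rep-stable {g} nn with Fin.any? (λ (k : Fin N) → (g Fin.≟ power s (toℕ k)) ⊎-dec (g Fin.≟ power s (toℕ k) ∙ u))
    ... | yes (k , eq) = toℕ k , eq
    ... | no none = ⊥-elim (nn λ ρ → none (rep-bounded ρ))

  -- A trivial power with exponent k + 1 ≤ r would leave at most r elements.
  cyclic-far : ∀ {r} s → r < N → (∀ g → Σ ℕ λ k → g ≡ power s k) → ∀ k → k < r → power s (suc k) ≢ ε
  cyclic-far {r} s r<N cyc k k<r eq = ℕ.<⇒≱ r<N (ℕ.≤-trans (surjection⇒≤ (λ (i : Fin (suc k)) → power s (toℕ i))
    λ g → let (j , e) = cyc g ; j< = m%n<n j (suc k) in
      fromℕ< j< , trans (cong (power s) (Fin.toℕ-fromℕ< j<)) (trans (power-% s (suc k) j eq) (sym e))) k<r)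

  cyclic : ∀ {r} s → r < N → (∀ g → Σ ℕ λ k → g ≡ power s k) → Structure r
  cyclic s r<N cyc = record
    { s = s ; u = ε ; commute = trans (identityʳ s) (sym (identityˡ s)) ; u² = identityˡ ε
    ; far = cyclic-far s r<N cyc ; reps = λ g → proj₁ (cyc g) , inj₁ (proj₂ (cyc g)) }

  -- This decision is what lets the doubly negated analysis of the cover yield actual generators of
  -- Γ.
  structure? : ∀ r → r < N → Dec (Structure r)
  structure? r r<N with Fin.any? (λ s → Fin.any? λ u → (s ∙ u Fin.≟ u ∙ s) ×-dec (u ∙ u Fin.≟ ε) ×-dec
      Fin.all? (λ (k : Fin r) → ¬? (power s (suc (toℕ k)) Fin.≟ ε)) ×-dec
      Fin.all? (λ g → Fin.any? λ (k : Fin N) → (g Fin.≟ power s (toℕ k)) ⊎-dec (g Fin.≟ power s (toℕ k) ∙ u)))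
  ... | yes (s , u , comm , u² , far , reps) = yes record
    { s = s ; u = u ; commute = comm ; u² = u²
    ; far = λ k k<r eq → far (fromℕ< k<r) (trans (cong (power s ∘ suc) (Fin.toℕ-fromℕ< k<r)) eq)
    ; reps = λ g → let (k , e) = reps g in toℕ k , e }
  ... | no none = no λ σ → let open Structure σ in none
    (s , u , commute , u² , (λ k → far (toℕ k) (Fin.toℕ<n k)) ,
     λ g → Representatives.rep-bounded s u commute u² (reps g))

  -- Covers the pairs that the definition of nilpotency exempts: an element commutes with itself and
  -- with its inverse.
  engel-commuting : ∀ {a c} → c ∙ a ≡ a ∙ c → ∀ k → iterConj (suc k) a c ≡ a
  engel-commuting {a} {c} eq zero = trans (cong (_∙ c ⁻¹) eq) (solve (a ∷ᵥ c ∷ᵥ []ᵥ) (x₀ ⊙ x₁ ⊙ x₁ ⁻) x₀ refl)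
  engel-commuting {a} {c} eq (suc k) = trans (cong (λ e → e ∙ a ∙ e ⁻¹) (engel-commuting eq k)) (solve (a ∷ᵥ []ᵥ) (x₀ ⊙ x₀ ⊙ x₀ ⁻) x₀ refl)

  comm-iterConj : ∀ k a b → comm Γ (suc k) a b ≡ a ∙ iterConj (suc k) a (b ⁻¹) ⁻¹
  comm-iterConj zero a b = solve (a ∷ᵥ b ∷ᵥ []ᵥ) (x₀ ⊙ (x₁ ⁻ ⊙ (x₀ ⁻ ⊙ x₁))) (x₀ ⊙ (x₁ ⁻ ⊙ x₀ ⊙ x₁ ⁻ ⁻) ⁻) refl
  comm-iterConj (suc k) a b = trans (cong (λ c → a ∙ (c ⁻¹ ∙ (a ⁻¹ ∙ c))) (comm-iterConj k a b))
    (solve (a ∷ᵥ iterConj (suc k) a (b ⁻¹) ∷ᵥ []ᵥ) (x₀ ⊙ ((x₀ ⊙ x₁ ⁻) ⁻ ⊙ (x₀ ⁻ ⊙ (x₀ ⊙ x₁ ⁻)))) (x₀ ⊙ (x₁ ⊙ x₀ ⊙ x₁ ⁻) ⁻) refl)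

  engel : ∀ n → 1 ≤ n → NilpotentClass≤ Γ n → ∀ a c → iterConj n a c ≡ a
  engel (suc k) _ nilpotent a c with a Fin.≟ c ⁻¹ | a Fin.≟ c
  ... | yes refl | _ = engel-commuting (trans (inverseʳ c) (sym (inverseˡ c))) k
  ... | no _ | yes refl = engel-commuting refl k
  ... | no a≢c⁻¹ | no a≢c = sym (trans (inverseˡ-unique a _ (trans (sym rel) (nilpotent a (c ⁻¹) a≢c⁻¹ (a≢c ∘ λ e → trans e (⁻¹-involutive c)))))
      (⁻¹-involutive _))
    where
    rel : comm Γ (suc k) a (c ⁻¹) ≡ a ∙ iterConj (suc k) a c ⁻¹
    rel = trans (comm-iterConj k a (c ⁻¹)) (cong (λ d → a ∙ iterConj (suc k) a d ⁻¹) (⁻¹-involutive c))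

  -- Two involutions x, y with iterConj n x y ≡ x satisfy (y x)^(2ⁿ) = 1.
  module Dihedral (x y : Fin N) (x² : x ∙ x ≡ ε) (y² : y ∙ y ≡ ε) (n : ℕ) (eng : iterConj n x y ≡ x)
                  (S : Subset N) (gen : IsGeneratingSet Γ S) (S⊆ : ∀ s → s ∈ S → s ≡ x ⊎ s ≡ y) where
    z : Fin N
    z = y ∙ x

    involutive : ∀ k → iterConj k x y ∙ iterConj k x y ≡ ε
    involutive zero = y²
    involutive (suc k) = trans (solve (c ∷ᵥ x ∷ᵥ []ᵥ) (x₀ ⊙ x₁ ⊙ x₀ ⁻ ⊙ (x₀ ⊙ x₁ ⊙ x₀ ⁻)) (x₀ ⊙ (x₁ ⊙ x₁) ⊙ x₀ ⁻) refl)
      (trans (cong (λ t → c ∙ t ∙ c ⁻¹) x²) (solve (c ∷ᵥ []ᵥ) (x₀ ⊙ 𝟙 ⊙ x₀ ⁻) 𝟙 refl))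
      where c = iterConj k x y

    -- Squaring c x gives c x c x, and c is its own inverse, so this is the next conjugate followed
    -- by x.
    power-2^ : ∀ k → power z (2 ^ k) ≡ iterConj k x y ∙ x
    power-2^ zero = identityʳ z
    power-2^ (suc k) = trans (cong (λ j → power z (2 ^ k + j)) (ℕ.+-identityʳ _)) (trans (power-+ z (2 ^ k) (2 ^ k))
      (trans (cong₂ _∙_ (power-2^ k) (power-2^ k))
      (trans (sym (assoc _ _ _)) (cong (_∙ x) (cong (c ∙ x ∙_) (inverseʳ-unique c c (involutive k)))))))
      where c = iterConj k x y

    M : ℕ
    M = 2 ^ n

    0<M : 0 < M
    0<M = ℕ.m^n>0 2 n

    z^M : power z M ≡ ε
    z^M = trans (power-2^ n) (trans (cong (_∙ x) eng) x²)

    D : Fin N → Set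
    D g = Σ ℕ λ k → g ≡ power z k ⊎ g ≡ power z k ∙ y

    D-y : ∀ {g} → D g → D (g ∙ y)
    D-y (k , inj₁ eq) = k , inj₂ (cong (_∙ y) eq)
    D-y (k , inj₂ eq) = k , inj₁ (trans (cong (_∙ y) eq) (trans (assoc _ _ _) (trans (cong (power z k ∙_) y²) (identityʳ _))))

    D-x : ∀ {g} → D g → D (g ∙ x)
    D-x (k , inj₂ eq) = suc k , inj₁ (trans (cong (_∙ x) eq) (trans (assoc _ _ _) (sym (power-suc z k))))
    -- The exponent k is raised by the period `M` so that it has a predecessor; splitting off one
    -- factor y x then lets x cancel.
    D-x (k , inj₁ eq) = k + pred M , inj₂ (begin
      _ ∙ x                                ≡⟨ cong (_∙ x) eq ⟩
      power z k ∙ x                        ≡⟨ cong (_∙ x) (sym (trans (power-+ z k M) (trans (cong (power z k ∙_) z^M) (identityʳ _)))) ⟩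
      power z (k + M) ∙ x                  ≡⟨ cong (λ j → power z j ∙ x) (trans (cong (k +_) (sym (ℕ.suc-pred M {{>-nonZero 0<M}}))) (ℕ.+-suc k (pred M))) ⟩
      power z (suc (k + pred M)) ∙ x       ≡⟨ cong (_∙ x) (power-suc z (k + pred M)) ⟩
      power z (k + pred M) ∙ (y ∙ x) ∙ x   ≡⟨ solve (power z (k + pred M) ∷ᵥ y ∷ᵥ x ∷ᵥ []ᵥ) (x₀ ⊙ (x₁ ⊙ x₂) ⊙ x₂) (x₀ ⊙ x₁ ⊙ (x₂ ⊙ x₂)) refl ⟩
      power z (k + pred M) ∙ y ∙ (x ∙ x)   ≡⟨ trans (cong (power z (k + pred M) ∙ y ∙_) x²) (identityʳ _) ⟩
      power z (k + pred M) ∙ y             ∎)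
      where open ≡.≡-Reasoning

    D-prod : ∀ {g} l → All (_∈ S) l → D g → D (g ∙ prod Γ l)
    D-prod [] [] δ = subst D (sym (identityʳ _)) δ
    D-prod (a ∷ l) (a∈ ∷ as) δ = subst D (assoc _ _ _) (D-prod l as ([ (λ { refl → D-x δ }) , (λ { refl → D-y δ }) ]′ (S⊆ a a∈)))

    N≤2M : N ≤ M + M
    N≤2M = surjection⇒≤ (λ i → [ (λ j → power z (toℕ j)) , (λ j → power z (toℕ j) ∙ y) ]′ (splitAt M i)) λ g →
      let (l , l∈ , eq) = proj₂ (proj₂ gen) g in
      index (subst D (trans (identityˡ _) eq) (D-prod l l∈ (0 , inj₁ refl)))
      where
      instance _ = >-nonZero 0<M
      mod : ∀ k → power z (toℕ (fromℕ< (m%n<n k M))) ≡ power z k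
      mod k = trans (cong (power z) (Fin.toℕ-fromℕ< (m%n<n k M))) (power-% z M k z^M)
      index : ∀ {g} → D g → Σ (Fin (M + M)) λ i → [ (λ j → power z (toℕ j)) , (λ j → power z (toℕ j) ∙ y) ]′ (splitAt M i) ≡ g
      index (k , inj₁ eq) = fromℕ< (m%n<n k M) ↑ˡ M ,
        trans (cong [ _ , _ ]′ (Fin.splitAt-↑ˡ M _ M)) (trans (mod k) (sym eq))
      index (k , inj₂ eq) = M ↑ʳ fromℕ< (m%n<n k M) ,
        trans (cong [ _ , _ ]′ (Fin.splitAt-↑ʳ M M _)) (trans (cong (_∙ y) (mod k)) (sym eq))

  module SmallDegree (n r : ℕ) (r<N : r < N) (2ⁿ≤ : 2 ^ n + 2 ^ n ≤ r) (eng : ∀ a c → iterConj n a c ≡ a)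
                     (S : Subset N) (gen : IsGeneratingSet Γ S) where
    cyclic-set : ∀ x → (∀ s → s ∈ S → s ≡ x ⊎ s ≡ x ⁻¹) → Structure r
    cyclic-set x S⊆ = cyclic x r<N λ g → let (l , l∈ , eq) = proj₂ (proj₂ gen) g in
      unrep (subst Rep (trans (identityˡ _) eq) (rep-prod l l∈ rep-ε))
      where
      open Representatives x ε (trans (identityʳ x) (sym (identityˡ x))) (identityˡ ε)
      rep-prod : ∀ {g} l → All (_∈ S) l → Rep g → Rep (g ∙ prod Γ l)
      rep-prod [] [] ρ = subst Rep (sym (identityʳ _)) ρ
      rep-prod (a ∷ l) (a∈ ∷ as) ρ = subst Rep (assoc _ _ _) (rep-prod l as
        ([ (λ { refl → rep-s ρ }) , (λ { refl → rep-gen ρ (nil refl ·s⁻¹ sym (identityˡ _)) }) ]′ (S⊆ a a∈)))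
      unrep : ∀ {g} → Rep g → Σ ℕ λ k → g ≡ power x k
      unrep (k , inj₁ eq) = k , eq
      unrep (k , inj₂ eq) = k , trans eq (identityʳ _)

    -- Closure under inverses leaves two possibilities: one letter is the inverse of the other or is
    -- missing, and Γ is cyclic; or both are involutions, and Γ has at most 2 · 2ⁿ ≤ r elements.
    two-letters : ∀ x y → (∀ s → s ∈ S → s ≡ x ⊎ s ≡ y) → Structure r
    two-letters x y S⊆ with x ∈? S | y ∈? S
    ... | no x∉ | _ = cyclic-set y λ s s∈ → [ (λ { refl → ⊥-elim (x∉ s∈) }) , inj₁ ]′ (S⊆ s s∈)
    ... | yes _ | no y∉ = cyclic-set x λ s s∈ → [ inj₁ , (λ { refl → ⊥-elim (y∉ s∈) }) ]′ (S⊆ s s∈)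
    ... | yes x∈ | yes y∈ with S⊆ (x ⁻¹) (proj₁ (proj₂ gen) x x∈) | S⊆ (y ⁻¹) (proj₁ (proj₂ gen) y y∈)
    ... | inj₂ x⁻¹≡y | _ = cyclic-set x λ s s∈ → [ inj₁ , (λ e → inj₂ (trans e (sym x⁻¹≡y))) ]′ (S⊆ s s∈)
    ... | inj₁ _ | inj₁ y⁻¹≡x = cyclic-set y λ s s∈ → [ (λ e → inj₂ (trans e (sym y⁻¹≡x))) , inj₁ ]′ (S⊆ s s∈)
    ... | inj₁ x⁻¹≡x | inj₂ y⁻¹≡y = ⊥-elim (ℕ.<⇒≱ r<N (ℕ.≤-trans
          (Dihedral.N≤2M x y (square x x⁻¹≡x) (square y y⁻¹≡y) n (eng x y) S gen S⊆) 2ⁿ≤))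
      where
      square : ∀ x → x ⁻¹ ≡ x → x ∙ x ≡ ε
      square x e = trans (cong (_∙ x) (sym e)) (inverseˡ x)

-- Recognising the product of two cyclic groups

module Product (Γ : FinGroup) where
  open GroupOf Γ
  open Generated (finGroup Γ)
  open Finite Γ

  power-commute : ∀ {x y} k → x ∙ y ≡ y ∙ x → power x k ∙ y ≡ y ∙ power x k
  power-commute {x} {y} zero c = trans (identityˡ y) (sym (identityʳ y))
  power-commute {x} {y} (suc k) c = trans (assoc _ _ _) (trans (cong (x ∙_) (power-commute k c))
    (trans (sym (assoc _ _ _)) (trans (cong (_∙ power x k) c) (assoc _ _ _))))

  powers-commute : ∀ {x y} j k → x ∙ y ≡ y ∙ x → power x j ∙ power y k ≡ power y k ∙ power x j
  powers-commute j k c = sym (power-commute k (sym (power-commute j c)))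

  isomorphism : ∀ i j s u → s ∙ u ≡ u ∙ s → power s (suc i) ≡ ε → power u (suc j) ≡ ε →
    (∀ (a a′ : Fin (suc i)) (b b′ : Fin (suc j)) →
      power s (toℕ a) ∙ power u (toℕ b) ≡ power s (toℕ a′) ∙ power u (toℕ b′) → a ≡ a′ × b ≡ b′) →
    (∀ g → Σ (Fin (suc i)) λ a → Σ (Fin (suc j)) λ b → power s (toℕ a) ∙ power u (toℕ b) ≡ g) →
    IsoToCyclicProduct Γ (suc i) (suc j)
  isomorphism i j s u c s^i u^j inj surj = φ , (φ-inj , φ-surj) , φ-hom
    where
    ψ : Fin (suc i) × Fin (suc j) → Fin N
    ψ (a , b) = power s (toℕ a) ∙ power u (toℕ b)
    φ : Fin N → Fin (suc i) × Fin (suc j)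
    φ g = let (a , b , _) = surj g in a , b
    ψφ : ∀ g → ψ (φ g) ≡ g
    ψφ g = let (_ , _ , eq) = surj g in eq
    ψ-inj : ∀ {x y} → ψ x ≡ ψ y → x ≡ y
    ψ-inj {a , b} {a′ , b′} eq = let (e , e′) = inj a a′ b b′ eq in cong₂ _,_ e e′
    φ-inj : ∀ {x y} → φ x ≡ φ y → x ≡ y
    φ-inj {x} {y} eq = trans (sym (ψφ x)) (trans (cong ψ eq) (ψφ y))
    φ-surj : ∀ y → Σ (Fin N) λ x → ∀ {z} → z ≡ x → φ z ≡ y
    φ-surj y = ψ y , λ { refl → ψ-inj (ψφ (ψ y)) }
    add-power : ∀ {m} x → power x (suc m) ≡ ε → (a b : Fin (suc m)) → power x (toℕ (addMod a b)) ≡ power x (toℕ a) ∙ power x (toℕ b)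
    add-power {m} x x^m a b = trans (cong (power x) (Fin.toℕ-fromℕ< (m%n<n (toℕ a + toℕ b) (suc m))))
      (trans (power-% x (suc m) (toℕ a + toℕ b) x^m) (power-+ x (toℕ a) (toℕ b)))
    interchange : ∀ p q p′ q′ → q ∙ p′ ≡ p′ ∙ q → (p ∙ p′) ∙ (q ∙ q′) ≡ (p ∙ q) ∙ (p′ ∙ q′)
    interchange p q p′ q′ e = trans (solve (p ∷ᵥ p′ ∷ᵥ q ∷ᵥ q′ ∷ᵥ []ᵥ) (x₀ ⊙ x₁ ⊙ (x₂ ⊙ x₃)) (x₀ ⊙ (x₁ ⊙ x₂) ⊙ x₃) refl)
      (trans (cong (λ t → p ∙ t ∙ q′) (sym e)) (solve (p ∷ᵥ p′ ∷ᵥ q ∷ᵥ q′ ∷ᵥ []ᵥ) (x₀ ⊙ (x₂ ⊙ x₁) ⊙ x₃) (x₀ ⊙ x₂ ⊙ (x₁ ⊙ x₃)) refl))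
    ψ-hom : ∀ a b a′ b′ → ψ (addMod a a′ , addMod b b′) ≡ ψ (a , b) ∙ ψ (a′ , b′)
    ψ-hom a b a′ b′ = trans (cong₂ _∙_ (add-power s s^i a a′) (add-power u u^j b b′))
      (interchange _ _ _ _ (sym (powers-commute (toℕ a′) (toℕ b) c)))
    φ-hom : ∀ x y → φ (x ∙ y) ≡ (addMod (proj₁ (φ x)) (proj₁ (φ y)) , addMod (proj₂ (φ x)) (proj₂ (φ y)))
    φ-hom x y = ψ-inj (trans (ψφ (x ∙ y)) (sym (trans (ψ-hom (proj₁ (φ x)) (proj₂ (φ x)) (proj₁ (φ y)) (proj₂ (φ y))) (cong₂ _∙_ (ψφ x) (ψφ y)))))

  module _ {r : ℕ} (σ : Structure r) (o : Order (Structure.s σ)) where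
    open Structure σ
    open Order o renaming (s^m to s^m₀)
    m′ : ℕ
    m′ = pred m
    suc-m′ : suc m′ ≡ m
    suc-m′ = ℕ.suc-pred m {{>-nonZero 0<m}}
    s^m : power s (suc m′) ≡ ε
    s^m = trans (cong (power s) suc-m′) s^m₀
    r<m : r < suc m′
    r<m = ℕ.≰⇒> λ m≤r → far m′ m≤r s^m
    power-inj< : ∀ a a′ → a < suc m′ → a′ < suc m′ → power s a ≡ power s a′ → ¬ a < a′
    power-inj< a a′ a< a′< eq a<a′ = minimal (a′ ∸ a) (ℕ.m<n⇒0<n∸m a<a′)
      (ℕ.≤-<-trans (ℕ.m∸n≤m a′ a) (subst (a′ <_) suc-m′ a′<)) (power-diff s a a′ (ℕ.<⇒≤ a<a′) eq)
    power-inj : ∀ (a a′ : Fin (suc m′)) → power s (toℕ a) ≡ power s (toℕ a′) → a ≡ a′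
    power-inj a a′ eq = Fin.toℕ-injective (ℕ.≤-antisym
      (ℕ.≮⇒≥ (power-inj< _ _ (Fin.toℕ<n a′) (Fin.toℕ<n a) (sym eq)))
      (ℕ.≮⇒≥ (power-inj< _ _ (Fin.toℕ<n a) (Fin.toℕ<n a′) eq)))
    mod : ∀ k → power s (toℕ (fromℕ< (m%n<n k (suc m′)))) ≡ power s k
    mod k = trans (cong (power s) (Fin.toℕ-fromℕ< (m%n<n k (suc m′)))) (power-% s (suc m′) k s^m)
    reduce : ∀ g k → u ≡ power s k → ∀ k′ → g ≡ power s k′ ⊎ g ≡ power s k′ ∙ u →
      Σ (Fin (suc m′)) λ a → Σ (Fin 1) λ b → power s (toℕ a) ∙ power ε (toℕ b) ≡ g
    reduce g k u≡ k′ (inj₁ e) = fromℕ< (m%n<n k′ (suc m′)) , fzero , trans (identityʳ _) (trans (mod k′) (sym e))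
    reduce g k u≡ k′ (inj₂ e) = fromℕ< (m%n<n (k′ + k) (suc m′)) , fzero ,
      trans (identityʳ _) (trans (mod (k′ + k)) (trans (power-+ s k′ k) (sym (trans e (cong (power s k′ ∙_) u≡)))))
    surjective : ∀ g → Σ (Fin (suc m′)) λ a → Σ (Fin 2) λ b → power s (toℕ a) ∙ power u (toℕ b) ≡ g
    surjective g with reps g
    ... | k , inj₁ e = fromℕ< (m%n<n k (suc m′)) , fzero , trans (identityʳ _) (trans (mod k) (sym e))
    ... | k , inj₂ e = fromℕ< (m%n<n k (suc m′)) , fsuc fzero , trans (cong₂ _∙_ (mod k) (identityʳ u)) (sym e)
    u-power : ∀ (a a′ : Fin (suc m′)) → power s (toℕ a) ≡ power s (toℕ a′) ∙ u → Σ (Fin N) λ k → u ≡ power s (toℕ k)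
    u-power a a′ eq = unrep (Representatives.rep-bounded s ε (trans (identityʳ s) (sym (identityˡ s))) (identityˡ ε) (k , inj₁ u≡))
      where
      k : ℕ
      -- The difference of the exponents a and a′, raised by the order of `s` to stay a natural
      -- number.
      k = (suc m′ ∸ toℕ a′) + toℕ a
      u≡ : u ≡ power s k
      u≡ = ∙-cancelˡ (power s (toℕ a′)) _ _ (trans (sym eq) (sym (trans (sym (power-+ s (toℕ a′) k))
        (trans (cong (power s) (trans (sym (ℕ.+-assoc (toℕ a′) _ (toℕ a))) (cong (_+ toℕ a) (ℕ.m+[n∸m]≡n (ℕ.<⇒≤ (Fin.toℕ<n a′))))))
        (trans (power-+ s (suc m′) (toℕ a)) (trans (cong (_∙ power s (toℕ a)) s^m) (identityˡ _)))))))
      unrep : Σ (Fin N) (λ k → u ≡ power s (toℕ k) ⊎ u ≡ power s (toℕ k) ∙ ε) → Σ (Fin N) λ k → u ≡ power s (toℕ k)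
      unrep (k , inj₁ e) = k , e
      unrep (k , inj₂ e) = k , trans e (identityʳ _)
    injective : ¬ Σ (Fin N) (λ k → u ≡ power s (toℕ k)) → ∀ (a a′ : Fin (suc m′)) (b b′ : Fin 2) →
      power s (toℕ a) ∙ power u (toℕ b) ≡ power s (toℕ a′) ∙ power u (toℕ b′) → a ≡ a′ × b ≡ b′
    injective u∉ a a′ fzero fzero eq = power-inj a a′ (∙-cancelʳ _ _ _ eq) , refl
    injective u∉ a a′ (fsuc fzero) (fsuc fzero) eq = power-inj a a′ (∙-cancelʳ _ _ _ eq) , refl
    injective u∉ a a′ fzero (fsuc fzero) eq = ⊥-elim (u∉ (u-power a a′
      (trans (sym (identityʳ _)) (trans eq (cong (power s (toℕ a′) ∙_) (identityʳ u))))))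
    injective u∉ a a′ (fsuc fzero) fzero eq = ⊥-elim (u∉ (u-power a′ a
      (trans (sym (identityʳ _)) (trans (sym eq) (cong (power s (toℕ a) ∙_) (identityʳ u))))))

    -- If `u` is a power of `s`, then `s` alone generates and the second factor is trivial;
    -- otherwise the products of a power of `s` and a power of `u` are pairwise distinct.
    product-structure : CondIII Γ r
    product-structure = case Fin.any? (λ (k : Fin N) → u Fin.≟ power s (toℕ k)) of λ
     { (yes (k , u≡)) → suc m′ , 1 , r<m , inj₁ refl , isomorphism m′ 0 s ε
         (trans (identityʳ s) (sym (identityˡ s))) s^m (identityʳ ε)
         (λ { a a′ fzero fzero eq → power-inj a a′ (∙-cancelʳ _ _ _ eq) , refl })
         (λ g → let (k′ , e) = reps g in reduce g (toℕ k) u≡ k′ e)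
     ; (no u∉) → suc m′ , 2 , r<m , inj₂ refl , isomorphism m′ 1 s u commute s^m (trans (cong (u ∙_) (identityʳ u)) u²)
         (injective u∉) surjective }

  structure⇒III : ∀ {r} → Structure r → CondIII Γ r
  structure⇒III σ = product-structure σ (order (Structure.s σ))

-- For n = 1 the requirement is 20, more than 4² = 16, so the hypothesis r ≥ 20 is used. From n = 2
-- on, where it reads 40 ≤ 64, the power of 4 suffices.
bound : ∀ n r → 1 ≤ n → 4 ^ (n + 1) ≤ r → 20 ≤ r → 2 ^ n * 10 ≤ r
bound (suc zero) r _ _ 20≤r = 20≤r
bound (suc (suc n)) r _ 4ⁿ≤r _ = ℕ.≤-trans (le n) 4ⁿ≤r
  where
  le : ∀ n → 2 ^ (2 + n) * 10 ≤ 4 ^ (2 + n + 1)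
  le zero = ℕ.m≤m+n 40 24
  le (suc n) = subst (_≤ 4 ^ (3 + n + 1)) (sym (ℕ.*-assoc 2 (2 ^ (2 + n)) 10))
    (ℕ.*-mono-≤ {2} {4} (ℕ.m≤m+n 2 2) (le n))

module Solve (Γ : FinGroup) (n r : ℕ) (1≤n : 1 ≤ n) (nilpotent : NilpotentClass≤ Γ n) (2ⁿ*10≤r : 2 ^ n * 10 ≤ r)
             (2≤r : 2 ≤ r) (r<N : r < FinGroup.N Γ) (S : Subset (FinGroup.N Γ)) (gen : IsGeneratingSet Γ S) where
  open GroupOf Γ

  graph : CayleyGraph
  graph = record { Γ = Γ ; S = S ; gen = gen ; r = r ; 2≤r = 2≤r }

  open Finite Γ
  open Words graph
  private
    module Gₐ = Generated (finGroup Γ)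
    module Gʷ = Generated wordGroup

  ev-power : ∀ w k → ev (Gʷ.power w k) ≡ Gₐ.power (ev w) k
  ev-power w zero = refl
  ev-power w (suc k) = trans (ev-++ w _) (cong (ev w ∙_) (ev-power w k))

  ev-gen : ∀ {s u w} → Gʷ.Gen s u w → Gₐ.Gen (ev s) (ev u) (ev w)
  ev-gen (Gʷ.nil e) = Gₐ.nil (ev-≋ e)
  ev-gen {s} (Gʷ._·s_ {g} γ e) = ev-gen γ Gₐ.·s trans (ev-≋ e) (ev-++ g s)
  ev-gen {s} (Gʷ._·s⁻¹_ {g} γ e) = ev-gen γ Gₐ.·s⁻¹ trans (ev-≋ e) (trans (ev-++ g (inv s)) (cong (ev g ∙_) (ev-inv s)))
  ev-gen {u = u} (Gʷ._·u_ {g} γ e) = ev-gen γ Gₐ.·u trans (ev-≋ e) (ev-++ g u)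

  word : ∀ g → Σ Word λ w → ev w ≡ g
  word g = let (l , l∈ , eq) = proj₂ (proj₂ gen) g in toWord l l∈ , trans (ev-toWord l l∈) eq
    where
    toWord : ∀ l → All (_∈ S) l → Word
    toWord [] [] = []
    toWord (a ∷ l) (a∈ ∷ l∈) = (a , a∈) ∷ toWord l l∈
    ev-toWord : ∀ l l∈ → ev (toWord l l∈) ≡ prod Γ l
    ev-toWord [] [] = refl
    ev-toWord (a ∷ l) (a∈ ∷ l∈) = cong (a ∙_) (ev-toWord l l∈)

  length-power : ∀ a k → length (Gʷ.power (a ∷ []) k) ≡ k
  length-power a zero = refl
  length-power a (suc k) = cong suc (length-power a k)

  fromGenerators : Generators letterGroup → Structure r
  fromGenerators γ = case kind of λ
    { (inj₁ (a , s≋a , torsion-free)) → record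
        { s = ev s ; u = ev u ; commute = commuteΓ ; u² = u²Γ
        -- `s` equals a letter, so a power with exponent at most r that vanishes in Γ is a closed
        -- word short enough to vanish in the cover.
        ; far = λ k k<r eq → torsion-free k (W.trans (power-cong (suc k) s≋a) (ret (closed-~ _
            (subst (_≤ r) (sym (length-power a (suc k))) k<r)
            (trans (ev-power (a ∷ []) (suc k)) (trans (cong (λ x → Gₐ.power x (suc k)) (sym (ev-≋ s≋a))) eq)))))
        ; reps = allReps }
    ; (inj₂ u≋ε) → cyclic (ev s) r<N λ g → case allReps g of λ
        { (k , inj₁ e) → k , e
        ; (k , inj₂ e) → k , trans e (trans (cong (Gₐ.power (ev s) k ∙_) (ev-≋ u≋ε)) (identityʳ _)) } }
    where
    open Generators γ
    module W = Group wordGroup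
    commuteΓ : ev s ∙ ev u ≡ ev u ∙ ev s
    commuteΓ = trans (sym (ev-++ s u)) (trans (ev-≋ commute) (ev-++ u s))
    u²Γ : ev u ∙ ev u ≡ ε
    u²Γ = trans (sym (ev-++ u u)) (ev-≋ u²)
    open Representatives (ev s) (ev u) commuteΓ u²Γ
    rep-word : ∀ {x} w → Rep x → ¬ ¬ Rep (x ∙ ev w)
    rep-word [] ρ k = k (subst Rep (sym (identityʳ _)) ρ)
    rep-word (a ∷ w) ρ k = generates a λ γa →
      rep-word w (rep-gen ρ (subst (Gₐ.Gen _ _) (identityʳ (proj₁ a)) (ev-gen γa))) (k ∘ subst Rep (assoc _ _ _))
    allReps : ∀ g → Rep g
    allReps g = let (w , eq) = word g in
      rep-stable λ k → rep-word w rep-ε (k ∘ subst Rep (trans (identityˡ _) eq))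
    power-cong : ∀ k {x y} → x ≋ y → Gʷ.power x k ≋ Gʷ.power y k
    power-cong zero e = W.refl
    power-cong (suc k) {x} {y} e = W.∙-cong {x} {y} e (power-cong k e)

  -- The existence of a structure is decided beforehand, so refuting its absence is enough, and
  -- there double negations are harmless. A finite search also separates degree at least three from
  -- a generating set within {x , y}.
  fromSeparation : ¬ ¬ Separation → Structure r
  fromSeparation sep with structure? r r<N
  ... | yes σ = σ
  ... | no none with Fin.all? (λ x → Fin.all? λ y → Fin.any? λ s → (s ∈? S) ×-dec ¬? (s Fin.≟ x) ×-dec ¬? (s Fin.≟ y))
  ... | yes branch = ⊥-elim (sep λ σ → minimise (λ x y → let (s , s∈ , n) = branch x y in (s , s∈) , n) σ λ M →
          Classification.classification letterGroup M n 1≤n (engel-words n 2ⁿ*10≤r (engel n 1≤n nilpotent)) (none ∘ fromGenerators))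
  ... | no ¬branch with Fin.¬∀⟶∃¬ N _ (λ x → Fin.all? λ y → Fin.any? λ s → (s ∈? S) ×-dec ¬? (s Fin.≟ x) ×-dec ¬? (s Fin.≟ y)) ¬branch
  ... | x , ¬branchˣ with Fin.¬∀⟶∃¬ N _ (λ y → Fin.any? λ s → (s ∈? S) ×-dec ¬? (s Fin.≟ x) ×-dec ¬? (s Fin.≟ y)) ¬branchˣ
  ... | y , only = SmallDegree.two-letters n r r<N 2·2ⁿ≤r (engel n 1≤n nilpotent) S gen x y λ s s∈ → split s s∈
    where
    2·2ⁿ≤r : 2 ^ n + 2 ^ n ≤ r
    2·2ⁿ≤r = ℕ.≤-trans (ℕ.≤-reflexive (trans (cong (2 ^ n +_) (sym (ℕ.+-identityʳ _))) (ℕ.*-comm 2 (2 ^ n))))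
      (ℕ.≤-trans (ℕ.*-monoʳ-≤ (2 ^ n) (ℕ.m≤m+n 2 8)) 2ⁿ*10≤r)
    split : ∀ s → s ∈ S → s ≡ x ⊎ s ≡ y
    split s s∈ with s Fin.≟ x | s Fin.≟ y
    ... | yes e | _ = inj₁ e
    ... | no _ | yes e = inj₂ e
    ... | no n | no n′ = ⊥-elim (only (s , s∈ , n , n′))

-- From local to global separators

-- Makes a Boolean colouring of the vertices out of reachability in a local graph, without deciding
-- reachability.
finite-em : ∀ {n} (P : Fin n → Set) → ¬ ¬ (∀ i → Dec (P i))
finite-em {zero} P k = k λ ()
finite-em {suc n} P k = em λ d → finite-em (P ∘ fsuc) λ f → k λ { fzero → d ; (fsuc i) → f i }

does-⇔ : ∀ {P Q : Set} (i : Dec P) (j : Dec Q) → (P → Q) → (Q → P) → does i ≡ does j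
does-⇔ (yes _) (yes _) f g = refl
does-⇔ (no _) (no _) f g = refl
does-⇔ (yes p) (no n) f g = ⊥-elim (n (f p))
does-⇔ (no n) (yes q) f g = ⊥-elim (n (g q))

does-true : ∀ {P : Set} (i : Dec P) → P → does i ≡ true
does-true (yes _) _ = refl
does-true (no n) p = ⊥-elim (n p)

does-false : ∀ {P : Set} (i : Dec P) → ¬ P → does i ≡ false
does-false (no _) _ = refl
does-false (yes p) n = ⊥-elim (n p)

module WalkWords (C : CayleyGraph) where
  open CayleyGraph C
  open GroupOf Γ
  open Words C public
  open Walks (CayAdj Γ S)

  infixl 7 _▹_
  _▹_ : Fin N → Word → Fin N
  x ▹ [] = x
  x ▹ (a ∷ w) = x ∙ proj₁ a ▹ w

  ▹-ev : ∀ x w → x ▹ w ≡ x ∙ ev w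
  ▹-ev x [] = sym (identityʳ x)
  ▹-ev x (a ∷ w) = trans (▹-ev (x ∙ proj₁ a) w) (assoc _ _ _)

  ▹-++ : ∀ x u w → x ▹ (u ++ w) ≡ x ▹ u ▹ w
  ▹-++ x [] w = refl
  ▹-++ x (a ∷ u) w = ▹-++ (x ∙ proj₁ a) u w

  ▹-cong : ∀ x {u w} → ev u ≡ ev w → x ▹ u ≡ x ▹ w
  ▹-cong x {u} {w} eq = trans (▹-ev x u) (trans (cong (x ∙_) eq) (sym (▹-ev x w)))

  ▹-injective : ∀ x {u w} → x ▹ u ≡ x ▹ w → ev u ≡ ev w
  ▹-injective x {u} {w} eq = ∙-cancelˡ x _ _ (trans (sym (▹-ev x u)) (trans eq (▹-ev x w)))

  ▹-closed : ∀ x {w} → ev w ≡ ε → x ▹ w ≡ x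
  ▹-closed x {w} eq = ▹-cong x {w} {[]} eq

  walkTo : ∀ x w {y} → x ▹ w ≡ y → Walk x y
  walkTo x [] refl = []
  walkTo x (a ∷ w) eq = (proj₁ a , proj₂ a , refl) ∷ walkTo (x ∙ proj₁ a) w eq

  len-walkTo : ∀ x w {y} (eq : x ▹ w ≡ y) → len (walkTo x w eq) ≡ length w
  len-walkTo x [] refl = refl
  len-walkTo x (a ∷ w) eq = cong suc (len-walkTo (x ∙ proj₁ a) w eq)

  edge-walkTo : ∀ x d t e {y} (eq : x ▹ (d ++ t ∷ e) ≡ y) → (x ▹ d , x ▹ d ∙ proj₁ t) LM.∈ edges (walkTo x (d ++ t ∷ e) eq)
  edge-walkTo x [] t e eq = here refl
  edge-walkTo x (a ∷ d) t e eq = there (edge-walkTo (x ∙ proj₁ a) d t e eq)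

  vert-walkTo : ∀ x d e {y} (eq : x ▹ (d ++ e) ≡ y) → (x ▹ d) LM.∈ verts (walkTo x (d ++ e) eq)
  vert-walkTo x [] [] refl = here refl
  vert-walkTo x [] (a ∷ e) eq = here refl
  vert-walkTo x (a ∷ d) e eq = there (vert-walkTo (x ∙ proj₁ a) d e eq)

  toWord : ∀ {x y} → Walk x y → Word
  toWord [] = []
  toWord ((s , s∈ , _) ∷ W) = (s , s∈) ∷ toWord W

  ▹-toWord : ∀ {x y} (W : Walk x y) → x ▹ toWord W ≡ y
  ▹-toWord [] = refl
  ▹-toWord ((s , s∈ , refl) ∷ W) = ▹-toWord W

  length-toWord : ∀ {x y} (W : Walk x y) → length (toWord W) ≡ len W
  length-toWord [] = refl
  length-toWord (_ ∷ W) = cong suc (length-toWord W)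

  vert-toWord : ∀ {x y z} (W : Walk x y) → z LM.∈ verts W → Σ Word λ c → Σ Word λ c′ → toWord W ≡ c ++ c′ × x ▹ c ≡ z
  vert-toWord [] (here refl) = [] , [] , refl , refl
  vert-toWord (e ∷ W) (here refl) = [] , _ , refl , refl
  vert-toWord ((s , s∈ , refl) ∷ W) (there z∈) = let (c , c′ , eq , eq′) = vert-toWord W z∈ in
    (s , s∈) ∷ c , c′ , cong (_ ∷_) eq , eq′

  open LocalSep (CayAdj Γ S) r

  module _ (x : Fin N) where
    Short : Word → Set
    Short c = length c ≤ r × ev c ≡ ε

    loop : ∀ c → ev c ≡ ε → Walk x x
    loop c eq = walkTo x c (▹-closed x {c} eq)

    in-ball : ∀ d e → Short (d ++ e) → InBall x (x ▹ d)
    in-ball d e (le , eq) = loop (d ++ e) eq , subst (_≤ r) (sym (len-walkTo x (d ++ e) _)) le , vert-walkTo x d e _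

    ball-edge : ∀ d t e → Short (d ++ t ∷ e) → BallEdge x (x ▹ d) (x ▹ d ∙ proj₁ t)
    ball-edge d t e (le , eq) = loop (d ++ t ∷ e) eq , subst (_≤ r) (sym (len-walkTo x (d ++ t ∷ e) _)) le , inj₁ (edge-walkTo x d t e _)

    ball-sym : ∀ {D y z} → BallStep x D y z → BallStep x D z y
    ball-sym ((C , le , e) , n , n′) = (C , le , [ inj₂ , inj₁ ]′ e) , n′ , n

    ball-rev : ∀ {D y z} → Star (BallStep x D) y z → Star (BallStep x D) z y
    ball-rev = Star.reverse ball-sym

  Avoid : (Fin N → Set) → Fin N → Word → Set
  Avoid F y [] = ¬ F y
  Avoid F y (a ∷ l) = ¬ F y × Avoid F (y ∙ proj₁ a) l

  avoid-head : ∀ {F y} l → Avoid F y l → ¬ F y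
  avoid-head [] n = n
  avoid-head (_ ∷ _) (n , _) = n

  avoid-last : ∀ {F y} l → Avoid F y l → ¬ F (y ▹ l)
  avoid-last [] n = n
  avoid-last (_ ∷ l) (_ , av) = avoid-last l av

  ball-path : ∀ x D d l e → Short x (d ++ l ++ e) → Avoid (LM._∈ D) (x ▹ d) l → Star (BallStep x D) (x ▹ d) (x ▹ d ▹ l)
  ball-path x D d [] e sh av = Star.ε
  ball-path x D d (a ∷ l) e sh (n , av) =
    (ball-edge x d a (l ++ e) sh , n , avoid-head l av) ◅
    subst (λ y → Star (BallStep x D) y (y ▹ l)) (▹-++ x d _)
      (ball-path x D (d ++ a ∷ []) l e (subst (Short x) (sym (List.++-assoc d _ _)) sh) (subst (λ y → Avoid (LM._∈ D) y l) (sym (▹-++ x d _)) av))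

module Parity (C : CayleyGraph)
              (g₀ : Fin (FinGroup.N (CayleyGraph.Γ C))) (V : Words.Word C) (2V≤r : length V + length V ≤ CayleyGraph.r C)
              (red : Fin (FinGroup.N (CayleyGraph.Γ C)) → Bool) where
  open CayleyGraph C
  open GroupOf Γ
  open WalkWords C
  open Paths letterGroup renaming (here to hereₚ; step to stepₚ)
  private module W = Group wordGroup

  X : Word → Set
  X = Pair [] V

  Xᴳ : Fin N → Set
  Xᴳ y = y ≡ g₀ ⊎ y ≡ g₀ ▹ V

  π : Word → Fin N
  π p = g₀ ▹ p

  π-resp : ∀ {p q} → p ≋ q → π p ≡ π q
  π-resp {p} {q} e = ▹-cong g₀ {p} {q} (ev-≋ e)

  Closed : Word → Set
  Closed c = length c ≤ r × ev c ≡ ε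

  rotate : ∀ u w → Closed (u ++ w) → Closed (w ++ u)
  rotate u w (le , eq) = subst (_≤ r) (List.length-++-comm u w) le ,
    trans (ev-++ w u) (trans (cong (_∙ ev u) (inverseʳ-unique _ _ (trans (sym (ev-++ u w)) eq))) (inverseˡ _))

  -- If the arc m is too long, its complement m′ is short enough.
  arc-~ : ∀ m m′ w → Closed (m ++ m′) → length w + length w ≤ r → ev m ≡ ev w → m ~ w
  arc-~ m m′ w (le , eq) 2w≤r e with length m + length w ℕ.≤? r
  ... | yes short = short-~ m w e short
  ... | no long = ~-trans m~ (short-~ (inv m′) w (trans (sym (ev-~ m~)) e)
          (subst (λ k → k + length w ≤ r) (sym (length-inv m′)) (ℕ.≤-trans (ℕ.+-monoˡ-≤ (length w) m′≤w) 2w≤r)))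
    where
    m~ : m ~ inv m′
    m~ = ~-trans (~-trans (~-≡ (sym (List.++-identityʳ m))) (~-++ˡ m (~-sym (inv-cancelʳ m′))))
      (~-trans (~-≡ (sym (List.++-assoc m m′ _))) (del [] (m ++ m′) (inv m′) le eq))
    m′≤w : length m′ ≤ length w
    m′≤w = ℕ.+-cancelˡ-≤ (length m) _ _ (ℕ.≤-trans (subst (_≤ r) (List.length-++ m) le) (ℕ.<⇒≤ (ℕ.≰⇒> long)))

  -- The arc `m` has the value of the empty word, of `V` or of its inverse, and it lies on a short
  -- closed walk. With |V| ≤ r/2 this makes them equal in the cover. So near `X` the cover sees the
  -- same separator as Γ.
  lift-X : ∀ {x} m m′ → X x → Closed (m ++ m′) → Xᴳ (π (x ++ m)) → X (x ++ m)
  lift-X {x} m m′ Xx cl xg = go Xx xg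
    where
    m≤r : length m ≤ r
    m≤r = ℕ.≤-trans (ℕ.m≤m+n _ _) (subst (_≤ r) (List.length-++ m) (proj₁ cl))
    at : ∀ w → x ≋ w → π (x ++ m) ≡ π (w ++ m)
    at w e = π-resp (W.∙-congʳ {m} {x} {w} e)
    go : X x → Xᴳ (π (x ++ m)) → X (x ++ m)
    go (inj₁ e) (inj₁ h) = inj₁ (W.trans (W.∙-congʳ {m} {x} {[]} e)
      (ret (closed-~ m m≤r (▹-injective g₀ {m} {[]} (trans (sym (at [] e)) h)))))
    go (inj₁ e) (inj₂ h) = inj₂ (W.trans (W.∙-congʳ {m} {x} {[]} e)
      (ret (arc-~ m m′ V cl 2V≤r (▹-injective g₀ {m} {V} (trans (sym (at [] e)) h)))))
    go (inj₂ e) (inj₁ h) = inj₁ (W.trans (W.∙-congʳ {m} {x} {V} e)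
      (ret (~-trans (~-++ˡ V (arc-~ m m′ (inv V) cl (subst (λ k → k + k ≤ r) (sym (length-inv V)) 2V≤r)
        (trans (inverseʳ-unique _ _ (trans (sym (ev-++ V m)) (▹-injective g₀ {V ++ m} {[]} (trans (sym (at V e)) h)))) (sym (ev-inv V)))))
        (inv-cancelʳ V))))
    go (inj₂ e) (inj₂ h) = inj₂ (W.trans (W.∙-congʳ {m} {x} {V} e)
      (ret (~-trans (~-++ˡ V (closed-~ m m≤r (cancel (▹-injective g₀ {V ++ m} {V} (trans (sym (at V e)) h)))))
        (~-≡ (List.++-identityʳ V)))))
      where
      cancel : ev (V ++ m) ≡ ev V → ev m ≡ ε
      cancel eq = ∙-cancelˡ (ev V) _ _ (trans (sym (ev-++ V m)) (trans eq (sym (identityʳ _))))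

  X⇒Xᴳ : ∀ {p} → X p → Xᴳ (π p)
  X⇒Xᴳ (inj₁ e) = inj₁ (π-resp e)
  X⇒Xᴳ (inj₂ e) = inj₂ (π-resp e)

  -- The first two arguments say whether the ends of an edge lie in `X`, the last two whether they
  -- are red. An edge counts if it joins `X` to a red vertex outside `X`.
  cross : Bool → Bool → Bool → Bool → Bool
  cross true  false p q = q
  cross false true  p q = p
  cross _     _     p q = false

  -- `Par p w b`: the parity of the number of edges between X and its red neighbours on the walk
  -- spelled by w from p is b.  It is a relation because membership in X is not decidable.
  data Par : Word → Word → Bool → Set where
    nil  : ∀ {p} → Par p [] false
    cons : ∀ {p a w b} (i : Dec (X p)) (j : Dec (X (p ++ a ∷ []))) → Par (p ++ a ∷ []) w b →
           Par p (a ∷ w) (cross (does i) (does j) (red (π p)) (red (π (p ++ a ∷ []))) xor b)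

  par-total : ∀ p w → ¬ ¬ Σ Bool (Par p w)
  par-total p [] k = k (false , nil)
  par-total p (a ∷ w) k = em λ i → em λ j → par-total (p ++ a ∷ []) w λ (b , P) → k (_ , cons i j P)

  snoc-cong : ∀ {p q} (a : Letter) → p ≋ q → (p ++ a ∷ []) ≋ (q ++ a ∷ [])
  snoc-cong {p} {q} a e = W.∙-congʳ {a ∷ []} {p} {q} e

  par-fun : ∀ {p q w b c} → p ≋ q → Par p w b → Par q w c → b ≡ c
  par-fun e nil nil = refl
  par-fun {p} {q} e (cons {a = a} i j P) (cons i′ j′ Q) = cong₂ _xor_
    (trans (cong₂ (λ x y → cross x y (red (π p)) (red (π (p ++ a ∷ []))))
        (does-⇔ i i′ (pair-resp e) (pair-resp (W.sym e))) (does-⇔ j j′ (pair-resp e′) (pair-resp (W.sym e′))))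
      (cong₂ (λ x y → cross (does i′) (does j′) (red x) (red y)) (π-resp e) (π-resp e′)))
    (par-fun e′ P Q)
    where
    e′ : (p ++ a ∷ []) ≋ (q ++ a ∷ [])
    e′ = snoc-cong a e

  par-resp : ∀ {p q w b} → p ≋ q → Par p w b → ¬ ¬ Par q w b
  par-resp {q = q} {w} e P k = par-total q w λ (c , Q) → k (subst (Par q w) (sym (par-fun e P Q)) Q)

  par-++ : ∀ {p} u w {b} → Par p (u ++ w) b → Σ Bool λ c → Σ Bool λ d → Par p u c × Par (p ++ u) w d × b ≡ c xor d
  par-++ {p} [] w P = false , _ , nil , subst (λ p → Par p w _) (sym (List.++-identityʳ p)) P , refl
  par-++ {p} (a ∷ u) w (cons i j P) = let
      (c , d , Q , R , eq) = par-++ u w P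
      x = cross (does i) (does j) (red (π p)) (red (π (p ++ a ∷ [])))
    in
    _ , d , cons i j Q , subst (λ p → Par p w d) (List.++-assoc p _ u) R ,
    trans (cong (x xor_) eq) (sym (xor-assoc x c d))

  par-single : ∀ {p a b} → Par p (a ∷ []) b → Σ (Dec (X p)) λ i → Σ (Dec (X (p ++ a ∷ []))) λ j →
    b ≡ cross (does i) (does j) (red (π p)) (red (π (p ++ a ∷ [])))
  par-single (cons i j nil) = i , j , xor-identityʳ _

  -- The only property required of the colouring: an excursion from `X` back to `X` along a short
  -- closed walk leaves and returns through neighbours of one colour. Cutvertices and 2-separators
  -- both provide it.
  Locally : Set
  Locally = ∀ x a l t m → Xᴳ x → Closed ((a ∷ l) ++ t ∷ m) → Avoid Xᴳ (x ∙ proj₁ a) l → Xᴳ (x ∙ proj₁ a ▹ l ∙ proj₁ t) →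
    red (x ∙ proj₁ a) ≡ red (x ∙ proj₁ a ▹ l)

  data Avoidʷ : Word → Word → Set where
    [_] : ∀ {p} → ¬ X p → Avoidʷ p []
    _∷_ : ∀ {p a l} → ¬ X p → Avoidʷ (p ++ a ∷ []) l → Avoidʷ p (a ∷ l)

  avoidʷ-snoc : ∀ {p} l t → Avoidʷ p l → ¬ X (p ++ l ++ t ∷ []) → Avoidʷ p (l ++ t ∷ [])
  avoidʷ-snoc [] t [ n ] n′ = n ∷ [ n′ ]
  avoidʷ-snoc {p} (a ∷ l) t (n ∷ av) n′ = n ∷ avoidʷ-snoc l t av (n′ ∘ subst X (List.++-assoc p _ _))

  avoidʷ-last : ∀ {p} l → Avoidʷ p l → ¬ X (p ++ l)
  avoidʷ-last {p} [] [ n ] = n ∘ subst X (List.++-identityʳ p)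
  avoidʷ-last {p} (a ∷ l) (_ ∷ av) = avoidʷ-last l av ∘ subst X (sym (List.++-assoc p _ l))

  avoid-down : ∀ {x} m l e → X x → Closed (m ++ l ++ e) → Avoidʷ (x ++ m) l → Avoid Xᴳ (π (x ++ m)) l
  avoid-down m [] e Xx cl [ n ] = n ∘ lift-X m e Xx cl
  avoid-down {x} m (a ∷ l) e Xx cl (n ∷ av) = n ∘ lift-X m _ Xx cl ,
    subst (λ y → Avoid Xᴳ y l) (trans (cong π (sym (List.++-assoc x m _))) (▹-++ g₀ (x ++ m) _))
      (avoid-down (m ++ a ∷ []) l e Xx (subst Closed (sym (List.++-assoc m _ _)) cl)
        (subst (λ p → Avoidʷ p l) (List.++-assoc x m _) av))

  module _ (locally : Locally) where
    mutual
      -- A segment of a short closed walk from `X` to `X` falls into excursions, each of which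
      -- contributes its two end edges or none. The complement `c′` is carried along so that each
      -- excursion is still seen on a short closed walk based at its starting point.
      par-X : ∀ x c c′ {b} → X x → Closed (c ++ c′) → X (x ++ c) → Par x c b → b ≡ false
      par-X x [] c′ Xx cl Xc nil = refl
      par-X x (a ∷ c) c′ Xx cl Xc (cons (no n) _ P) = ⊥-elim (n Xx)
      par-X x (a ∷ c) c′ Xx cl Xc (cons (yes _) (yes Xa) P) =
        par-X (x ++ a ∷ []) c (c′ ++ a ∷ []) Xa (subst Closed (List.++-assoc c c′ _) (rotate (a ∷ []) (c ++ c′) cl))
          (subst X (sym (List.++-assoc x _ c)) Xc) P
      par-X x (a ∷ c) c′ Xx cl Xc (cons (yes _) (no nXa) P) =
        trans (cong (red (π (x ++ a ∷ [])) xor_) (par-out x a [] c c′ Xx [ nXa ] cl Xc P)) (xor-same (red (π (x ++ a ∷ []))))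

      -- The state within an excursion: it left `x` by `a` and has followed `l` outside `X`. The
      -- parity still to come cancels the edge of departure.
      par-out : ∀ x a l c c′ {b} → X x → Avoidʷ (x ++ a ∷ []) l → Closed ((a ∷ l) ++ c ++ c′) →
        X (x ++ (a ∷ l) ++ c) → Par (x ++ a ∷ l) c b → b ≡ red (π (x ++ a ∷ []))
      par-out x a l [] c′ Xx av cl Xc nil = ⊥-elim (avoidʷ-last l av
        (subst X (trans (cong (λ t → x ++ a ∷ t) (List.++-identityʳ l)) (sym (List.++-assoc x _ l))) Xc))
      par-out x a l (t ∷ c) c′ Xx av cl Xc (cons (yes Xl) _ P) =
        ⊥-elim (avoidʷ-last l av (subst X (sym (List.++-assoc x _ l)) Xl))
      par-out x a l (t ∷ c) c′ Xx av cl Xc (cons (no _) (no nXt) P) =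
        par-out x a (l ++ t ∷ []) c c′ Xx (avoidʷ-snoc l t av (nXt ∘ subst X (trans (List.++-assoc x _ _) (sym (List.++-assoc x (a ∷ l) _)))))
          (subst Closed (cong (a ∷_) (sym (List.++-assoc l _ _))) cl)
          (subst X (cong (λ u → x ++ a ∷ u) (sym (List.++-assoc l _ c))) Xc)
          (subst (λ p → Par p c _) (List.++-assoc x (a ∷ l) _) P)
      par-out x a l (t ∷ c) c′ Xx av cl Xc (cons (no _) (yes Xt) P) =
        trans (cong₂ _xor_ (sym colour) rest) (xor-identityʳ _)
        where
        x▹ : ∀ w → π x ▹ w ≡ π (x ++ w)
        x▹ w = sym (▹-++ g₀ x w)
        colour : red (π (x ++ a ∷ [])) ≡ red (π (x ++ a ∷ l))
        colour = trans (cong red (sym (x▹ (a ∷ []))))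
          (trans (locally (π x) a l t (c ++ c′) (X⇒Xᴳ Xx) cl
            (subst (λ y → Avoid Xᴳ y l) (sym (x▹ (a ∷ []))) (avoid-down (a ∷ []) l _ Xx cl av))
            (subst Xᴳ (trans (▹-++ g₀ (x ++ a ∷ l) (t ∷ [])) (cong (_∙ proj₁ t) (sym (x▹ (a ∷ l))))) (X⇒Xᴳ Xt)))
          (cong red (x▹ (a ∷ l))))
        rest = par-X ((x ++ a ∷ l) ++ t ∷ []) c (c′ ++ (a ∷ l) ++ t ∷ []) Xt
          (subst Closed (List.++-assoc c c′ _) (rotate ((a ∷ l) ++ t ∷ []) (c ++ c′)
            (subst Closed (cong (a ∷_) (sym (List.++-assoc l _ _))) cl)))
          (subst X (sym (trans (List.++-assoc (x ++ a ∷ l) _ c) (List.++-assoc x _ _))) Xc) P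

    par-outside : ∀ p c {b} → (∀ d e → c ≡ d ++ e → ¬ X (p ++ d)) → Par p c b → b ≡ false
    par-outside p [] n nil = refl
    par-outside p (a ∷ c) n (cons i j P) with i | j
    ... | yes Xp | _ = ⊥-elim (n [] (a ∷ c) refl (subst X (sym (List.++-identityʳ p)) Xp))
    ... | no _ | yes Xa = ⊥-elim (n (a ∷ []) c refl Xa)
    ... | no _ | no _ = par-outside (p ++ a ∷ []) c (λ d e eq → n (a ∷ d) e (cong (a ∷_) eq) ∘ subst X (List.++-assoc p _ d)) P

    false-stable : ∀ {b} → ¬ ¬ b ≡ false → b ≡ false
    false-stable {b} = decidable-stable (b Bool.≟ false)

    -- A closed walk that misses `X` crosses nothing; otherwise it is rotated to begin in `X`, which
    -- merely permutes the two summands of its parity.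
    par-closed : ∀ p c {b} → Closed c → Par p c b → b ≡ false
    par-closed p c {b} cl P = false-stable λ k → em λ
      { (no none) → k (par-outside p c (λ d e eq Xd → none (d , e , eq , Xd)) P)
      ; (yes (d , e , refl , Xd)) → visit d e cl P Xd k }
      where
      visit : ∀ d e {b} → Closed (d ++ e) → Par p (d ++ e) b → X (p ++ d) → ¬ ¬ b ≡ false
      visit d e {b} cl P Xd k = par-total (p ++ d) (e ++ d) λ (b′ , P′) →
        let (c₁ , c₂ , P₁ , P₂ , eq) = par-++ d e P
            (c₃ , c₄ , P₃ , P₄ , eq′) = par-++ e d P′
            back : ((p ++ d) ++ e) ≋ p
            back = ret (~-trans (~-≡ (List.++-assoc p d e)) (~-trans (~-++ˡ p (closed-~ (d ++ e) (proj₁ cl) (proj₂ cl))) (~-≡ (List.++-identityʳ p))))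
            cl′ = rotate d e cl
            home : ((p ++ d) ++ (e ++ d)) ≋ (p ++ d)
            home = ret (~-trans (~-++ˡ (p ++ d) (closed-~ (e ++ d) (proj₁ cl′) (proj₂ cl′))) (~-≡ (List.++-identityʳ (p ++ d))))
        in k (trans eq (trans (cong₂ _xor_ (sym (par-fun back P₄ P₁)) (par-fun W.refl P₂ P₃)) (trans (xor-comm c₄ c₃) (trans (sym eq′)
             (par-X (p ++ d) (e ++ d) [] Xd (subst Closed (sym (List.++-identityʳ (e ++ d))) cl′) (pair-resp (W.sym home) Xd) P′)))))

    par-~ : ∀ {u w b c} → u ~ w → Par [] u b → Par [] w c → b ≡ c
    par-~ e P Q = decidable-stable (_ Bool.≟ _) (go e P Q)
      where
      one : ∀ {u w b c} → Delete u w → Par [] u b → Par [] w c → b ≡ c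
      one (delete u d t le eq) P Q =
        let (b₁ , b₂ , P₁ , P₂ , e₁) = par-++ u (d ++ t) P
            (b₃ , b₄ , P₃ , P₄ , e₂) = par-++ d t P₂
            (c₁ , c₂ , Q₁ , Q₂ , e₃) = par-++ u t Q
            back : (u ++ d) ≋ u
            back = ret (~-trans (~-++ˡ u (closed-~ d le eq)) (~-≡ (List.++-identityʳ u)))
        in trans e₁ (trans (cong₂ _xor_ (par-fun W.refl P₁ Q₁)
             (trans e₂ (cong₂ _xor_ (par-closed u d (le , eq) P₃) (par-fun back P₄ Q₂)))) (sym e₃))
      go : ∀ {u w b c} → u ~ w → Par [] u b → Par [] w c → ¬ ¬ b ≡ c
      go Star.ε P Q k = k (par-fun W.refl P Q)
      go (_◅_ {j = z} (fwd s) ss) P Q k = par-total [] z λ (d , R) → go ss R Q λ eq → k (trans (one s P R) eq)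
      go (_◅_ {j = z} (bwd s) ss) P Q k = par-total [] z λ (d , R) → go ss R Q λ eq → k (trans (sym (one s R P)) eq)

    path-par : ∀ {p q} → ¬ X p → Path X p q → ¬ ¬ Σ Word λ w → (p ++ w) ≋ q × Par p w false
    path-par {p} n (hereₚ e) k = k ([] , W.trans (ret (~-≡ (List.++-identityʳ p))) e , nil)
    path-par {p} n (stepₚ a p′ e n′ P) k = path-par n′ P λ (w , e′ , Q) → par-resp e Q λ Q′ →
      k (a ∷ w , W.trans (W.trans (ret (~-≡ (sym (List.++-assoc p (a ∷ []) w)))) (W.∙-congʳ {w} {p ++ a ∷ []} {p′} (W.sym e))) e′ ,
         cons (no n) (no (n′ ∘ pair-resp (W.sym e))) Q′)

    -- The closed walk through a red and a non-red neighbour of X would cross an odd number of red edges.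
    separates : ∀ x y a b → x ≡ [] ⊎ x ≡ V → y ≡ [] ⊎ y ≡ V → ¬ Xᴳ (π (x ++ a ∷ [])) → ¬ Xᴳ (π (y ++ b ∷ [])) →
      red (π (x ++ a ∷ [])) ≡ true → red (π (y ++ b ∷ [])) ≡ false → ¬ Path X (x ++ a ∷ []) (y ++ b ∷ [])
    separates x y a b x≡ y≡ na nb ra rb P =
      path-par (na ∘ X⇒Xᴳ) P λ (w , e , Pw) →
      let n = barˡ b
          p₁ = x ++ a ∷ []
          back : ((p₁ ++ w) ++ n ∷ []) ≋ y
          back = W.trans (W.∙-congʳ {n ∷ []} {p₁ ++ w} {y ++ b ∷ []} e)
            (W.trans (W.assoc y (b ∷ []) (n ∷ [])) (W.trans (W.∙-congˡ {y} {(b ∷ []) ++ n ∷ []} {[]} (W.inverseʳ (b ∷ []))) (W.identityʳ y)))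
          z = ((p₁ ++ w) ++ n ∷ []) ++ inv y
          z≋ : z ≋ []
          z≋ = W.trans (W.∙-congʳ {inv y} {(p₁ ++ w) ++ n ∷ []} {y} back) (W.inverseʳ y)
      in z≋ λ z~ → par-total [] z λ (t , Pz) →
      let (c₁ , c₂ , P₁ , P₂ , e₁) = par-++ ((p₁ ++ w) ++ n ∷ []) (inv y) Pz
          (c₃ , c₄ , P₃ , P₄ , e₂) = par-++ (p₁ ++ w) (n ∷ []) P₁
          (c₅ , c₆ , P₅ , P₆ , e₃) = par-++ p₁ w P₃
          (c₇ , c₈ , P₇ , P₈ , e₄) = par-++ x (a ∷ []) P₅
          c₇≡ : c₇ ≡ false
          c₇≡ = par-X [] x (inv x) (inj₁ W.refl) (cycle x≡) (X≡ x≡) P₇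
          c₈≡ : c₈ ≡ true
          c₈≡ = let (i , j , eq) = par-single P₈ in trans eq (trans (cross-out i j (X≡ x≡) (na ∘ X⇒Xᴳ)) ra)
          c₆≡ : c₆ ≡ false
          c₆≡ = par-fun W.refl P₆ Pw
          c₄≡ : c₄ ≡ false
          c₄≡ = let (i , j , eq) = par-single P₄ in trans eq (trans (cross-in i j
                  (λ Xw → nb (X⇒Xᴳ (pair-resp e Xw))) (pair-resp (W.sym back) (X≡ y≡))) (trans (cong red (π-resp e)) rb))
      in par-total y (inv y) λ (c₉ , P₉) →
      let c₂≡ : c₂ ≡ false
          c₂≡ = trans (par-fun back P₂ P₉) (par-X y (inv y) y (X≡ y≡) (rotate y (inv y) (cycle y≡)) (inj₁ (W.inverseʳ y)) P₉)
          odd : t ≡ true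
          odd = trans e₁ (cong₂ _xor_ (trans e₂ (cong₂ _xor_ (trans e₃ (cong₂ _xor_ (trans e₄ (cong₂ _xor_ c₇≡ c₈≡)) c₆≡)) c₄≡)) c₂≡)
      in case trans (sym odd) (par-~ z~ Pz nil) of λ ()
      where
      X≡ : ∀ {x} → x ≡ [] ⊎ x ≡ V → X x
      X≡ (inj₁ refl) = inj₁ W.refl
      X≡ (inj₂ refl) = inj₂ W.refl
      cycle : ∀ {x} → x ≡ [] ⊎ x ≡ V → Closed (x ++ inv x)
      cycle (inj₁ refl) = z≤n , refl
      cycle (inj₂ refl) = subst (_≤ r) (sym (trans (List.length-++ V) (cong (length V +_) (length-inv V)))) 2V≤r ,
        trans (ev-++ V (inv V)) (trans (cong (ev V ∙_) (ev-inv V)) (inverseʳ _))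
      cross-out : ∀ {P Q : Set} (i : Dec P) (j : Dec Q) {p q} → P → ¬ Q → cross (does i) (does j) p q ≡ q
      cross-out i j {p} {q} yP nQ = cong₂ (λ x y → cross x y p q) (does-true i yP) (does-false j nQ)
      cross-in : ∀ {P Q : Set} (i : Dec P) (j : Dec Q) {p q} → ¬ P → Q → cross (does i) (does j) p q ≡ p
      cross-in i j {p} {q} nP yQ = cong₂ (λ x y → cross x y p q) (does-false i nP) (does-true j yQ)

module FromLocal (C : CayleyGraph) where
  open CayleyGraph C
  open GroupOf Γ
  open WalkWords C
  open Walks (CayAdj Γ S)
  open LocalSep (CayAdj Γ S) r
  open Paths letterGroup using (Pair; Path)

  separation : ∀ V p q → ¬ Pair [] V p → ¬ Pair [] V q → ¬ Path (Pair [] V) p q → Separation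
  separation V p q p∉ q∉ n = record
    { V = V ; p = p ; q = q
    ; p∉ = subst (λ V → ¬ Pair [] V p) (sym (spell-word V)) p∉
    ; q∉ = subst (λ V → ¬ Pair [] V q) (sym (spell-word V)) q∉
    ; separated = subst (λ V → ¬ Path (Pair [] V) p q) (sym (spell-word V)) n }

  avoid-mono : ∀ {F F′ : Fin N → Set} → (∀ {y} → F′ y → F y) → ∀ {y} l → Avoid F y l → Avoid F′ y l
  avoid-mono f [] n = n ∘ f
  avoid-mono f (_ ∷ l) (n , av) = n ∘ f , avoid-mono f l av

  letter-moves : ∀ x (a : Letter) → x ∙ proj₁ a ≢ x
  letter-moves x (s , s∈) eq = proj₁ gen (subst (_∈ S) (∙-cancelˡ x s ε (trans eq (sym (identityʳ x)))) s∈)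

  walk-short : ∀ {x} (C : Walk x x) → len C ≤ r → Short x (toWord C)
  walk-short {x} C le = subst (_≤ r) (sym (length-toWord C)) le , ▹-injective x {toWord C} {[]} (▹-toWord C)

  Exit : Fin N → Fin N → Set
  Exit x y = Σ Letter λ a → Star (BallStep x (x ∷ [])) (x ∙ proj₁ a) y

  -- Follow the closed walk to y and start afresh at every return to x: the letter made after the
  -- last return leads to a neighbour of x connected to y in the punctured ball.
  exit : ∀ {x y} → InBall x y → y ≢ x → Exit x y
  exit {x} {y} (C , le , y∈) y≢x with vert-toWord C y∈
  ... | c , c′ , eq , refl = go [] c c′ (subst (Short x) eq (walk-short C le)) (λ n → ⊥-elim (n refl)) y≢x
    where
    go : ∀ d l e → Short x (d ++ l ++ e) → (x ▹ d ≢ x → Exit x (x ▹ d)) → x ▹ d ▹ l ≢ x → Exit x (x ▹ d ▹ l)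
    go d [] e sh st n = st n
    go d (a ∷ l) e sh st n = subst (λ z → Exit x (z ▹ l)) (▹-++ x d _)
      (go (d ++ a ∷ []) l e (subst (Short x) (sym (List.++-assoc d _ _)) sh)
        (subst (λ z → z ≢ x → Exit x z) (sym (▹-++ x d _)) next)
        (n ∘ subst (λ z → z ▹ l ≡ x) (▹-++ x d _)))
      where
      next : x ▹ d ∙ proj₁ a ≢ x → Exit x (x ▹ d ∙ proj₁ a)
      next n′ with x ▹ d Fin.≟ x
      ... | yes e′ = a , subst (λ z → Star (BallStep x (x ∷ [])) (x ∙ proj₁ a) (z ∙ proj₁ a)) (sym e′) Star.ε
      ... | no n″ = let (b , σ) = st n″ in
        b , σ ◅◅ ((ball-edge x d a (l ++ e) sh , (λ { (here h) → n″ h }) , λ { (here h) → n′ h }) ◅ Star.ε)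

  -- Red is the component of `a` in the punctured ball. An excursion of a short closed walk at x
  -- stays in that ball, so it keeps its colour.
  cutvertex : ∀ x → LocalCutvertex x → ¬ ¬ Separation
  cutvertex x (a , b , Ba , Bb , a≢x , b≢x , apart) k = finite-em (Star (BallStep x (x ∷ [])) a) λ red? →
    let (s , σ) = exit Ba a≢x
        (t , τ) = exit Bb b≢x
        open Parity C x [] z≤n (does ∘ red?)
        locally : Locally
        locally = λ x′ c l u m Xx cl av _ → let x≡ = X⇒x Xx in
          subst (λ x′ → does (red? (x′ ∙ proj₁ c)) ≡ does (red? (x′ ∙ proj₁ c ▹ l))) (sym x≡)
          (let P = ball-path x (x ∷ []) (c ∷ []) l (u ∷ m) cl (avoid-mono (λ { (here h) → inj₁ h }) l (subst (λ x′ → Avoid Xᴳ (x′ ∙ proj₁ c) l) x≡ av)) in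
          does-⇔ (red? _) (red? _) (_◅◅ P) (_◅◅ ball-rev x P))
        nX : ∀ c → ¬ Xᴳ (x ∙ proj₁ c)
        nX = λ { c (inj₁ h) → letter-moves x c h ; c (inj₂ h) → letter-moves x c h }
    in k (separation [] (s ∷ []) (t ∷ []) (nX s ∘ X⇒Xᴳ) (nX t ∘ X⇒Xᴳ)
         (separates locally [] [] s t (inj₁ refl) (inj₁ refl) (nX s) (nX t)
           (does-true (red? _) (ball-rev x σ)) (does-false (red? _) λ ρ → apart (ρ ◅◅ τ))))
    where
    X⇒x : ∀ {y z : Fin N} → y ≡ z ⊎ y ≡ z → y ≡ z
    X⇒x (inj₁ h) = h
    X⇒x (inj₂ h) = h

  -- Red is the component of `a` in the connectivity graph, and `V` spells the given walk between
  -- the two vertices, whose length is at most r/2.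
  two-separator : ∀ v₀ v₁ → Local2Separator v₀ v₁ → ¬ ¬ Separation
  two-separator v₀ v₁ (v₀≢v₁ , (a , b , Na , Nb , apart) , W , 2W≤r) k = finite-em (Star (ConnAdj v₀ v₁) a) λ red? →
    let open Parity C v₀ V 2V≤r (does ∘ red?)
        locally : Locally
        locally = λ x c l t m Xx cl av Xt → let σ = connect x c l t m Xx cl av Xt in
          does-⇔ (red? _) (red? _) (λ ρ → ρ ◅◅ (σ ◅ Star.ε)) (λ ρ → ρ ◅◅ (conn-sym σ ◅ Star.ε))
        (x , x≡ , s , xs≡) = neighbour Na
        (y , y≡ , t , yt≡) = neighbour Nb
        na = outside Na ∘ subst F xs≡
        nb = outside Nb ∘ subst F yt≡
    in k (separation V (x ++ s ∷ []) (y ++ t ∷ []) (na ∘ X⇒Xᴳ) (nb ∘ X⇒Xᴳ)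
         (separates locally x y s t x≡ y≡ na nb
           (trans (cong (does ∘ red?) xs≡) (does-true (red? a) Star.ε))
           (trans (cong (does ∘ red?) yt≡) (does-false (red? b) apart))))
    where
    V : Word
    V = toWord W
    V≡ : v₀ ▹ V ≡ v₁
    V≡ = ▹-toWord W
    2V≤r : length V + length V ≤ r
    2V≤r = subst (λ k → k + k ≤ r) (sym (length-toWord W)) (subst (_≤ r) (cong (len W +_) (ℕ.+-identityʳ _)) 2W≤r)
    F : Fin N → Set
    F y = y ≡ v₀ ⊎ y ≡ v₀ ▹ V
    outside : ∀ {n} → InNbhd v₀ v₁ n → ¬ F n
    outside (n₀ , n₁ , _) (inj₁ h) = n₀ h
    outside (n₀ , n₁ , _) (inj₂ h) = n₁ (trans h V≡)
    neighbour : ∀ {n} → InNbhd v₀ v₁ n → Σ Word λ x → (x ≡ [] ⊎ x ≡ V) × Σ Letter λ s → v₀ ▹ (x ++ s ∷ []) ≡ n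
    neighbour (_ , _ , inj₁ (s , s∈ , eq)) = [] , inj₁ refl , (s , s∈) , sym eq
    neighbour (_ , _ , inj₂ (s , s∈ , eq)) = V , inj₂ refl , (s , s∈) , trans (▹-++ v₀ V _) (trans (cong (_∙ s) V≡) (sym eq))
    D : List (Fin N)
    D = v₀ ∷ v₁ ∷ []
    D⊆F : ∀ {y} → y LM.∈ D → F y
    D⊆F (here h) = inj₁ h
    D⊆F (there (here h)) = inj₂ (trans h (sym V≡))
    conn-sym : ∀ {y z} → ConnAdj v₀ v₁ y z → ConnAdj v₀ v₁ z y
    conn-sym (Ny , Nz , inj₁ (By , Bz , ny , nz , σ)) = Nz , Ny , inj₁ (Bz , By , nz , ny , ball-rev v₀ σ)
    conn-sym (Ny , Nz , inj₂ (By , Bz , ny , nz , σ)) = Nz , Ny , inj₂ (Bz , By , nz , ny , ball-rev v₁ σ)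
    nbhd : ∀ {x n} → F x → ¬ F n → (c : Letter) → n ≡ x ∙ proj₁ c → InNbhd v₀ v₁ n
    nbhd Fx nF (c , c∈) eq = nF ∘ inj₁ , (λ h → nF (inj₂ (trans h (sym V≡)))) , adj Fx
      where
      adj : F _ → CayAdj Γ S v₀ _ ⊎ CayAdj Γ S v₁ _
      adj (inj₁ h) = inj₁ (c , c∈ , trans eq (cong (_∙ c) h))
      adj (inj₂ h) = inj₂ (c , c∈ , trans eq (cong (_∙ c) (trans h V≡)))
    -- The excursion lies on a short closed walk at x, hence in the ball around whichever of the two
    -- vertices x is. Its first and last vertices are therefore adjacent in the connectivity graph.
    connect : ∀ x c l t m → F x → length ((c ∷ l) ++ t ∷ m) ≤ r × ev ((c ∷ l) ++ t ∷ m) ≡ ε → Avoid F (x ∙ proj₁ c) l →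
      F (x ∙ proj₁ c ▹ l ∙ proj₁ t) → ConnAdj v₀ v₁ (x ∙ proj₁ c) (x ∙ proj₁ c ▹ l)
    connect x c l t m Fx cl av Ft =
      nbhd Fx (avoid-head l av) c refl ,
      nbhd Ft (avoid-last l av) (barˡ t) (sym (trans (assoc _ _ _) (trans (cong (x ∙ proj₁ c ▹ l ∙_) (inverseʳ (proj₁ t))) (identityʳ _)))) ,
      at Fx
      where
      same : SameComp x D (x ∙ proj₁ c) (x ∙ proj₁ c ▹ l)
      same = in-ball x (c ∷ []) (l ++ t ∷ m) cl , in-ball x (c ∷ l) (t ∷ m) cl ,
        avoid-head l av ∘ D⊆F , avoid-last l av ∘ D⊆F ,
        ball-path x D (c ∷ []) l (t ∷ m) cl (avoid-mono D⊆F l av)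
      at : F x → SameComp v₀ D (x ∙ proj₁ c) (x ∙ proj₁ c ▹ l) ⊎ SameComp v₁ D (x ∙ proj₁ c) (x ∙ proj₁ c ▹ l)
      at (inj₁ h) = inj₁ (subst (λ z → SameComp z D (x ∙ proj₁ c) (x ∙ proj₁ c ▹ l)) h same)
      at (inj₂ h) = inj₂ (subst (λ z → SameComp z D (x ∙ proj₁ c) (x ∙ proj₁ c ▹ l)) (trans h V≡) same)

  local-separation : HasLocalSeparator≤2 → ¬ ¬ Separation
  local-separation (inj₁ (x , c)) = cutvertex x c
  local-separation (inj₂ (v₀ , v₁ , s)) = two-separator v₀ v₁ s

-- Walks and words

module Cover (C : CayleyGraph) where
  open CayleyGraph C
  open GroupOf Γ
  open WalkWords C
  open Walks (CayAdj Γ S)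
  open LocalCover (CayAdj Γ S) ε r
  open Ends _≈ᶜ_ CAdj
  open Paths letterGroup renaming (here to hereₚ; step to stepₚ)
  private module W = Group wordGroup

  wd : CV → Word
  wd (_ , W) = toWord W

  from : ∀ x → Word → Σ (Fin N) (Walk x)
  from x w = x ▹ w , walkTo x w refl

  cv : Word → CV
  cv = from ε

  from-toWord : ∀ {x y} (W : Walk x y) → from x (toWord W) ≡ (y , W)
  from-toWord [] = refl
  from-toWord (e@(s , s∈ , refl) ∷ W) = cong (λ (y , W) → y , e ∷ W) (from-toWord W)

  cv-wd : ∀ c → cv (wd c) ≡ c
  cv-wd (_ , W) = from-toWord W

  wd-cv : ∀ w → wd (cv w) ≡ w
  wd-cv = go ε
    where
    go : ∀ x w → toWord (walkTo x w refl) ≡ w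
    go x [] = refl
    go x (a ∷ w) = cong (a ∷_) (go (x ∙ proj₁ a) w)

  from-++ : ∀ x u {a} (p : x ▹ u ≡ a) t → from x (u ++ t) ≡ (a ▹ t , walkTo x u p ++ʷ walkTo a t refl)
  from-++ x [] refl t = refl
  from-++ x (a ∷ u) p t = cong (λ (y , W) → y , _ ∷ W) (from-++ (x ∙ proj₁ a) u p t)

  toWord-++ : ∀ {x y z} (W : Walk x y) (W′ : Walk y z) → toWord (W ++ʷ W′) ≡ toWord W ++ toWord W′
  toWord-++ [] W′ = refl
  toWord-++ (e ∷ W) W′ = cong (_ ∷_) (toWord-++ W W′)

  move⇒~ : ∀ {c c′} → Move c c′ → wd c ~ wd c′
  move⇒~ (cycle {a} W₁ C W₂ le) = ~-trans
    (~-≡ (trans (toWord-++ W₁ (C ++ʷ W₂)) (cong (toWord W₁ ++_) (toWord-++ C W₂))))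
    (~-trans (del (toWord W₁) (toWord C) (toWord W₂) (subst (_≤ r) (sym (length-toWord C)) le)
        (▹-injective a {toWord C} {[]} (▹-toWord C)))
      (~-≡ (sym (toWord-++ W₁ W₂))))
  move⇒~ (backtrack {a} W₁ e e′ W₂) = ~-trans (~-≡ (toWord-++ W₁ (e ∷ (e′ ∷ W₂))))
    (~-trans (del (toWord W₁) (toWord B) (toWord W₂) 2≤r (▹-injective a {toWord B} {[]} (▹-toWord B)))
      (~-≡ (sym (toWord-++ W₁ W₂))))
    where
    B : Walk a a
    B = e ∷ (e′ ∷ [])

  ≈⇒~ : ∀ {c c′} → c ≈ᶜ c′ → wd c ~ wd c′
  ≈⇒~ = EqC.gfold (EqC.isEquivalence Delete) wd move⇒~

  ~⇒≈ : ∀ {u w} → u ~ w → cv u ≈ᶜ cv w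
  ~⇒≈ = EqC.gfold (EqC.isEquivalence Move) cv λ { (delete u c t le eq) → one u c t le eq }
    where
    one : ∀ u c t → length c ≤ r → ev c ≡ ε → cv (u ++ c ++ t) ≈ᶜ cv (u ++ t)
    one u c t le eq = ≡.subst₂ _≈ᶜ_ (sym long) (sym (from-++ ε u refl t)) (EqC.return
      (cycle (walkTo ε u refl) (walkTo a c cl) (walkTo a t refl) (subst (_≤ r) (sym (len-walkTo a c cl)) le)))
      where
      a : Fin N
      a = ε ▹ u
      cl : a ▹ c ≡ a
      cl = ▹-closed a {c} eq
      long : cv (u ++ c ++ t) ≡ (a ▹ t , walkTo ε u refl ++ʷ (walkTo a c cl ++ʷ walkTo a t refl))
      long = trans (from-++ ε u refl (c ++ t)) (cong (λ (y , W) → y , walkTo ε u refl ++ʷ W) (from-++ a c cl t))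

  wd-≈ : ∀ {c c′} → wd c ~ wd c′ → c ≈ᶜ c′
  wd-≈ {c} {c′} e = ≡.subst₂ _≈ᶜ_ (cv-wd c) (cv-wd c′) (~⇒≈ e)

  adj⇒~ : ∀ {c c′} → CAdj c c′ → Σ Letter λ a → wd c′ ~ (wd c ++ a ∷ [])
  adj⇒~ {a , W} {b , W′} (e@(s , s∈ , _) , eq) = (s , s∈) , ~-trans (≈⇒~ eq) (~-≡ (toWord-++ W (e ∷ [])))

  ~⇒adj : ∀ {c c′} a → wd c′ ~ (wd c ++ a ∷ []) → CAdj c c′
  ~⇒adj {x , W} {y , W′} a e = edge , wd-≈ (~-trans e (~-≡ (sym (toWord-++ W (edge ∷ [])))))
    where
    edge : CayAdj Γ S x y
    edge = proj₁ a , proj₂ a , trans (sym (▹-toWord W′)) (trans (▹-cong ε {toWord W′} {toWord W ++ a ∷ []} (ev-~ e))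
      (trans (▹-++ ε (toWord W) _) (cong (_∙ proj₁ a) (▹-toWord W))))

  -- If N ≤ r then a closed walk longer than r contains a proper closed subwalk of length ≤ N.
  contract : N ≤ r → ∀ c → ev c ≡ ε → c ~ []
  contract N≤r c = go c (<-wellFounded _)
    where
    take-+ : ∀ i k (c : Word) → take (i + k) c ≡ take i c ++ take k (drop i c)
    take-+ zero k c = refl
    take-+ (suc i) k [] = sym (List.take-[] k)
    take-+ (suc i) k (a ∷ c) = cong (a ∷_) (take-+ i k c)
    take-nonempty : ∀ k (c : Word) → 0 < k → 0 < length c → 0 < length (take k c)
    take-nonempty (suc k) (a ∷ c) _ _ = s≤s z≤n
    go : ∀ c → Acc _<_ (length c) → ev c ≡ ε → c ~ []
    go c (acc rec) eq with length c ℕ.≤? r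
    ... | yes le = closed-~ c le eq
    ... | no long with Fin.pigeonhole (ℕ.n<1+n N) (λ i → ε ▹ take (toℕ i) c)
    ... | i , j , i<j , same = ~-trans c~ (go (d ++ t) (rec shorter) (trans (sym (ev-~ c~)) eq))
      where
      k = toℕ j ∸ toℕ i
      c′ = drop (toℕ i) c
      d = take (toℕ i) c
      e = take k c′
      t = drop k c′
      j≤N : toℕ j ≤ N
      j≤N = ℕ.≤-pred (Fin.toℕ<n j)
      N<c : N < length c
      N<c = ℕ.≤-<-trans N≤r (ℕ.≰⇒> long)
      split : c ≡ d ++ e ++ t
      split = trans (sym (List.take++drop≡id (toℕ i) c)) (cong (d ++_) (sym (List.take++drop≡id k c′)))
      e≤r : length e ≤ r
      e≤r = ℕ.≤-trans (ℕ.≤-reflexive (List.length-take k c′))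
        (ℕ.≤-trans (ℕ.m⊓n≤m k _) (ℕ.≤-trans (ℕ.m∸n≤m (toℕ j) (toℕ i)) (ℕ.≤-trans j≤N N≤r)))
      e-closed : ev e ≡ ε
      e-closed = ▹-injective (ε ▹ d) {e} {[]} (sym (trans same (trans (cong (λ l → ε ▹ take l c) (sym (ℕ.m+[n∸m]≡n (ℕ.<⇒≤ i<j))))
        (trans (cong (ε ▹_) (take-+ (toℕ i) k c)) (▹-++ ε d e)))))
      c~ : c ~ (d ++ t)
      c~ = ~-trans (~-≡ split) (del d e t e≤r e-closed)
      0<e : 0 < length e
      0<e = take-nonempty k c′ (ℕ.m<n⇒0<n∸m i<j)
        (subst (0 <_) (sym (List.length-drop (toℕ i) c)) (ℕ.m<n⇒0<n∸m (ℕ.<-trans (ℕ.<-≤-trans i<j j≤N) N<c)))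
      shorter : length (d ++ t) < length c
      shorter = ≡.subst₂ _<_ (sym (List.length-++ d))
        (sym (trans (cong length split) (trans (List.length-++ d) (cong (length d +_) (List.length-++ e)))))
        (ℕ.+-monoʳ-< (length d) (ℕ.m<n+m (length t) 0<e))

  -- For N ≤ r every closed walk is trivial in the cover, which then has only N vertices; by the
  -- pigeonhole principle a ray would repeat one.
  ray⇒r<N : ∀ {f} → IsRay f → r < N
  ray⇒r<N {f} (_ , injective) = ℕ.≰⇒> λ N≤r → case Fin.pigeonhole (ℕ.n<1+n N) (λ i → proj₁ (f (toℕ i))) of λ
    { (i , j , i<j , same) → ℕ.<⇒≢ i<j (injective _ _ (wd-≈ (join N≤r (wd (f (toℕ i))) (wd (f (toℕ j)))
        (▹-injective ε {wd (f (toℕ i))} {wd (f (toℕ j))}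
          (trans (▹-toWord (proj₂ (f (toℕ i)))) (trans same (sym (▹-toWord (proj₂ (f (toℕ j)))))))))))  }
    where
    join : N ≤ r → ∀ u w → ev u ≡ ev w → u ~ w
    join N≤r u w eq = ~-trans (~-trans (~-≡ (sym (List.++-identityʳ u))) (~-++ˡ u (~-sym (inv-cancelˡ w))))
      (~-trans (~-≡ (sym (List.++-assoc u (inv w) w)))
        (~-++ʳ w (contract N≤r (u ++ inv w) (trans (ev-++ u (inv w)) (trans (cong₂ _∙_ eq (ev-inv w)) (inverseʳ _))))))

  module _ {X : List CV} {x y : Word} (avoids : ∀ {p} → ¬ Pair x y p → Avoids X (cv p)) where
    path⇒star : ∀ {p w} → ¬ Pair x y p → Path (Pair x y) p w → ¬ ¬ Star (StepAvoiding X) (cv p) (cv w)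
    path⇒star {p} {w} n (hereₚ e) k = e λ e′ → k ((avoids n , avoids (path-end pair-resp n (hereₚ e)) , inj₂ (~⇒≈ e′)) ◅ Star.ε)
    path⇒star {p} {w} n (stepₚ a p′ e n′ P) k = e λ e → path⇒star n′ P λ σ →
      k ((avoids n , avoids n′ , inj₁ (~⇒adj {cv p} {cv p′} a
        (~-trans (~-≡ (wd-cv p′)) (~-trans e (~-≡ (cong (_++ a ∷ []) (sym (wd-cv p)))))))) ◅ σ)

    unreachable : ∀ {c c′} → ¬ Pair x y (wd c) → ¬ Star (StepAvoiding X) c c′ → ¬ Path (Pair x y) (wd c) (wd c′)
    unreachable {c} {c′} nF n P = path⇒star nF P (n ∘ ≡.subst₂ (Star (StepAvoiding X)) (cv-wd c) (cv-wd c′))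

  translate : ∀ x y p q → ¬ Pair x y p → ¬ Pair x y q → ¬ Path (Pair x y) p q → Separation
  translate x y p q p∉ q∉ n = FromLocal.separation C (inv x ++ y) (inv x ++ p) (inv x ++ q) (p∉ ∘ up) (q∉ ∘ up)
    λ P → n (path-resp {p = x ++ (inv x ++ p)} (back p) (path-mono down (pair-translate x P) ⊕ hereₚ (back q)))
    where
    back : ∀ p → (x ++ (inv x ++ p)) ≋ p
    back p = ret (~-trans (~-≡ (sym (List.++-assoc x (inv x) p))) (~-++ʳ p (inv-cancelʳ x)))
    lift : ∀ {p} w → (inv x ++ p) ≋ w → p ≋ (x ++ w)
    lift {p} w e = W.trans (W.sym (back p)) (W.∙-congˡ {x} {inv x ++ p} {w} e)
    up : ∀ {p} → Pair [] (inv x ++ y) (inv x ++ p) → Pair x y p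
    up {p} (inj₁ e) = inj₁ (W.trans (lift {p} [] e) (W.identityʳ x))
    up {p} (inj₂ e) = inj₂ (W.trans (lift {p} (inv x ++ y) e) (back y))
    down : ∀ {t} → Pair x y t → Pair (x ++ []) (x ++ (inv x ++ y)) t
    down (inj₁ e) = inj₁ (W.trans e (W.sym (W.identityʳ x)))
    down (inj₂ e) = inj₂ (W.trans e (W.sym (back y)))

  -- One vertex far out on each ray suffices. A single separating vertex becomes a pair with equal
  -- points, and the empty set cannot separate because the cover is connected.
  ends-separation : TwoEndsSeparatedBy≤2 → Separation
  ends-separation (f , g , _ , _ , X , X≤2 , n , sep) = by X X≤2 (sep n n ℕ.≤-refl ℕ.≤-refl)
    where
    p q : CV
    p = f n
    q = g n
    apart : ∀ x y → ¬ p ≈ᶜ x → ¬ p ≈ᶜ y → ¬ q ≈ᶜ x → ¬ q ≈ᶜ y →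
      ∀ {X} → (∀ {c} → ¬ c ≈ᶜ x → ¬ c ≈ᶜ y → Avoids X c) → ¬ Star (StepAvoiding X) p q → Separation
    apart x y px py qx qy av σ = translate (wd x) (wd y) (wd p) (wd q) (off px py) (off qx qy)
      (unreachable (λ n → av (n ∘ inj₁ ∘ to {x}) (n ∘ inj₂ ∘ to {y})) (off px py) σ)
      where
      off : ∀ {c} → ¬ c ≈ᶜ x → ¬ c ≈ᶜ y → ¬ Pair (wd x) (wd y) (wd c)
      off nx ny (inj₁ e) = e (nx ∘ wd-≈)
      off nx ny (inj₂ e) = e (ny ∘ wd-≈)
      to : ∀ {z w} → cv w ≈ᶜ z → w ≋ wd z
      to {w = w} e = ret (~-trans (~-≡ (sym (wd-cv w))) (≈⇒~ e))
    by : ∀ X → length X ≤ 2 → Avoids X p × Avoids X q × ¬ Star (StepAvoiding X) p q → Separation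
    by [] _ (_ , _ , σ) = ⊥-elim (σ (≡.subst₂ (Star (StepAvoiding [])) (cv-wd p) (cv-wd q)
        (walk (wd p) (inv (wd p) ++ wd q) ◅◅ (([] , [] , inj₂ (~⇒≈ cancel)) ◅ Star.ε))))
      where
      walk : ∀ u w → Star (StepAvoiding []) (cv u) (cv (u ++ w))
      walk u [] = ([] , [] , inj₂ (~⇒≈ (~-≡ (sym (List.++-identityʳ u))))) ◅ Star.ε
      walk u (a ∷ w) = ([] , [] , inj₁ (~⇒adj {cv u} {cv (u ++ a ∷ [])} a
          (~-trans (~-≡ (wd-cv (u ++ a ∷ []))) (~-≡ (cong (_++ a ∷ []) (sym (wd-cv u))))))) ◅
        subst (λ t → Star (StepAvoiding []) (cv (u ++ a ∷ [])) (cv t)) (List.++-assoc u (a ∷ []) w) (walk (u ++ a ∷ []) w)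
      cancel : (wd p ++ inv (wd p) ++ wd q) ~ wd q
      cancel = ~-trans (~-≡ (sym (List.++-assoc (wd p) (inv (wd p)) (wd q)))) (~-++ʳ (wd q) (inv-cancelʳ (wd p)))
    by (x ∷ []) _ ((px ∷ []) , (qx ∷ []) , σ) = apart x x px px qx qx (λ n _ → n ∷ []) σ
    by (x ∷ y ∷ []) _ ((px ∷ py ∷ []) , (qx ∷ qy ∷ []) , σ) = apart x y px py qx qy (λ n n′ → n ∷ n′ ∷ []) σ
    by (_ ∷ _ ∷ _ ∷ _) (s≤s (s≤s ())) _

-- The standard generators of C_i × C_j

module StandardGenerators (Γ : FinGroup) where
  open GroupOf Γ
  open Generated (finGroup Γ)

  -- `far` also keeps the powers of `s` away from `t`, so that they are distinct modulo t up to
  -- exponent r. For j = 1 the element `t` is trivial.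
  record Standard (r : ℕ) : Set where
    field
      s t     : Fin N
      commute : s ∙ t ≡ t ∙ s
      t²      : t ∙ t ≡ ε
      far     : ∀ k → k < r → power s (suc k) ≢ ε × power s (suc k) ≢ t
      reps    : ∀ g → Σ ℕ λ k → g ≡ power s k ⊎ g ≡ power s k ∙ t

  module Coordinates (i j : ℕ) (φ : Fin N → Fin (suc i) × Fin (suc j))
    (φ-inj : ∀ {x y} → φ x ≡ φ y → x ≡ y) (φ-surj : ∀ y → Σ (Fin N) λ x → φ x ≡ y)
    (φ-hom : ∀ x y → φ (x ∙ y) ≡ (addMod (proj₁ (φ x)) (proj₁ (φ y)) , addMod (proj₂ (φ x)) (proj₂ (φ y)))) where

    α β : Fin N → ℕ
    α x = toℕ (proj₁ (φ x))
    β x = toℕ (proj₂ (φ x))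

    toℕ-addMod : ∀ {m} (a b : Fin (suc m)) → toℕ (addMod a b) ≡ (toℕ a + toℕ b) % suc m
    toℕ-addMod {m} a b = Fin.toℕ-fromℕ< (m%n<n (toℕ a + toℕ b) (suc m))

    α-∙ : ∀ x y → α (x ∙ y) ≡ (α x + α y) % suc i
    α-∙ x y = trans (cong (toℕ ∘ proj₁) (φ-hom x y)) (toℕ-addMod (proj₁ (φ x)) _)

    β-∙ : ∀ x y → β (x ∙ y) ≡ (β x + β y) % suc j
    β-∙ x y = trans (cong (toℕ ∘ proj₂) (φ-hom x y)) (toℕ-addMod (proj₂ (φ x)) _)

    ext : ∀ {x y} → α x ≡ α y → β x ≡ β y → x ≡ y
    ext e e′ = φ-inj (cong₂ _,_ (Fin.toℕ-injective e) (Fin.toℕ-injective e′))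

    element : ∀ a b → a < suc i → b < suc j → Σ (Fin N) λ x → α x ≡ a × β x ≡ b
    element a b a< b< = let (x , e) = φ-surj (fromℕ< a< , fromℕ< b<) in
      x , trans (cong (toℕ ∘ proj₁) e) (Fin.toℕ-fromℕ< a<) , trans (cong (toℕ ∘ proj₂) e) (Fin.toℕ-fromℕ< b<)

    ε-coordinates : α ε ≡ 0 × β ε ≡ 0
    ε-coordinates = let (e , αe , βe) = element 0 0 (s≤s z≤n) (s≤s z≤n)
                        e≡ε : e ≡ ε
                        -- The preimage of (0 , 0) is idempotent, hence neutral.
                        e≡ε = identityʳ-unique e e (ext (trans (α-∙ e e) (trans (cong₂ (λ a b → (a + b) % suc i) αe αe) (sym αe)))
                                                        (trans (β-∙ e e) (trans (cong₂ (λ a b → (a + b) % suc j) βe βe) (sym βe))))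
                    in trans (cong α (sym e≡ε)) αe , trans (cong β (sym e≡ε)) βe

    module _ (1≤i : 1 ≤ i) where
      s : Fin N
      s = proj₁ (element 1 0 (s≤s 1≤i) (s≤s z≤n))
      αs : α s ≡ 1
      αs = proj₁ (proj₂ (element 1 0 (s≤s 1≤i) (s≤s z≤n)))
      βs : β s ≡ 0
      βs = proj₂ (proj₂ (element 1 0 (s≤s 1≤i) (s≤s z≤n)))

      α-power : ∀ k → α (power s k) ≡ k % suc i
      α-power zero = proj₁ ε-coordinates
      α-power (suc k) = trans (α-∙ s (power s k)) (trans (cong (_% suc i) (cong₂ _+_ (trans αs (sym (m<n⇒m%n≡m (s≤s 1≤i)))) (α-power k)))
        (sym (%-distribˡ-+ 1 k (suc i))))

      β-power : ∀ k → β (power s k) ≡ 0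
      β-power zero = proj₂ ε-coordinates
      β-power (suc k) = trans (β-∙ s (power s k)) (cong (_% suc j) (cong₂ _+_ βs (β-power k)))

      standard : ∀ {r} → r ≤ i → ∀ t → α t ≡ 0 → t ∙ t ≡ ε → (∀ g → β g ≡ 0 ⊎ β g ≡ β t) → Standard r
      standard {r} r≤i t αt t² βs? = record
        { s = s ; t = t ; t² = t²
        ; commute = ext (trans (α-∙ s t) (trans (cong (_% suc i) (ℕ.+-comm (α s) (α t))) (sym (α-∙ t s))))
                        (trans (β-∙ s t) (trans (cong (_% suc j) (ℕ.+-comm (β s) (β t))) (sym (β-∙ t s))))
        ; far = λ k k<r → nonzero k k<r (proj₁ ε-coordinates) , nonzero k k<r αt
        ; reps = λ g → α g , represent g (βs? g) }
        where
        nonzero : ∀ k → k < r → ∀ {x} → α x ≡ 0 → power s (suc k) ≢ x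
        nonzero k k<r αx eq = case trans (sym (m<n⇒m%n≡m (s≤s (ℕ.≤-trans k<r r≤i)))) (trans (sym (α-power (suc k))) (trans (cong α eq) αx)) of λ ()
        αg : ∀ g → α (power s (α g)) ≡ α g
        αg g = trans (α-power (α g)) (m<n⇒m%n≡m (Fin.toℕ<n (proj₁ (φ g))))
        represent : ∀ g → β g ≡ 0 ⊎ β g ≡ β t → g ≡ power s (α g) ⊎ g ≡ power s (α g) ∙ t
        represent g (inj₁ e) = inj₁ (ext (sym (αg g)) (trans e (sym (β-power (α g)))))
        represent g (inj₂ e) = inj₂ (ext
          (sym (trans (α-∙ (power s (α g)) t) (trans (cong (_% suc i) (trans (cong₂ _+_ (αg g) αt) (ℕ.+-identityʳ _))) (m<n⇒m%n≡m (Fin.toℕ<n (proj₁ (φ g)))))))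
          (sym (trans (β-∙ (power s (α g)) t) (trans (cong (_% suc j) (cong (_+ β t) (β-power (α g))))
            (trans (m<n⇒m%n≡m (Fin.toℕ<n (proj₂ (φ t)))) (sym e))))))

  III⇒standard : ∀ {r} → 1 ≤ r → CondIII Γ r → Standard r
  III⇒standard 1≤r (suc i , 1 , r<i , _ , φ , (φ-inj , φ-surj) , φ-hom) =
    standard (ℕ.≤-trans 1≤r (ℕ.≤-pred r<i)) (ℕ.≤-pred r<i) ε (proj₁ ε-coordinates) (identityˡ ε)
      λ g → inj₁ (cong toℕ (only (proj₂ (φ g))))
    where
    open Coordinates i 0 φ φ-inj (λ y → proj₁ (φ-surj y) , proj₂ (φ-surj y) refl) φ-hom
    only : (x : Fin 1) → x ≡ fzero
    only fzero = refl
  III⇒standard {r} 1≤r (suc i , 2 , r<i , _ , φ , (φ-inj , φ-surj) , φ-hom) =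
    let (t , αt , βt) = element 0 1 (s≤s z≤n) (s≤s (s≤s z≤n)) in
    standard (ℕ.≤-trans 1≤r (ℕ.≤-pred r<i)) (ℕ.≤-pred r<i) t αt
      (ext (trans (α-∙ t t) (trans (cong₂ (λ a b → (a + b) % suc i) αt αt) (sym (proj₁ ε-coordinates))))
           (trans (β-∙ t t) (trans (cong₂ (λ a b → (a + b) % 2) βt βt) (sym (proj₂ ε-coordinates)))))
      λ g → two (proj₂ (φ g)) βt
    where
    open Coordinates i 1 φ φ-inj (λ y → proj₁ (φ-surj y) , proj₂ (φ-surj y) refl) φ-hom
    two : (x : Fin 2) → ∀ {b} → b ≡ 1 → toℕ x ≡ 0 ⊎ toℕ x ≡ b
    two fzero _ = inj₁ refl
    two (fsuc fzero) e = inj₂ (sym e)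
  III⇒standard 1≤r (zero , _ , () , _)
  III⇒standard 1≤r (suc i , 0 , _ , inj₁ () , _)
  III⇒standard 1≤r (suc i , 0 , _ , inj₂ () , _)
  III⇒standard 1≤r (suc i , suc (suc (suc _)) , _ , inj₁ () , _)
  III⇒standard 1≤r (suc i , suc (suc (suc _)) , _ , inj₂ () , _)

module StandardGraph (Γ : FinGroup) (r : ℕ) (4≤r : 4 ≤ r) (std : StandardGenerators.Standard Γ r) where
  open GroupOf Γ
  open Generated (finGroup Γ)
  open Finite Γ using (power-+; power-suc)
  open Product Γ using (power-commute)
  open StandardGenerators.Standard std

  2≤r : 2 ≤ r
  2≤r = ℕ.≤-trans (ℕ.m≤m+n 2 2) 4≤r
  0<r : 0 < r
  0<r = ℕ.≤-trans (s≤s z≤n) 2≤r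

  central : ∀ g → g ∙ t ≡ t ∙ g
  central g = case reps g of λ
    { (k , inj₁ e) → trans (cong (_∙ t) e) (trans (power-commute k commute) (cong (t ∙_) (sym e)))
    ; (k , inj₂ e) → trans (cong (_∙ t) e) (trans (cong (_∙ t) (power-commute k commute)) (trans (assoc _ _ _) (cong (t ∙_) (sym e)))) }

  s-central : ∀ g → g ∙ s ≡ s ∙ g
  s-central g = case reps g of λ
    { (k , inj₁ e) → trans (cong (_∙ s) e) (trans (power-commute k refl) (cong (s ∙_) (sym e)))
    ; (k , inj₂ e) → trans (cong (_∙ s) e) (trans (assoc _ _ _) (trans (cong (power s k ∙_) (sym commute))
        (trans (sym (assoc _ _ _)) (trans (cong (_∙ t) (power-commute k refl)) (trans (assoc _ _ _) (cong (s ∙_) (sym e))))))) }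

  t⁻¹ : t ⁻¹ ≡ t
  t⁻¹ = sym (inverseʳ-unique t t t²)

  infix 4 _≈_
  -- Equality modulo the subgroup generated by `t`: what the height of a vertex can determine.
  _≈_ : Fin N → Fin N → Set
  x ≈ y = x ≡ y ⊎ x ≡ y ∙ t

  ≈-sym : ∀ {x y} → x ≈ y → y ≈ x
  ≈-sym (inj₁ e) = inj₁ (sym e)
  ≈-sym {x} {y} (inj₂ e) = inj₂ (sym (trans (cong (_∙ t) e) (trans (assoc _ _ _) (trans (cong (y ∙_) t²) (identityʳ y)))))

  ≈-trans : ∀ {x y z} → x ≈ y → y ≈ z → x ≈ z
  ≈-trans (inj₁ refl) q = q
  ≈-trans (inj₂ e) (inj₁ refl) = inj₂ e
  ≈-trans {z = z} (inj₂ e) (inj₂ e′) = inj₁ (trans e (trans (cong (_∙ t) e′) (trans (assoc _ _ _) (trans (cong (z ∙_) t²) (identityʳ z)))))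

  ≈-∙ˡ : ∀ z {x y} → x ≈ y → z ∙ x ≈ z ∙ y
  ≈-∙ˡ z (inj₁ e) = inj₁ (cong (z ∙_) e)
  ≈-∙ˡ z (inj₂ e) = inj₂ (trans (cong (z ∙_) e) (sym (assoc _ _ _)))

  ≈-∙ʳ : ∀ z {x y} → x ≈ y → x ∙ z ≈ y ∙ z
  ≈-∙ʳ z (inj₁ e) = inj₁ (cong (_∙ z) e)
  ≈-∙ʳ z {x} {y} (inj₂ e) = inj₂ (trans (cong (_∙ z) e) (trans (assoc _ _ _) (trans (cong (y ∙_) (sym (central z))) (sym (assoc _ _ _)))))

  ≈-cancelˡ : ∀ z {x y} → z ∙ x ≈ z ∙ y → x ≈ y
  ≈-cancelˡ z {x} {y} p = ≡.subst₂ _≈_ (canc x) (canc y) (≈-∙ˡ (z ⁻¹) p)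
    where
    canc : ∀ x → z ⁻¹ ∙ (z ∙ x) ≡ x
    canc x = \\-leftDividesʳ z x

  ≈-cancelʳ : ∀ z {x y} → x ∙ z ≈ y ∙ z → x ≈ y
  ≈-cancelʳ z {x} {y} p = ≡.subst₂ _≈_ (canc x) (canc y) (≈-∙ʳ (z ⁻¹) p)
    where
    canc : ∀ x → x ∙ z ∙ z ⁻¹ ≡ x
    canc x = solve (z ∷ᵥ x ∷ᵥ []ᵥ) (x₁ ⊙ x₀ ⊙ x₀ ⁻) x₁ refl

  power≉ε : ∀ k → 0 < k → k ≤ r → ¬ power s k ≈ ε
  power≉ε (suc k) _ k<r (inj₁ e) = proj₁ (far k k<r) e
  power≉ε (suc k) _ k<r (inj₂ e) = proj₂ (far k k<r) (trans e (identityˡ t))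

  powers-distinct : ∀ a b → a ≤ r → b ≤ r → power s a ≈ power s b → a ≡ b
  powers-distinct a b a≤r b≤r p = ℕ.≤-antisym (ℕ.≮⇒≥ (less b a a≤r (≈-sym p))) (ℕ.≮⇒≥ (less a b b≤r p))
    where
    less : ∀ a b → b ≤ r → power s a ≈ power s b → ¬ a < b
    less a b b≤r p a<b = power≉ε (b ∸ a) (ℕ.m<n⇒0<n∸m a<b) (ℕ.≤-trans (ℕ.m∸n≤m b a) b≤r)
      (≈-sym (≈-cancelˡ (power s a) (≡.subst₂ _≈_ (sym (identityʳ _)) (trans (cong (power s) (sym (ℕ.m+[n∸m]≡n (ℕ.<⇒≤ a<b)))) (power-+ s a (b ∸ a))) p)))

  r<N : r < N
  r<N = Fin.injective⇒≤ {f = λ (i : Fin (suc r)) → power s (toℕ i)} λ {i} {j} eq →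
    Fin.toℕ-injective (powers-distinct (toℕ i) (toℕ j) (ℕ.≤-pred (Fin.toℕ<n i)) (ℕ.≤-pred (Fin.toℕ<n j)) (inj₁ eq))

  s≉ε : ¬ s ≈ ε
  s≉ε = power≉ε 1 (s≤s z≤n) 0<r ∘ ≈-trans (inj₁ (identityʳ s))

  s≉s⁻¹ : ¬ s ≈ s ⁻¹
  s≉s⁻¹ p = power≉ε 2 (s≤s z≤n) 2≤r (≈-trans (inj₁ (cong (s ∙_) (identityʳ s))) (≈-trans (≈-∙ˡ s p) (inj₁ (inverseʳ s))))

  s⁻¹≉ε : ¬ s ⁻¹ ≈ ε
  s⁻¹≉ε p = s≉ε (≈-trans (≈-sym (≈-trans (≈-∙ʳ s p) (inj₁ (identityˡ s)))) (inj₁ (inverseˡ s)))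

  t≈ε : t ≈ ε
  t≈ε = inj₂ (sym (identityˡ t))

  IsLetter : Fin N → Set
  IsLetter x = x ≡ s ⊎ x ≡ s ⁻¹ ⊎ (x ≡ t × x ≢ ε)

  isLetter? : ∀ x → Dec (IsLetter x)
  isLetter? x = (x Fin.≟ s) ⊎-dec (x Fin.≟ s ⁻¹) ⊎-dec ((x Fin.≟ t) ×-dec ¬? (x Fin.≟ ε))

  S : Subset N
  S = tabulate (does ∘ isLetter?)

  ∈S : ∀ {x} → IsLetter x → x ∈ S
  ∈S {x} l = lookup⇒[]= x S (trans (lookup∘tabulate (does ∘ isLetter?) x) (dec-true (isLetter? x) l))

  S∈ : ∀ {x} → x ∈ S → IsLetter x
  S∈ {x} x∈ = extract (isLetter? x) (trans (sym (lookup∘tabulate (does ∘ isLetter?) x)) ([]=⇒lookup x∈))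
    where
    extract : ∀ {P : Set} (d : Dec P) → does d ≡ true → P
    extract (yes p) _ = p

  generating : IsGeneratingSet Γ S
  generating = (λ ε∈ → not-ε (S∈ ε∈)) , (λ x x∈ → ∈S (inverse (S∈ x∈))) , spelled
    where
    not-ε : ¬ IsLetter ε
    not-ε (inj₁ e) = s≉ε (inj₁ (sym e))
    not-ε (inj₂ (inj₁ e)) = s⁻¹≉ε (inj₁ (sym e))
    not-ε (inj₂ (inj₂ (_ , n))) = n refl
    inverse : ∀ {x} → IsLetter x → IsLetter (x ⁻¹)
    inverse (inj₁ refl) = inj₂ (inj₁ refl)
    inverse (inj₂ (inj₁ refl)) = inj₁ (⁻¹-involutive s)
    inverse (inj₂ (inj₂ (refl , n))) = inj₂ (inj₂ (t⁻¹ , n ∘ trans (sym t⁻¹)))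
    repeated : ∀ k l → All (_∈ S) l → Σ (List (Fin N)) λ l′ → All (_∈ S) l′ × prod Γ l′ ≡ power s k ∙ prod Γ l
    repeated zero l l∈ = l , l∈ , sym (identityˡ _)
    repeated (suc k) l l∈ = let (l′ , l′∈ , e) = repeated k l l∈ in
      s ∷ l′ , ∈S (inj₁ refl) ∷ l′∈ , trans (cong (s ∙_) e) (sym (assoc _ _ _))
    spelled : ∀ g → Σ (List (Fin N)) λ l → All (_∈ S) l × prod Γ l ≡ g
    spelled g with reps g
    ... | k , inj₁ e = let (l , l∈ , e′) = repeated k [] [] in l , l∈ , trans e′ (trans (identityʳ _) (sym e))
    ... | k , inj₂ e with t Fin.≟ ε
    ...   | yes t≡ε = let (l , l∈ , e′) = repeated k [] [] in l , l∈ , trans e′ (trans (cong (power s k ∙_) (sym t≡ε)) (sym e))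
    ...   | no t≢ε = let (l , l∈ , e′) = repeated k (t ∷ []) (∈S (inj₂ (inj₂ (refl , t≢ε))) ∷ []) in
      l , l∈ , trans e′ (trans (cong (power s k ∙_) (identityʳ t)) (sym e))

  graph : CayleyGraph
  graph = record { Γ = Γ ; S = S ; gen = generating ; r = r ; 2≤r = 2≤r }

  open WalkWords graph

  data Kind (x : Fin N) : Set where
    up   : x ≡ s → Kind x
    down : x ≡ s ⁻¹ → Kind x
    flat : x ≡ t → Kind x

  kind : (a : Letter) → Kind (proj₁ a)
  kind (x , x∈) with x Fin.≟ s | x Fin.≟ s ⁻¹
  ... | yes e | _ = up e
  ... | no _ | yes e = down e
  ... | no n | no n′ = [ ⊥-elim ∘ n , [ ⊥-elim ∘ n′ , flat ∘ proj₁ ]′ ]′ (S∈ x∈)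

  -- The height of a word is their difference. Keeping the two counts apart avoids integers and
  -- bounds both by the length of the word.
  ups downs : Word → ℕ
  ups [] = 0
  ups (a ∷ w) with kind a
  ... | up _ = suc (ups w)
  ... | down _ = ups w
  ... | flat _ = ups w
  downs [] = 0
  downs (a ∷ w) with kind a
  ... | up _ = downs w
  ... | down _ = suc (downs w)
  ... | flat _ = downs w

  ups-++ : ∀ u w → ups (u ++ w) ≡ ups u + ups w
  ups-++ [] w = refl
  ups-++ (a ∷ u) w with kind a
  ... | up _ = cong suc (ups-++ u w)
  ... | down _ = ups-++ u w
  ... | flat _ = ups-++ u w

  downs-++ : ∀ u w → downs (u ++ w) ≡ downs u + downs w
  downs-++ [] w = refl
  downs-++ (a ∷ u) w with kind a
  ... | up _ = downs-++ u w
  ... | down _ = cong suc (downs-++ u w)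
  ... | flat _ = downs-++ u w

  ups+downs≤length : ∀ w → ups w + downs w ≤ length w
  ups+downs≤length [] = z≤n
  ups+downs≤length (a ∷ w) with kind a
  ... | up _ = s≤s (ups+downs≤length w)
  ... | down _ = ℕ.≤-trans (ℕ.≤-reflexive (ℕ.+-suc (ups w) (downs w))) (s≤s (ups+downs≤length w))
  ... | flat _ = ℕ.m≤n⇒m≤1+n (ups+downs≤length w)

  ev-height : ∀ w → ev w ∙ power s (downs w) ≈ power s (ups w)
  ev-height [] = inj₁ (identityʳ ε)
  ev-height (a ∷ w) with kind a
  ... | up refl = ≈-trans (inj₁ (assoc _ _ _)) (≈-∙ˡ s (ev-height w))
  ... | down refl = ≈-trans (inj₁ eq) (ev-height w)
    where
    d = power s (downs w)
    eq : s ⁻¹ ∙ ev w ∙ (s ∙ d) ≡ ev w ∙ d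
    eq = trans (solve (s ∷ᵥ ev w ∷ᵥ d ∷ᵥ []ᵥ) (x₀ ⁻ ⊙ x₁ ⊙ (x₀ ⊙ x₂)) (x₀ ⁻ ⊙ (x₁ ⊙ x₀) ⊙ x₂) refl)
      (trans (cong (λ y → s ⁻¹ ∙ y ∙ d) (s-central (ev w))) (solve (s ∷ᵥ ev w ∷ᵥ d ∷ᵥ []ᵥ) (x₀ ⁻ ⊙ (x₀ ⊙ x₁) ⊙ x₂) (x₁ ⊙ x₂) refl))
  ... | flat refl = ≈-trans (inj₁ (assoc _ _ _)) (≈-trans (≈-∙ʳ _ t≈ε) (≈-trans (inj₁ (identityˡ _)) (ev-height w)))

  -- The powers of `s` with exponents `downs c` and `ups c` agree modulo t. Both exponents are at
  -- most r, where powers are distinct modulo t.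
  balanced : ∀ c → length c ≤ r → ev c ≡ ε → ups c ≡ downs c
  balanced c le eq = sym (powers-distinct (downs c) (ups c) (ℕ.≤-trans (ℕ.m≤n+m _ (ups c)) bound′) (ℕ.≤-trans (ℕ.m≤m+n _ _) bound′)
    (≈-trans (inj₁ (sym (trans (cong (_∙ power s (downs c)) eq) (identityˡ _)))) (ev-height c)))
    where
    bound′ : ups c + downs c ≤ r
    bound′ = ℕ.≤-trans (ups+downs≤length c) le

  -- The local separator of the standard Cayley graph

  open Walks (CayAdj Γ S)
  open LocalSep (CayAdj Γ S) r

  -- Heights live on a cycle in Γ; the bound h ≤ r/2 keeps the positive half of a ball distinct from
  -- its negative half.
  Positive : Fin N → Set
  Positive y = Σ ℕ λ h → 0 < h × h + h ≤ r × y ≈ power s h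

  Closed : Word → Set
  Closed c = length c ≤ r × ev c ≡ ε

  arc-height : ∀ d e → Closed (d ++ e) → ups d + ups e ≡ downs d + downs e
  arc-height d e (le , eq) = trans (sym (ups-++ d e)) (trans (balanced (d ++ e) le eq) (downs-++ d e))

  -- The height gained on one arc of a closed walk is lost on the other, so it is paid for twice
  -- within the length r.
  twice≤r : ∀ d e {h} → Closed (d ++ e) → h ≤ ups d + downs d → h ≤ ups e + downs e → h + h ≤ r
  twice≤r d e (le , _) hd he = ℕ.≤-trans (ℕ.+-mono-≤ (ℕ.≤-trans hd (ups+downs≤length d)) (ℕ.≤-trans he (ups+downs≤length e)))
    (subst (_≤ r) (List.length-++ d) le)

  ev-up : ∀ d → downs d ≤ ups d → ev d ≈ power s (ups d ∸ downs d)
  ev-up d le = ≈-cancelʳ (power s (downs d)) (≈-trans (ev-height d)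
    (inj₁ (trans (cong (power s) (sym (ℕ.m∸n+n≡m le))) (power-+ s (ups d ∸ downs d) (downs d)))))

  ev-down : ∀ d → ups d ≤ downs d → ev d ∙ power s (downs d ∸ ups d) ≈ ε
  ev-down d le = ≈-cancelʳ (power s (ups d)) (≈-trans (inj₁ (trans (assoc _ _ _)
    (cong (ev d ∙_) (trans (sym (power-+ s (downs d ∸ ups d) (ups d))) (cong (power s) (ℕ.m∸n+n≡m le))))))
    (≈-trans (ev-height d) (inj₁ (sym (identityˡ _)))))

  up⇒positive : ∀ d e → Closed (d ++ e) → downs d < ups d → Positive (ev d)
  up⇒positive d e cl lt = ups d ∸ downs d , ℕ.m<n⇒0<n∸m lt ,
    twice≤r d e cl (ℕ.≤-trans (ℕ.m∸n≤m (ups d) (downs d)) (ℕ.m≤m+n _ _))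
      (ℕ.≤-trans (ℕ.m≤n+o⇒m∸n≤o (ups d) (downs d) (ℕ.≤-trans (ℕ.m≤m+n _ (ups e)) (ℕ.≤-reflexive (arc-height d e cl)))) (ℕ.m≤n+m _ _)) ,
    ev-up d (ℕ.<⇒≤ lt)

  -- If the arc ended at height -k instead, then k ≤ r/2 as well, and the power of `s` with exponent
  -- h + k ≤ r would be trivial modulo t.
  positive⇒up : ∀ d e → Closed (d ++ e) → Positive (ev d) → downs d < ups d
  positive⇒up d e cl (h , 0<h , 2h≤r , p) = ℕ.≰⇒> λ le →
    let k = downs d ∸ ups d
        2k≤r : k + k ≤ r
        2k≤r = twice≤r d e cl (ℕ.≤-trans (ℕ.m∸n≤m (downs d) (ups d)) (ℕ.m≤n+m _ _))
          (ℕ.≤-trans (ℕ.m≤n+o⇒m∸n≤o (downs d) (ups d) (ℕ.≤-trans (ℕ.m≤m+n _ (downs e)) (ℕ.≤-reflexive (sym (arc-height d e cl))))) (ℕ.m≤m+n _ _))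
    in power≉ε (h + k) (ℕ.<-≤-trans 0<h (ℕ.m≤m+n h k)) (mean h k 2h≤r 2k≤r)
         (≈-trans (inj₁ (power-+ s h k)) (≈-trans (≈-∙ʳ (power s k) (≈-sym p)) (ev-down d le)))
    where
    mean : ∀ h k → h + h ≤ r → k + k ≤ r → h + k ≤ r
    mean h k hh kk with ℕ.≤-total h k
    ... | inj₁ h≤k = ℕ.≤-trans (ℕ.+-monoˡ-≤ k h≤k) kk
    ... | inj₂ k≤h = ℕ.≤-trans (ℕ.+-monoʳ-≤ h k≤h) hh

  flat⇒≈ε : ∀ d → ups d ≡ downs d → ev d ≈ ε
  flat⇒≈ε d eq = ≈-trans (ev-up d (ℕ.≤-reflexive (sym eq))) (inj₁ (cong (power s) (trans (cong (_∸ downs d) eq) (ℕ.n∸n≡0 (downs d)))))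

  letter-height : ∀ a → ups (a ∷ []) ≤ 1 × downs (a ∷ []) ≤ 1
  letter-height a = ℕ.≤-trans (ℕ.m≤m+n _ _) (ups+downs≤length (a ∷ [])) , ℕ.≤-trans (ℕ.m≤n+m _ (ups (a ∷ []))) (ups+downs≤length (a ∷ []))

  forward : ∀ d a → downs d < ups d → downs (d ++ a ∷ []) ≤ ups (d ++ a ∷ [])
  forward d a lt = ≡.subst₂ _≤_ (sym (downs-++ d _)) (sym (ups-++ d _))
    (ℕ.≤-trans (ℕ.+-monoʳ-≤ (downs d) (proj₂ (letter-height a))) (ℕ.≤-trans (ℕ.≤-reflexive (ℕ.+-comm (downs d) 1)) (ℕ.≤-trans lt (ℕ.m≤m+n _ _))))

  backward : ∀ d a → downs (d ++ a ∷ []) < ups (d ++ a ∷ []) → downs d ≤ ups d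
  backward d a lt = ℕ.≤-pred (ℕ.≤-trans (s≤s (ℕ.m≤m+n (downs d) (downs (a ∷ []))))
    (ℕ.≤-trans (≡.subst₂ _<_ (downs-++ d _) (ups-++ d _) lt)
    (ℕ.≤-trans (ℕ.+-monoʳ-≤ (ups d) (proj₁ (letter-height a))) (ℕ.≤-reflexive (ℕ.+-comm (ups d) 1)))))

  positive-resp : ∀ {x y} → x ≈ y → Positive x → Positive y
  positive-resp p (h , 0<h , 2h≤r , q) = h , 0<h , 2h≤r , ≈-trans (≈-sym p) q

  ▹-≈ : ∀ {v} d → v ≈ ε → v ▹ d ≈ ev d
  ▹-≈ {v} d p = ≈-trans (inj₁ (▹-ev v d)) (≈-trans (≈-∙ʳ (ev d) p) (inj₁ (identityˡ _)))

  edge-toWord : ∀ {x y p q} (W : Walk x y) → (p , q) LM.∈ edges W → Σ Word λ d → Σ Letter λ a → Σ Word λ e →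
    toWord W ≡ d ++ a ∷ e × x ▹ d ≡ p × x ▹ (d ++ a ∷ []) ≡ q
  edge-toWord ((s , s∈ , refl) ∷ W) (here refl) = [] , (s , s∈) , toWord W , refl , refl , refl
  edge-toWord ((s , s∈ , refl) ∷ W) (there h) = let (d , a , e , eq , eq′ , eq″) = edge-toWord W h in
    (s , s∈) ∷ d , a , e , cong (_ ∷_) eq , eq′ , eq″

  arcs : ∀ {v p q} (C : Walk v v) → len C ≤ r → (p , q) LM.∈ edges C → Σ Word λ d → Σ Letter λ a → Σ Word λ e →
    Closed (d ++ a ∷ e) × Closed ((d ++ a ∷ []) ++ e) × v ▹ d ≡ p × v ▹ (d ++ a ∷ []) ≡ q
  arcs {v} C le h = let
      (d , a , e , eq , eqs) = edge-toWord C h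
      cl = subst Closed eq (subst (_≤ r) (sym (length-toWord C)) le , ▹-injective v {toWord C} {[]} (▹-toWord C))
    in d , a , e , cl , subst Closed (sym (List.++-assoc d _ e)) cl , eqs

  -- An edge changes the height by at most one, so positivity can be lost only at height 0, that is,
  -- at a vertex that is trivial modulo t. The ball may be centred at ε or at t.
  ball-step : ∀ {v y z} → v ≈ ε → BallEdge v y z → ¬ z ≈ ε → Positive y → Positive z
  ball-step v≈ε (C , le , inj₁ h) nz py with arcs C le h
  ... | d , a , e , cl , cl′ , refl , refl = positive-resp (≈-sym (▹-≈ (d ++ a ∷ []) v≈ε)) (up⇒positive (d ++ a ∷ []) e cl′
    (ℕ.≤∧≢⇒< (forward d a (positive⇒up d (a ∷ e) cl (positive-resp (▹-≈ d v≈ε) py)))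
      λ e → nz (≈-trans (▹-≈ (d ++ a ∷ []) v≈ε) (flat⇒≈ε (d ++ a ∷ []) (sym e)))))
  ball-step v≈ε (C , le , inj₂ h) nz py with arcs C le h
  ... | d , a , e , cl , cl′ , refl , refl = positive-resp (≈-sym (▹-≈ d v≈ε)) (up⇒positive d (a ∷ e) cl
    (ℕ.≤∧≢⇒< (backward d a (positive⇒up (d ++ a ∷ []) e cl′ (positive-resp (▹-≈ (d ++ a ∷ []) v≈ε) py)))
      λ e → nz (≈-trans (▹-≈ d v≈ε) (flat⇒≈ε d (sym e)))))

  ball-star : ∀ {v D y z} → v ≈ ε → (∀ {x} → x ≈ ε → x LM.∈ D) → Star (BallStep v D) y z → Positive y → Positive z
  ball-star v≈ε D⊇ Star.ε p = p
  ball-star v≈ε D⊇ ((edge , _ , z∉) ◅ σ) p = ball-star v≈ε D⊇ σ (ball-step v≈ε edge (z∉ ∘ D⊇) p)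

  s-positive : Positive s
  s-positive = 1 , s≤s z≤n , 2≤r , inj₁ (sym (identityʳ s))

  s⁻¹-negative : ¬ Positive (s ⁻¹)
  s⁻¹-negative (h , 0<h , 2h≤r , p) = power≉ε (suc h) (s≤s z≤n) (ℕ.≤-trans (ℕ.+-monoˡ-≤ h 0<h) 2h≤r)
    (≈-trans (≈-∙ˡ s (≈-sym p)) (inj₁ (inverseʳ s)))

  ls lb : Letter
  ls = s , ∈S (inj₁ refl)
  lb = s ⁻¹ , ∈S (inj₂ (inj₁ refl))

  local-separator : HasLocalSeparator≤2
  local-separator with t Fin.≟ ε
  ... | yes t≡ε = inj₁ (ε , s , s ⁻¹ ,
      subst (InBall ε) (identityˡ s) (in-ball ε (ls ∷ []) (lb ∷ []) (2≤r , trans (cong (s ∙_) (identityʳ _)) (inverseʳ s))) ,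
      subst (InBall ε) (identityˡ (s ⁻¹)) (in-ball ε (lb ∷ []) (ls ∷ []) (2≤r , trans (cong (s ⁻¹ ∙_) (identityʳ _)) (inverseˡ s))) ,
      (λ e → s≉ε (inj₁ e)) , (λ e → s⁻¹≉ε (inj₁ e)) ,
      λ σ → s⁻¹-negative (ball-star (inj₁ refl) single σ s-positive))
    where
    single : ∀ {x} → x ≈ ε → x LM.∈ ε ∷ []
    single (inj₁ e) = here e
    single (inj₂ e) = here (trans e (trans (identityˡ t) t≡ε))
  ... | no t≢ε = inj₂ (ε , t , (λ e → t≢ε (sym e)) ,
      (s , s ⁻¹ , nbhd-s , nbhd-s⁻¹ , λ σ → s⁻¹-negative (star σ s-positive)) ,
      (t , ∈S (inj₂ (inj₂ (refl , t≢ε))) , sym (identityˡ t)) ∷ [] , 2≤r)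
    where
    nbhd-s : InNbhd ε t s
    nbhd-s = (λ e → s≉ε (inj₁ e)) , (λ e → s≉ε (≈-trans (inj₁ e) t≈ε)) , inj₁ (s , proj₂ ls , sym (identityˡ s))
    nbhd-s⁻¹ : InNbhd ε t (s ⁻¹)
    nbhd-s⁻¹ = (λ e → s⁻¹≉ε (inj₁ e)) , (λ e → s⁻¹≉ε (≈-trans (inj₁ e) t≈ε)) , inj₁ (s ⁻¹ , proj₂ lb , sym (identityˡ _))
    double : ∀ {x} → x ≈ ε → x LM.∈ ε ∷ t ∷ []
    double (inj₁ e) = here e
    double (inj₂ e) = there (here (trans e (identityˡ t)))
    star : ∀ {y z} → Star (ConnAdj ε t) y z → Positive y → Positive z
    star Star.ε p = p
    star ((_ , _ , inj₁ (_ , _ , _ , _ , σ)) ◅ τ) p = star τ (ball-star (inj₁ refl) double σ p)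
    star ((_ , _ , inj₂ (_ , _ , _ , _ , σ)) ◅ τ) p = star τ (ball-star t≈ε double σ p)

  condII : CondII Γ r
  condII = S , generating , local-separator , r<N

  -- Two ends in the cover of the standard Cayley graph

  open LocalCover (CayAdj Γ S) ε r
  open Ends _≈ᶜ_ CAdj
  open Cover graph

  -- Equality of the differences of `ups` and `downs`, with the subtractions moved across.
  SameHeight : Word → Word → Set
  SameHeight u w = ups u + downs w ≡ ups w + downs u

  same-height-delete : ∀ {u w} → Delete u w → SameHeight u w
  same-height-delete (delete u c t le eq) = begin
    ups (u ++ c ++ t) + downs (u ++ t)               ≡⟨ cong₂ _+_ (trans (ups-++ u _) (cong (ups u +_) (ups-++ c t))) (downs-++ u t) ⟩
    (ups u + (ups c + ups t)) + (downs u + downs t)   ≡⟨ cong (λ k → (ups u + (k + ups t)) + (downs u + downs t)) (balanced c le eq) ⟩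
    (ups u + (downs c + ups t)) + (downs u + downs t) ≡⟨ rearrange (ups u) (downs c) (ups t) (downs u) (downs t) ⟩
    (ups u + ups t) + (downs u + (downs c + downs t)) ≡⟨ cong₂ _+_ (sym (ups-++ u t)) (sym (trans (downs-++ u _) (cong (downs u +_) (downs-++ c t)))) ⟩
    ups (u ++ t) + downs (u ++ c ++ t) ∎
    where
    open ≡.≡-Reasoning
    open +-*-Solver using (_:+_; _:=_) renaming (solve to solveℕ)
    rearrange : ∀ a b c d e → (a + (b + c)) + (d + e) ≡ (a + c) + (d + (b + e))
    rearrange = solveℕ 5 (λ a b c d e → (a :+ (b :+ c)) :+ (d :+ e) := (a :+ c) :+ (d :+ (b :+ e))) refl

  same-height-trans : ∀ {u w z} → SameHeight u w → SameHeight w z → SameHeight u z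
  same-height-trans {u} {w} {z} p q = ℕ.+-cancelʳ-≡ (ups w + downs w) _ _ (begin
    (ups u + downs z) + (ups w + downs w) ≡⟨ shuffle₁ (ups u) (downs z) (ups w) (downs w) ⟩
    (ups u + downs w) + (ups w + downs z) ≡⟨ cong₂ _+_ p q ⟩
    (ups w + downs u) + (ups z + downs w) ≡⟨ shuffle₂ (ups w) (downs u) (ups z) (downs w) ⟩
    (ups z + downs u) + (ups w + downs w) ∎)
    where
    open ≡.≡-Reasoning
    open +-*-Solver using (_:+_; _:=_) renaming (solve to solveℕ)
    shuffle₁ : ∀ a b c d → (a + b) + (c + d) ≡ (a + d) + (c + b)
    shuffle₁ = solveℕ 4 (λ a b c d → (a :+ b) :+ (c :+ d) := (a :+ d) :+ (c :+ b)) refl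
    shuffle₂ : ∀ a b c d → (a + b) + (c + d) ≡ (c + b) + (a + d)
    shuffle₂ = solveℕ 4 (λ a b c d → (a :+ b) :+ (c :+ d) := (c :+ b) :+ (a :+ d)) refl

  same-height : ∀ {u w} → u ~ w → SameHeight u w
  same-height = EqC.fold (record { refl = refl ; sym = sym ; trans = λ {u} {w} {z} → same-height-trans {u} {w} {z} }) same-height-delete

  High : Word → Set
  High w = downs w < ups w

  high-~ : ∀ {u w} → u ~ w → High u → High w
  high-~ {u} {w} e h = ℕ.≰⇒> λ le → ℕ.<⇒≱ h (ℕ.+-cancelʳ-≤ (downs w) (ups u) (downs u)
    (ℕ.≤-trans (ℕ.≤-reflexive (same-height e)) (ℕ.≤-trans (ℕ.+-monoˡ-≤ (downs u) le) (ℕ.≤-reflexive (ℕ.+-comm (downs w) (downs u))))))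

  kind-s : ∀ {a} → proj₁ a ≡ s → ∀ w → ups (a ∷ w) ≡ suc (ups w) × downs (a ∷ w) ≡ downs w
  kind-s {a} eq w with kind a
  ... | up _ = refl , refl
  ... | down e = ⊥-elim (s≉s⁻¹ (inj₁ (trans (sym eq) e)))
  ... | flat e = ⊥-elim (s≉ε (≈-trans (inj₁ (trans (sym eq) e)) t≈ε))

  kind-s⁻¹ : ∀ {a} → proj₁ a ≡ s ⁻¹ → ∀ w → ups (a ∷ w) ≡ ups w × downs (a ∷ w) ≡ suc (downs w)
  kind-s⁻¹ {a} eq w with kind a
  ... | up e = ⊥-elim (s≉s⁻¹ (inj₁ (trans (sym e) eq)))
  ... | down _ = refl , refl
  ... | flat e = ⊥-elim (s⁻¹≉ε (≈-trans (inj₁ (trans (sym eq) e)) t≈ε))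

  kind-t : ∀ {a} → proj₁ a ≡ t → ∀ w → ups (a ∷ w) ≡ ups w × downs (a ∷ w) ≡ downs w
  kind-t {a} eq w with kind a
  ... | up e = ⊥-elim (s≉ε (≈-trans (inj₁ (trans (sym e) eq)) t≈ε))
  ... | down e = ⊥-elim (s⁻¹≉ε (≈-trans (inj₁ (trans (sym e) eq)) t≈ε))
  ... | flat _ = refl , refl

  height-s : ∀ k w → ups (replicate k ls ++ w) ≡ k + ups w × downs (replicate k ls ++ w) ≡ downs w
  height-s zero w = refl , refl
  height-s (suc k) w = let (e , e′) = kind-s {ls} refl (replicate k ls ++ w) ; (f , f′) = height-s k w in
    trans e (cong suc f) , trans e′ f′

  height-s⁻¹ : ∀ k w → ups (replicate k lb ++ w) ≡ ups w × downs (replicate k lb ++ w) ≡ k + downs w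
  height-s⁻¹ zero w = refl , refl
  height-s⁻¹ (suc k) w = let (e , e′) = kind-s⁻¹ {lb} refl (replicate k lb ++ w) ; (f , f′) = height-s⁻¹ k w in
    trans e f , trans e′ (cong suc f′)

  data Tail : Word → Set where
    none : Tail []
    one  : ∀ a → proj₁ a ≡ t → Tail (a ∷ [])

  tail-height : ∀ {τ} → Tail τ → ups τ ≡ 0 × downs τ ≡ 0
  tail-height none = refl , refl
  tail-height (one a e) = kind-t {a} e []

  -- A power of `s` followed by at most one `t`. Zero exponents belong to `rising`, hence the
  -- successor in `falling`.
  data Normal (w : Word) : Set where
    rising  : ∀ k {τ} → Tail τ → w ~ (replicate k ls ++ τ) → Normal w
    falling : ∀ k {τ} → Tail τ → w ~ (replicate (suc k) lb ++ τ) → Normal w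

  letter-~ : ∀ a b w → proj₁ a ≡ proj₁ b → (a ∷ w) ~ (b ∷ w)
  letter-~ a b w e = ~-++ʳ w (short-~ (a ∷ []) (b ∷ []) (cong (_∙ ε) e) 2≤r)

  cancel-~ : ∀ a b w → proj₁ a ∙ proj₁ b ≡ ε → (a ∷ b ∷ w) ~ w
  cancel-~ a b w e = del [] (a ∷ b ∷ []) w 2≤r (trans (cong (proj₁ a ∙_) (identityʳ _)) e)

  -- Exchanging t with one letter is a relation of length 4, available in the cover because 4 ≤ r.
  commute-~ : ∀ a b k w → proj₁ a ≡ t → (a ∷ replicate k b ++ w) ~ (replicate k b ++ a ∷ w)
  commute-~ a b zero w e = ~-refl
  commute-~ a b (suc k) w e = ~-trans (~-++ʳ (replicate k b ++ w) (short-~ (a ∷ b ∷ []) (b ∷ a ∷ [])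
      (trans (cong (proj₁ a ∙_) (identityʳ _)) (trans (trans (cong (_∙ proj₁ b) e) (trans (sym (central (proj₁ b))) (cong (proj₁ b ∙_) (sym e))))
        (cong (proj₁ b ∙_) (sym (identityʳ _))))) 4≤r))
    (~-++ˡ (b ∷ []) (commute-~ a b k w e))

  add-tail : ∀ a {τ} → proj₁ a ≡ t → Tail τ → Σ Word λ τ′ → Tail τ′ × (a ∷ τ) ~ τ′
  add-tail a e none = a ∷ [] , one a e , ~-refl
  add-tail a e (one b e′) = [] , none , cancel-~ a b [] (trans (cong₂ _∙_ e e′) t²)

  normal : ∀ w → Normal w
  normal [] = rising 0 none ~-refl
  normal (a ∷ w) with kind a | normal w
  ... | up e | rising k τ p = rising (suc k) τ (~-trans (~-++ˡ (a ∷ []) p) (letter-~ a ls _ e))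
  ... | up e | falling zero τ p = rising 0 τ (~-trans (~-++ˡ (a ∷ []) p) (cancel-~ a lb _ (trans (cong (_∙ s ⁻¹) e) (inverseʳ s))))
  ... | up e | falling (suc k) τ p = falling k τ (~-trans (~-++ˡ (a ∷ []) p) (cancel-~ a lb _ (trans (cong (_∙ s ⁻¹) e) (inverseʳ s))))
  ... | down e | rising zero τ p = falling 0 τ (~-trans (~-++ˡ (a ∷ []) p) (letter-~ a lb _ e))
  ... | down e | rising (suc k) τ p = rising k τ (~-trans (~-++ˡ (a ∷ []) p) (cancel-~ a ls _ (trans (cong (_∙ s) e) (inverseˡ s))))
  ... | down e | falling k τ p = falling (suc k) τ (~-trans (~-++ˡ (a ∷ []) p) (letter-~ a lb _ e))
  ... | flat e | rising k {τ₀} τ p = let (_ , τ′ , q) = add-tail a e τ in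
    rising k τ′ (~-trans (~-++ˡ (a ∷ []) p) (~-trans (commute-~ a ls k τ₀ e) (~-++ˡ (replicate k ls) q)))
  ... | flat e | falling k {τ₀} τ p = let (_ , τ′ , q) = add-tail a e τ in
    falling k τ′ (~-trans (~-++ˡ (a ∷ []) p) (~-trans (commute-~ a lb (suc k) τ₀ e) (~-++ˡ (replicate (suc k) lb) q)))

  -- The height of a normal form is its signed exponent, so at height 0 only the tail remains. Hence
  -- there are at most two vertices at height 0.
  ground : ∀ w → ups w ≡ downs w → Σ Word λ τ → Tail τ × w ~ τ
  ground w eq = case normal w of λ
    { (rising zero {τ₀} τ p) → τ₀ , τ , p
    ; (rising (suc k) {τ₀} τ p) → ⊥-elim (ℕ.<-irrefl (sym eq) (high-~ (~-sym p)
        (let (e , e′) = height-s (suc k) τ₀ in ≡.subst₂ _<_ (sym (trans e′ (proj₂ (tail-height τ)))) (sym e) (s≤s z≤n))))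
    ; (falling k {τ₀} τ p) → ⊥-elim (no-fall k τ p) }
    where
    no-fall : ∀ k {τ₀} → Tail τ₀ → ¬ w ~ (replicate (suc k) lb ++ τ₀)
    no-fall k {τ₀} τ p = let (e , e′) = height-s⁻¹ (suc k) τ₀ in
      case ℕ.+-cancelˡ-≡ (ups w) _ _ (trans (cong (ups w +_) (sym (trans e′ (cong (suc k +_) (proj₂ (tail-height τ))))))
        (trans (same-height p) (trans (cong₂ _+_ (trans e (proj₁ (tail-height τ))) (sym eq)) (sym (ℕ.+-identityʳ _))))) of λ ()

  rise fall : ℕ → CV
  rise k = cv (replicate k ls)
  fall k = cv (replicate k lb)

  height-rise : ∀ k → ups (replicate k ls) ≡ k × downs (replicate k ls) ≡ 0
  height-rise zero = refl , refl
  height-rise (suc k) = let (e , e′) = kind-s {ls} refl (replicate k ls) ; (f , f′) = height-rise k in trans e (cong suc f) , trans e′ f′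

  height-fall : ∀ k → ups (replicate k lb) ≡ 0 × downs (replicate k lb) ≡ k
  height-fall zero = refl , refl
  height-fall (suc k) = let (e , e′) = kind-s⁻¹ {lb} refl (replicate k lb) ; (f , f′) = height-fall k in trans e f , trans e′ (cong suc f′)

  replicate-snoc : ∀ k (a : Letter) → replicate (suc k) a ≡ replicate k a ++ a ∷ []
  replicate-snoc zero a = refl
  replicate-snoc (suc k) a = cong (a ∷_) (replicate-snoc k a)

  ray-step : ∀ a k → CAdj (cv (replicate k a)) (cv (replicate (suc k) a))
  ray-step a k = ~⇒adj {cv (replicate k a)} {cv (replicate (suc k) a)} a
    (~-trans (~-≡ (wd-cv (replicate (suc k) a))) (~-≡ (trans (replicate-snoc k a) (cong (_++ a ∷ []) (sym (wd-cv (replicate k a)))))))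

  cv-~ : ∀ {u w} → cv u ≈ᶜ cv w → u ~ w
  cv-~ {u} {w} e = ≡.subst₂ _~_ (wd-cv u) (wd-cv w) (≈⇒~ e)

  rise-ray : IsRay rise
  rise-ray = ray-step ls , λ i j e → let (u , d) = height-rise i ; (u′ , d′) = height-rise j in
    trans (sym (trans (cong₂ _+_ u d′) (ℕ.+-identityʳ i))) (trans (same-height (cv-~ {replicate i ls} {replicate j ls} e)) (trans (cong₂ _+_ u′ d) (ℕ.+-identityʳ j)))

  fall-ray : IsRay fall
  fall-ray = ray-step lb , λ i j e → let (u , d) = height-fall i ; (u′ , d′) = height-fall j in
    sym (trans (sym (cong₂ _+_ u d′)) (trans (same-height (cv-~ {replicate i lb} {replicate j lb} e)) (cong₂ _+_ u′ d)))

  -- X consists of the vertices of the cover at height 0.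
  module _ (X : List CV) (at-ground : ∀ {c} → ups (wd c) ≡ downs (wd c) → ¬ Avoids X c)
           (off-ground : ∀ {c} → ups (wd c) ≢ downs (wd c) → Avoids X c) where
    -- An edge changes the height by at most one, so a walk cannot descend without a vertex at
    -- height 0, and all of these are in `X`.
    stays-high : ∀ {c c′} → Star (StepAvoiding X) c c′ → High (wd c) → High (wd c′)
    stays-high Star.ε h = h
    stays-high (_◅_ {c} {c′} (_ , av , inj₂ e) σ) h = stays-high σ (high-~ (≈⇒~ e) h)
    stays-high (_◅_ {c} {c′} (_ , av , inj₁ adj) σ) h = let (a , e) = adj⇒~ {c} {c′} adj in
      stays-high σ (next a e (forward (wd c) a h))
      where
      next : ∀ a → wd c′ ~ (wd c ++ a ∷ []) → downs (wd c ++ a ∷ []) ≤ ups (wd c ++ a ∷ []) → High (wd c′)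
      next a e le with downs (wd c ++ a ∷ []) ℕ.≟ ups (wd c ++ a ∷ [])
      ... | no n = high-~ (~-sym e) (ℕ.≤∧≢⇒< le n)
      ... | yes eq = ⊥-elim (at-ground {c′} (ℕ.+-cancelʳ-≡ (downs (wd c ++ a ∷ [])) _ _
          (trans (same-height e) (trans (cong (_+ downs (wd c′)) (sym eq)) (ℕ.+-comm _ (downs (wd c′)))))) av)

    separated : SeparatedBy rise fall X
    separated = 1 , λ m k 1≤m 1≤k →
      off-ground (λ e → ℕ.<-irrefl (sym e) (high m 1≤m)) ,
      off-ground (λ e → ℕ.<-irrefl e (low k 1≤k)) ,
      λ σ → ℕ.<-asym (low k 1≤k) (stays-high σ (high m 1≤m))
      where
      high : ∀ m → 1 ≤ m → High (wd (rise m))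
      high m 1≤m = subst High (sym (wd-cv (replicate m ls))) (let (e , e′) = height-rise m in ≡.subst₂ _<_ (sym e′) (sym e) 1≤m)
      low : ∀ k → 1 ≤ k → ups (wd (fall k)) < downs (wd (fall k))
      low k 1≤k = subst (λ w → ups w < downs w) (sym (wd-cv (replicate k lb))) (let (e , e′) = height-fall k in ≡.subst₂ _<_ (sym e) (sym e′) 1≤k)

  avoids-flat : ∀ {c} w → ups w ≡ downs w → ups (wd c) ≢ downs (wd c) → ¬ c ≈ᶜ cv w
  avoids-flat {c} w eq n e = n (ℕ.+-cancelʳ-≡ (downs w) _ _
    (trans (same-height (subst (wd c ~_) (wd-cv w) (≈⇒~ e))) (trans (cong (_+ downs (wd c)) eq) (ℕ.+-comm (downs w) _))))

  flat-≈ : ∀ {c} w → wd c ~ w → c ≈ᶜ cv w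
  flat-≈ {c} w e = wd-≈ (~-trans e (~-≡ (sym (wd-cv w))))

  two-ends : TwoEndsSeparatedBy≤2
  two-ends with t Fin.≟ ε
  ... | yes t≡ε = rise , fall , rise-ray , fall-ray , X , s≤s z≤n ,
      separated X (λ {c} eq av → clash c (ground (wd c) eq) av) (λ {c} n → avoids-flat {c} [] refl n ∷ [])
    where
    X : List CV
    X = cv [] ∷ []
    clash : ∀ c → (Σ Word λ τ → Tail τ × wd c ~ τ) → ¬ Avoids X c
    clash c (_ , none , e) (n ∷ []) = n (flat-≈ [] e)
    clash c (_ , one (x , x∈) x≡t , e) _ = proj₁ generating (subst (_∈ S) (trans x≡t t≡ε) x∈)
  ... | no t≢ε = rise , fall , rise-ray , fall-ray , X , s≤s (s≤s z≤n) ,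
      separated X (λ {c} eq av → clash c (ground (wd c) eq) av)
        (λ {c} n → avoids-flat {c} [] refl n ∷ avoids-flat {c} (lt ∷ []) (let (e , e′) = kind-t {lt} refl [] in trans e (sym e′)) n ∷ [])
    where
    lt : Letter
    lt = t , ∈S (inj₂ (inj₂ (refl , t≢ε)))
    X : List CV
    X = cv [] ∷ cv (lt ∷ []) ∷ []
    clash : ∀ c → (Σ Word λ τ → Tail τ × wd c ~ τ) → ¬ Avoids X c
    clash c (_ , none , e) (n ∷ _) = n (flat-≈ [] e)
    clash c (_ , one a a≡t , e) (_ ∷ n ∷ []) = n (flat-≈ (lt ∷ []) (~-trans e (letter-~ a lt [] a≡t)))

  condI : CondI Γ r
  condI = S , generating , two-ends

-- The cycle of implications

mainTheorem1 : (Γ : FinGroup) (n r : ℕ) → 1 ≤ n → NilpotentClass≤ Γ n →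
    4 ^ (n + 1) ≤ r → 20 ≤ r →
    (CondI Γ r → CondII Γ r) × (CondII Γ r → CondIII Γ r) × (CondIII Γ r → CondI Γ r)
-- The passage from (i) to (ii) goes through (iii), so the generating set in (ii) is the standard
-- one, not the one given in (i).
mainTheorem1 Γ n r 1≤n nilpotent 4ⁿ⁺¹≤r 20≤r = StandardGraph.condII Γ r 4≤r ∘ standard ∘ I⇒III , II⇒III , StandardGraph.condI Γ r 4≤r ∘ standard
  where
  4≤r : 4 ≤ r
  4≤r = ℕ.≤-trans (ℕ.m≤m+n 4 16) 20≤r

  2≤r : 2 ≤ r
  2≤r = ℕ.≤-trans (ℕ.m≤m+n 2 18) 20≤r

  standard : CondIII Γ r → StandardGenerators.Standard Γ r
  standard = StandardGenerators.III⇒standard Γ (ℕ.≤-trans (ℕ.m≤m+n 1 19) 20≤r)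

  module _ {S : Subset (FinGroup.N Γ)} (gen : IsGeneratingSet Γ S) where
    graph : CayleyGraph
    graph = record { Γ = Γ ; S = S ; gen = gen ; r = r ; 2≤r = 2≤r }

    separation⇒III : r < FinGroup.N Γ → ¬ ¬ Words.Separation graph → CondIII Γ r
    separation⇒III r<N σ =
      Product.structure⇒III Γ (Solve.fromSeparation Γ n r 1≤n nilpotent (bound n r 1≤n 4ⁿ⁺¹≤r 20≤r) 2≤r r<N S gen σ)

  I⇒III : CondI Γ r → CondIII Γ r
  I⇒III (S , gen , ends@(f , _ , f-ray , _)) =
    separation⇒III gen (Cover.ray⇒r<N (graph gen) {f} f-ray) (ret (Cover.ends-separation (graph gen) ends))

  II⇒III : CondII Γ r → CondIII Γ r
  II⇒III (S , gen , local , r<N) = separation⇒III gen r<N (FromLocal.local-separation (graph gen) local)
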